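{- Let $M$ be a loopless sparse paving matroid of rank $d$ on $m+d$ elements, with $m,d\geq 1$ and $\lambda$ circuit-hyperplanes. Then $M$ is degenerate if and only if either $$m=1,\quad d\geq 3\text{ is odd},\quad \lambda=1,$$ or $(m,d,\lambda)=(4,3,7)$.
   Context: A matroid of rank $d$ is paving if every circuit has at least $d$ elements; it is sparse paving if both it and its dual are paving. A circuit-hyperplane is a subset of the ground set that is both a circuit and a hyperplane. For a loopless matroid $M$, let $L(M)$ be its lattice of flats, $\chi_M(t)$ its characteristic polynomial and $\operatorname{rk}M$ its rank. The Kazhdan--Lusztig polynomials $P_M(t)\in\mathbb Z[t]$ of loopless matroids are uniquely determined by: (i) $P_M(t)=1$ if $\operatorname{rk}M=0$; (ii) $\deg P_M(t)<\operatorname{rk}M/2$ if $\operatorname{rk}M>0$; (iii) $t^{\operatorname{rk}M}P_M(t^{ -1})=\sum_{F\in L(M)}\chi_{M_F}(t)P_{M^F}(t)$, where $M_F$ is the restriction of $M$ to $F$ and $M^F$ is the contraction of $M$ by $F$. A loopless matroid $M$ of positive rank $d$ is non-degenerate if $\deg P_M(t)=\lfloor (d-1)/2\rfloor$, and degenerate otherwise. -}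

module Defs where

open import Data.Bool.Base using (true; false; if_then_else_)
import Data.Bool.Properties as Bool
open import Data.Fin.Base using (Fin)
open import Data.Fin.Properties using (all?)
open import Data.Fin.Subset
open import Data.Fin.Subset.Induction using (Acc; acc; ⊂-wellFounded)
open import Data.Fin.Subset.Properties
open import Data.Integer.Base as ℤ using (ℤ; 0ℤ; 1ℤ)
open import Data.List.Base using (List; []; _∷_; [_]; _++_; map; filter; foldr; replicate; upTo)
open import Data.Nat.Base
open import Data.Nat.Properties
open import Data.Nat.Tactic.RingSolver using (solve-∀)
open import Data.Product.Base using (_×_; _,_)
open import Data.Sum.Base using ([_,_]′)
open import Data.Vec.Base using (tabulate; []; _∷_; there)
open import Data.Vec.Properties using (≡-dec)
open import Function.Base using (_∘_)
open import Relation.Binary.PropositionalEquality using (_≡_; _≢_; refl; sym; trans; cong; cong₂; subst₂)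
open import Relation.Nullary.Decidable using (Dec; yes; no; does; map′; ¬?; _×-dec_; _→-dec_; decidable-stable)
open import Relation.Nullary.Negation using (¬_)
open import Relation.Unary using (Pred; Decidable)
open import Level using (0ℓ)

private
  variable
    n : ℕ

------------------------------------------------------------------------
-- Subsets of Fin n

subsets : ∀ n → List (Subset n)
subsets zero    = [ [] ]
subsets (suc n) = map (inside ∷_) (subsets n) ++ map (outside ∷_) (subsets n)

allSubsets? : {P : Pred (Subset n) 0ℓ} → Decidable P → Dec (∀ S → P S)
allSubsets? P? = map′
  (λ ¬∃ S → decidable-stable (P? S) (λ ¬p → ¬∃ (S , ¬p)))
  (λ ∀P (S , ¬p) → ¬p (∀P S))
  (¬? (anySubset? (¬? ∘ P?)))

∣∪∣+∣∩∣ : (p q : Subset n) → ∣ p ∪ q ∣ + ∣ p ∩ q ∣ ≡ ∣ p ∣ + ∣ q ∣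
∣∪∣+∣∩∣ []          []          = refl
∣∪∣+∣∩∣ (true  ∷ p) (true  ∷ q) = cong suc (trans (+-suc _ _)
                                   (trans (cong suc (∣∪∣+∣∩∣ p q)) (sym (+-suc _ _))))
∣∪∣+∣∩∣ (true  ∷ p) (false ∷ q) = cong suc (∣∪∣+∣∩∣ p q)
∣∪∣+∣∩∣ (false ∷ p) (true  ∷ q) = trans (cong suc (∣∪∣+∣∩∣ p q)) (sym (+-suc _ _))
∣∪∣+∣∩∣ (false ∷ p) (false ∷ q) = ∣∪∣+∣∩∣ p q

─-∪ : (r p q : Subset n) → r ─ (p ∪ q) ≡ (r ─ p) ∩ (r ─ q)
─-∪ []          []          []          = refl
─-∪ (_     ∷ r) (true  ∷ p) (_     ∷ q) = cong (_ ∷_) (─-∪ r p q)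
─-∪ (true  ∷ r) (false ∷ p) (true  ∷ q) = cong (_ ∷_) (─-∪ r p q)
─-∪ (false ∷ r) (false ∷ p) (true  ∷ q) = cong (_ ∷_) (─-∪ r p q)
─-∪ (true  ∷ r) (false ∷ p) (false ∷ q) = cong (_ ∷_) (─-∪ r p q)
─-∪ (false ∷ r) (false ∷ p) (false ∷ q) = cong (_ ∷_) (─-∪ r p q)

─-∩ : (r p q : Subset n) → r ─ (p ∩ q) ≡ (r ─ p) ∪ (r ─ q)
─-∩ []          []          []          = refl
─-∩ (_     ∷ r) (true  ∷ p) (_     ∷ q) = cong (_ ∷_) (─-∩ r p q)
─-∩ (true  ∷ r) (false ∷ p) (true  ∷ q) = cong (_ ∷_) (─-∩ r p q)
─-∩ (false ∷ r) (false ∷ p) (true  ∷ q) = cong (_ ∷_) (─-∩ r p q)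
─-∩ (true  ∷ r) (false ∷ p) (false ∷ q) = cong (_ ∷_) (─-∩ r p q)
─-∩ (false ∷ r) (false ∷ p) (false ∷ q) = cong (_ ∷_) (─-∩ r p q)

∪-least : {p q r : Subset n} → p ⊆ r → q ⊆ r → p ∪ q ⊆ r
∪-least p⊆r q⊆r = [ p⊆r , q⊆r ]′ ∘ x∈p∪q⁻ _ _

∪-monoˡ : {p q : Subset n} (r : Subset n) → p ⊆ q → p ∪ r ⊆ q ∪ r
∪-monoˡ {q = q} r p⊆q = ∪-least (p⊆p∪q r ∘ p⊆q) (q⊆p∪q q r)

─-∈⁻ : (p q : Subset n) → ∀ {x} → x ∈ p ─ q → x ∉ q
─-∈⁻ (_ ∷ p) (true  ∷ q) (there i) (there j) = ─-∈⁻ p q i j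
─-∈⁻ (_ ∷ p) (false ∷ q) (there i) (there j) = ─-∈⁻ p q i j

∸-submodular : ∀ {a b c d} k → k ≤ a → k ≤ b → k ≤ c → k ≤ d →
               a + b ≤ c + d → (a ∸ k) + (b ∸ k) ≤ (c ∸ k) + (d ∸ k)
∸-submodular {a} {b} {c} {d} k k≤a k≤b k≤c k≤d le =
  +-cancelʳ-≤ (k + k) _ _ (begin
    ((a ∸ k) + (b ∸ k)) + (k + k) ≡⟨ regroup k≤a k≤b ⟩
    a + b                         ≤⟨ le ⟩
    c + d                         ≡⟨ regroup k≤c k≤d ⟨
    ((c ∸ k) + (d ∸ k)) + (k + k) ∎)
  where
  open ≤-Reasoning
  shuffle : ∀ x y k → (x + y) + (k + k) ≡ (x + k) + (y + k)
  shuffle = solve-∀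
  regroup : ∀ {x y} → k ≤ x → k ≤ y → ((x ∸ k) + (y ∸ k)) + (k + k) ≡ x + y
  regroup {x} {y} k≤x k≤y =
    trans (shuffle (x ∸ k) (y ∸ k) k) (cong₂ _+_ (m∸n+n≡m k≤x) (m∸n+n≡m k≤y))

------------------------------------------------------------------------
-- Matroids

-- The ground set E is a subset of an ambient Fin n, so that minors need
-- no relabelling.  Only the values of rk on subsets of E are meaningful.

record Matroid (n : ℕ) : Set where
  field
    E         : Subset n
    rk        : Subset n → ℕ
    rk-card   : ∀ S → S ⊆ E → rk S ≤ ∣ S ∣
    rk-mono   : ∀ S T → S ⊆ T → T ⊆ E → rk S ≤ rk T
    rk-submod : ∀ S T → S ⊆ E → T ⊆ E → rk (S ∪ T) + rk (S ∩ T) ≤ rk S + rk T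

  rank : ℕ
  rank = rk E

  rk-∪ : ∀ S T → S ⊆ E → T ⊆ E → rk (S ∪ T) ≤ rk S + rk T
  rk-∪ S T S⊆E T⊆E = ≤-trans (m≤m+n _ _) (rk-submod S T S⊆E T⊆E)

  Independent : Subset n → Set
  Independent S = rk S ≡ ∣ S ∣

  IsCircuit : Subset n → Set
  IsCircuit C = C ⊆ E × ¬ Independent C × (∀ D → D ⊂ C → Independent D)

  IsFlat : Subset n → Set
  IsFlat F = F ⊆ E × (∀ e → e ∈ E → e ∉ F → rk F < rk (F ∪ ⁅ e ⁆))

  IsHyperplane : Subset n → Set
  IsHyperplane H = IsFlat H × suc (rk H) ≡ rank

  IsCircuitHyperplane : Subset n → Set
  IsCircuitHyperplane S = IsCircuit S × IsHyperplane S

  Loopless : Set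
  Loopless = ∀ e → e ∈ E → rk ⁅ e ⁆ ≢ 0

  Paving : Set
  Paving = ∀ C → IsCircuit C → rank ≤ ∣ C ∣

  closure : Subset n → Subset n
  closure S = tabulate λ e → does ((e ∈? E) ×-dec (rk (S ∪ ⁅ e ⁆) ≟ rk S))

  independent? : Decidable Independent
  independent? S = rk S ≟ ∣ S ∣

  isCircuit? : Decidable IsCircuit
  isCircuit? C = (C ⊆? E) ×-dec ¬? (independent? C)
    ×-dec allSubsets? (λ D → (D ⊂? C) →-dec independent? D)

  isFlat? : Decidable IsFlat
  isFlat? F = (F ⊆? E)
    ×-dec all? (λ e → (e ∈? E) →-dec (¬? (e ∈? F) →-dec (rk F <? rk (F ∪ ⁅ e ⁆))))

  isHyperplane? : Decidable IsHyperplane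
  isHyperplane? H = isFlat? H ×-dec (suc (rk H) ≟ rank)

  isCircuitHyperplane? : Decidable IsCircuitHyperplane
  isCircuitHyperplane? S = isCircuit? S ×-dec isHyperplane? S

  flats : List (Subset n)
  flats = filter isFlat? (subsets n)

  circuitHyperplanes : List (Subset n)
  circuitHyperplanes = filter isCircuitHyperplane? (subsets n)

open Matroid public

restrict : Matroid n → Subset n → Matroid n
restrict M F = record
  { E         = E M ∩ F
  ; rk        = rk M
  ; rk-card   = λ S S⊆ → rk-card M S (p∩q⊆p _ _ ∘ S⊆)
  ; rk-mono   = λ S T S⊆T T⊆ → rk-mono M S T S⊆T (p∩q⊆p _ _ ∘ T⊆)
  ; rk-submod = λ S T S⊆ T⊆ → rk-submod M S T (p∩q⊆p _ _ ∘ S⊆) (p∩q⊆p _ _ ∘ T⊆)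
  }

contract : Matroid n → Subset n → Matroid n
contract {n} M F = record
  { E         = E M ─ F
  ; rk        = λ S → rk M (S ∪ F′) ∸ rk M F′
  ; rk-card   = λ S S⊆ → ≤-trans
      (m≤n+o⇒m∸n≤o _ (rk M F′)
        (≤-trans (rk-∪ M S F′ (E⊇ S⊆) F′⊆E) (≤-reflexive (+-comm (rk M S) _))))
      (rk-card M S (E⊇ S⊆))
  ; rk-mono   = λ S T S⊆T T⊆ → ∸-monoˡ-≤ (rk M F′)
      (rk-mono M (S ∪ F′) (T ∪ F′) (∪-monoˡ F′ S⊆T) (with-F′ (E⊇ T⊆)))
  ; rk-submod = λ S T S⊆ T⊆ → ∸-submodular (rk M F′)
      (above (∪-least (E⊇ S⊆) (E⊇ T⊆))) (above (E⊇ S⊆ ∘ p∩q⊆p S T))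
      (above (E⊇ S⊆)) (above (E⊇ T⊆))
      (subst₂ (λ A B → rk M A + rk M B ≤ rk M (S ∪ F′) + rk M (T ∪ F′))
        (merge S T) (sym (∪-distribʳ-∩ F′ S T))
        (rk-submod M (S ∪ F′) (T ∪ F′) (with-F′ (E⊇ S⊆)) (with-F′ (E⊇ T⊆))))
  }
  where
  F′ : Subset n
  F′ = E M ∩ F
  F′⊆E : F′ ⊆ E M
  F′⊆E = p∩q⊆p (E M) F
  E⊇ : ∀ {S} → S ⊆ E M ─ F → S ⊆ E M
  E⊇ S⊆ = p─q⊆p (E M) F ∘ S⊆
  with-F′ : ∀ {S} → S ⊆ E M → S ∪ F′ ⊆ E M
  with-F′ S⊆E = ∪-least S⊆E F′⊆E
  above : ∀ {S} → S ⊆ E M → rk M F′ ≤ rk M (S ∪ F′)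
  above {S} S⊆E = rk-mono M F′ (S ∪ F′) (q⊆p∪q S F′) (with-F′ S⊆E)
  merge : ∀ S T → (S ∪ F′) ∪ (T ∪ F′) ≡ (S ∪ T) ∪ F′
  merge S T = ⊆-antisym
    (∪-least (∪-monoˡ F′ (p⊆p∪q T)) (∪-monoˡ F′ (q⊆p∪q S T)))
    (∪-least (∪-least (p⊆p∪q _ ∘ p⊆p∪q F′) (q⊆p∪q (S ∪ F′) _ ∘ p⊆p∪q F′))
             (p⊆p∪q _ ∘ q⊆p∪q S F′))

dual : Matroid n → Matroid n
dual {n} M = record
  { E         = E M
  ; rk        = λ S → rk* S ∸ rank M
  ; rk-card   = λ S S⊆E → m≤n+o⇒m∸n≤o _ (rank M)
      (≤-trans (+-monoʳ-≤ ∣ S ∣ (rk-mono M _ _ (p─q⊆p (E M) S) (λ x → x)))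
               (≤-reflexive (+-comm ∣ S ∣ _)))
  ; rk-mono   = λ S T S⊆T T⊆E → ∸-monoˡ-≤ (rank M) (mono S T S⊆T T⊆E)
  ; rk-submod = λ S T S⊆E T⊆E → ∸-submodular (rank M)
      (above (∪-least S⊆E T⊆E)) (above (S⊆E ∘ p∩q⊆p S T)) (above S⊆E) (above T⊆E)
      (submod S T)
  }
  where
  rk* : Subset n → ℕ
  rk* S = ∣ S ∣ + rk M (E M ─ S)

  split : ∀ (A B : Subset n) {x} → x ∈ A → x ∈ B ∪ (A ─ B)
  split A B {x} x∈A with x ∈? B
  ... | yes x∈B = p⊆p∪q _ x∈B
  ... | no  x∉B = q⊆p∪q B _ (x∈p∧x∉q⇒x∈p─q x∈A x∉B)

  mono : ∀ S T → S ⊆ T → T ⊆ E M → rk* S ≤ rk* T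
  mono S T S⊆T T⊆E = begin
    ∣ S ∣ + rk M (E M ─ S)                         ≤⟨ +-monoʳ-≤ ∣ S ∣ (rk-mono M _ _ cover inE) ⟩
    ∣ S ∣ + rk M ((T ─ S) ∪ (E M ─ T))             ≤⟨ +-monoʳ-≤ ∣ S ∣ (rk-∪ M _ _ T─S⊆E (p─q⊆p _ T)) ⟩
    ∣ S ∣ + (rk M (T ─ S) + rk M (E M ─ T))        ≤⟨ +-monoʳ-≤ ∣ S ∣ (+-monoˡ-≤ _ (rk-card M _ T─S⊆E)) ⟩
    ∣ S ∣ + (∣ T ─ S ∣ + rk M (E M ─ T))           ≡⟨ +-assoc ∣ S ∣ _ _ ⟨
    (∣ S ∣ + ∣ T ─ S ∣) + rk M (E M ─ T)           ≡⟨ cong (_+ rk M (E M ─ T)) (∣∪∣+∣∩∣ S (T ─ S)) ⟨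
    (∣ S ∪ (T ─ S) ∣ + ∣ S ∩ (T ─ S) ∣) + rk M (E M ─ T)
      ≡⟨ cong₂ (λ a b → (∣ a ∣ + b) + rk M (E M ─ T)) union disjoint ⟩
    (∣ T ∣ + 0) + rk M (E M ─ T)                   ≡⟨ cong (_+ rk M (E M ─ T)) (+-identityʳ ∣ T ∣) ⟩
    ∣ T ∣ + rk M (E M ─ T)                         ∎
    where
    open ≤-Reasoning
    T─S⊆E : T ─ S ⊆ E M
    T─S⊆E = T⊆E ∘ p─q⊆p T S
    inE : (T ─ S) ∪ (E M ─ T) ⊆ E M
    inE = ∪-least T─S⊆E (p─q⊆p _ T)
    cover : E M ─ S ⊆ (T ─ S) ∪ (E M ─ T)
    cover {x} x∈ with x ∈? T
    ... | yes x∈T = p⊆p∪q _ (x∈p∧x∉q⇒x∈p─q x∈T (─-∈⁻ (E M) S x∈))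
    ... | no  x∉T = q⊆p∪q (T ─ S) _ (x∈p∧x∉q⇒x∈p─q (p─q⊆p (E M) S x∈) x∉T)
    union : S ∪ (T ─ S) ≡ T
    union = ⊆-antisym (∪-least S⊆T (p─q⊆p T S)) (split T S)
    disjoint : ∣ S ∩ (T ─ S) ∣ ≡ 0
    disjoint = trans (cong ∣_∣ (Empty-unique {p = S ∩ (T ─ S)} λ (x , x∈) →
      ─-∈⁻ T S (p∩q⊆q S _ x∈) (p∩q⊆p S _ x∈))) (∣⊥∣≡0 n)

  above : ∀ {S} → S ⊆ E M → rank M ≤ rk* S
  above {S} S⊆E = ≤-trans
    (rk-mono M _ _ (split (E M) S) (∪-least S⊆E (p─q⊆p _ S)))
    (≤-trans (rk-∪ M S (E M ─ S) S⊆E (p─q⊆p _ S)) (+-monoˡ-≤ _ (rk-card M S S⊆E)))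

  shuffle : ∀ a b c d → (a + b) + (c + d) ≡ (a + c) + (b + d)
  shuffle = solve-∀

  submod : ∀ S T → rk* (S ∪ T) + rk* (S ∩ T) ≤ rk* S + rk* T
  submod S T = begin
    rk* (S ∪ T) + rk* (S ∩ T)
      ≡⟨ shuffle (∣ S ∪ T ∣) _ (∣ S ∩ T ∣) _ ⟩
    (∣ S ∪ T ∣ + ∣ S ∩ T ∣) + (rk M (E M ─ (S ∪ T)) + rk M (E M ─ (S ∩ T)))
      ≡⟨ cong₂ _+_ (∣∪∣+∣∩∣ S T) (+-comm (rk M (E M ─ (S ∪ T))) _) ⟩
    (∣ S ∣ + ∣ T ∣) + (rk M (E M ─ (S ∩ T)) + rk M (E M ─ (S ∪ T)))
      ≡⟨ cong₂ (λ A B → (∣ S ∣ + ∣ T ∣) + (rk M A + rk M B)) (─-∩ (E M) S T) (─-∪ (E M) S T) ⟩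
    (∣ S ∣ + ∣ T ∣) + (rk M ((E M ─ S) ∪ (E M ─ T)) + rk M ((E M ─ S) ∩ (E M ─ T)))
      ≤⟨ +-monoʳ-≤ (∣ S ∣ + ∣ T ∣) (rk-submod M _ _ (p─q⊆p _ S) (p─q⊆p _ T)) ⟩
    (∣ S ∣ + ∣ T ∣) + (rk M (E M ─ S) + rk M (E M ─ T))
      ≡⟨ shuffle (∣ S ∣) (∣ T ∣) _ _ ⟩
    rk* S + rk* T ∎
    where open ≤-Reasoning

SparsePaving : Matroid n → Set
SparsePaving M = Paving M × Paving (dual M)

------------------------------------------------------------------------
-- Integer polynomials

-- Coefficient lists, constant term first; trailing zeros are permitted,
-- hence the equality _≋_.

Poly : Set
Poly = List ℤ

coeff : Poly → ℕ → ℤ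
coeff []      _       = 0ℤ
coeff (a ∷ p) zero    = a
coeff (a ∷ p) (suc k) = coeff p k

infix 4 _≋_
_≋_ : Poly → Poly → Set
p ≋ q = ∀ k → coeff p k ≡ coeff q k

infixl 6 _⊕_
_⊕_ : Poly → Poly → Poly
[]      ⊕ q       = q
(a ∷ p) ⊕ []      = a ∷ p
(a ∷ p) ⊕ (b ∷ q) = (a ℤ.+ b) ∷ (p ⊕ q)

infixl 7 _⊗_
_⊗_ : Poly → Poly → Poly
[]      ⊗ q = []
(a ∷ p) ⊗ q = map (a ℤ.*_) q ⊕ (0ℤ ∷ (p ⊗ q))

∑ : List Poly → Poly
∑ = foldr _⊕_ []

monomial : ℤ → ℕ → Poly
monomial a k = replicate k 0ℤ ++ [ a ]

-- t^r p(t⁻¹), provided deg p ≤ r.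
reflect : ℕ → Poly → Poly
reflect r p = map (λ k → coeff p (r ∸ k)) (upTo (suc r))

-- The zero polynomial has no degree.
HasDegree : Poly → ℕ → Set
HasDegree p k = coeff p k ≢ 0ℤ × (∀ j → k < j → coeff p j ≡ 0ℤ)

------------------------------------------------------------------------
-- Characteristic polynomial

sumℤ : List ℤ → ℤ
sumℤ = foldr ℤ._+_ 0ℤ

-- The Möbius function of the lattice of flats, by
-- μ(G,G) = 1 and μ(G,F) = - ∑ { μ(G,H) ∣ H flat, G ⊆ H ⊂ F } for G ⊂ F.

möbius-acc : Matroid n → (G F : Subset n) → Acc _⊂_ F → ℤ
möbius-acc {n} M G F (acc rs) =
  if does (≡-dec Bool._≟_ G F) then 1ℤ
  else if does (G ⊂? F) then ℤ.- sumℤ (map term (flats M))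
  else 0ℤ
  where
  term : Subset n → ℤ
  term H with H ⊂? F
  ... | yes H⊂F = if does (G ⊆? H) then möbius-acc M G H (rs H⊂F) else 0ℤ
  ... | no  _   = 0ℤ

möbius : Matroid n → Subset n → Subset n → ℤ
möbius M G F = möbius-acc M G F (⊂-wellFounded F)

-- The least flat is closure M ⊥, which is ⊥ when M is loopless.

χ : Matroid n → Poly
χ M = ∑ (map (λ F → monomial (möbius M (closure M ⊥) F) (rank M ∸ rk M F)) (flats M))

------------------------------------------------------------------------
-- Kazhdan–Lusztig polynomials

-- The conditions constrain P only on loopless matroids, where they determine
-- it up to _≋_; the values of P on matroids with loops are arbitrary.  The
-- sum stays within loopless matroids, as contracting a flat creates no loops.

record KazhdanLusztig : Set where
  field
    P       : ∀ {n} → Matroid n → Poly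
    P-rank0 : ∀ {n} (M : Matroid n) → Loopless M → rank M ≡ 0 → P M ≋ [ 1ℤ ]
    P-deg   : ∀ {n} (M : Matroid n) → Loopless M → 0 < rank M →
              ∀ k → coeff (P M) k ≢ 0ℤ → 2 * k < rank M
    P-rec   : ∀ {n} (M : Matroid n) → Loopless M →
              reflect (rank M) (P M) ≋
              ∑ (map (λ F → χ (restrict M F) ⊗ P (contract M F)) (flats M))

  NonDegenerate : Matroid n → Set
  NonDegenerate M = HasDegree (P M) ⌊ rank M ∸ 1 /2⌋

  Degenerate : Matroid n → Set
  Degenerate M = ¬ NonDegenerate M

{-# OPTIONS --safe #-}
module Submission where

-- By induction on the rank, the Kazhdan–Lusztig polynomial of a sparse paving matroid with λ
-- circuit-hyperplanes is that of the uniform matroid of the same rank and size minus λ times a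
-- polynomial depending only on the rank: contracting an independent flat gives a sparse paving
-- matroid again, and the circuit-hyperplanes are counted linearly.  The coefficients for uniform
-- matroids obey a recursion suggested by deleting an element; it reduces the defining recursion to
-- the binomial theorem and yields closed forms.  Two circuit-hyperplanes share at most d − 2
-- elements, hence λ d ≤ C(m + d, d − 1) and dually λ m ≤ C(m + d, d + 1), and these bounds keep the
-- top coefficient from vanishing except in the listed cases.

-- Setting `uniform m 0` to zero separates the ground set, the only flat whose restriction has the
-- full characteristic polynomial, from the others: it enters through `uniformχ`, they through
-- `uniformΔ`. The recursion for `uniform` is compatible with the defining one because its middle
-- term is sent to its own reversal when weighted by (t - 1)^j and summed over all j-subsets, while
-- the other terms obey Pascal's rule. The degree bound is not visible in that recursion and is read
-- off the closed form.
--
-- In the sum over flats the obstacle is size d - 1, where a set is a flat only if no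
-- circuit-hyperplane contains it. Summing over all sets and subtracting one term per
-- circuit-hyperplane above keeps the sum linear in λ.
--
-- A vanishing top coefficient determines λ as a quotient of products of binomial coefficients.
-- Inserted into either bound on λ, it leaves a polynomial inequality. Neither suffices alone: the
-- bound by C(m + d, d + 1) excludes the smaller m, that by C(m + d, d - 1) the larger ones; in
-- ranks above three no m > 1 survives both.

open import Defs
open import Data.Bool.Base using (true; false; if_then_else_)
import Data.Bool.Properties as Bool
open import Data.Empty using (⊥-elim)
open import Data.Fin.Base using (Fin)
open import Data.Fin.Subset hiding (_-_)
open import Data.Fin.Subset.Induction using (Acc; acc; ⊂-wellFounded)
open import Data.Fin.Subset.Properties
open import Data.Integer.Base as ℤ using (ℤ; +_; 0ℤ; 1ℤ; -1ℤ)
import Data.Integer.Properties as ℤ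
open import Data.Integer.Tactic.RingSolver using () renaming (solve-∀ to ℤ-solve)
open import Data.List.Base using (List; []; _∷_; [_]; _++_; map; filter; length; applyUpTo)
import Data.List.Properties as List
open import Data.Nat.Base hiding (∣_-_∣)
open import Data.Nat.Combinatorics
  using (nCn≡1; nC1≡n; nCk≡nC[n∸k]; nCk+nC[k+1]≡[n+1]C[k+1]; k>n⇒nCk≡0) renaming (_C_ to _choose_)
import Data.Nat.Divisibility as ℕ
open import Data.Nat.Induction using (<-wellFounded)
open import Data.Nat.Properties
open import Data.Nat.Tactic.RingSolver using (solve-∀)
open import Data.Product.Base using (_×_; _,_; proj₁; proj₂; ∃)
open import Data.Sum.Base using (_⊎_; inj₁; inj₂)
open import Data.Vec.Base using ([]; _∷_; here)
open import Data.Vec.Properties using (≡-dec; lookup∘tabulate; []=⇒lookup; ∷-injectiveʳ)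
open import Function.Base using (_∘_)
open import Function.Bundles using (_⇔_; mk⇔)
open import Level using (0ℓ)
open import Relation.Binary.PropositionalEquality hiding ([_])
open import Relation.Nullary.Decidable
  using (Dec; yes; no; does; dec-true; dec-false; _×-dec_; decidable-stable; from-no)
open import Relation.Nullary.Negation using (¬_; contradiction)
open import Relation.Unary using (Pred; Decidable)
open import Algebra.Properties.CommutativeSemigroup ℤ.+-commutativeSemigroup using (interchange)
open import Algebra.Properties.CommutativeSemigroup *-commutativeSemigroup using () renaming (x∙yz≈y∙xz to *-swap)

-- Binomial coefficients

nC0≡1 : ∀ n → n choose 0 ≡ 1
nC0≡1 n = trans (nCk≡nC[n∸k] {0} {n} z≤n) (nCn≡1 n)

pascal : ∀ n k → suc n choose suc k ≡ n choose k + n choose suc k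
pascal n k = sym (nCk+nC[k+1]≡[n+1]C[k+1] n k)

absorption : ∀ n k → suc k * (suc n choose suc k) ≡ suc n * (n choose k)
absorption zero    zero    = refl
absorption zero    (suc k) = begin
  suc (suc k) * (1 choose suc (suc k)) ≡⟨ cong (suc (suc k) *_) (k>n⇒nCk≡0 {1} {suc (suc k)} (s≤s (s≤s z≤n))) ⟩
  suc (suc k) * 0                      ≡⟨ *-zeroʳ (suc (suc k)) ⟩
  0                                    ≡⟨ cong (1 *_) (k>n⇒nCk≡0 {0} {suc k} (s≤s z≤n)) ⟨
  1 * (0 choose suc k)                 ∎
  where open ≡-Reasoning
absorption (suc n) zero    = begin
  1 * (suc (suc n) choose 1)     ≡⟨ *-identityˡ _ ⟩
  suc (suc n) choose 1           ≡⟨ nC1≡n (suc (suc n)) ⟩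
  suc (suc n)                    ≡⟨ *-identityʳ (suc (suc n)) ⟨
  suc (suc n) * 1                ≡⟨ cong (suc (suc n) *_) (nC0≡1 (suc n)) ⟨
  suc (suc n) * (suc n choose 0) ∎
  where open ≡-Reasoning
absorption (suc n) (suc k) = begin
  suc (suc k) * (suc (suc n) choose suc (suc k))
    ≡⟨ cong (suc (suc k) *_) (pascal (suc n) (suc k)) ⟩
  suc (suc k) * (suc n choose suc k + suc n choose suc (suc k))
    ≡⟨ expand (suc k) (suc n choose suc k) (suc n choose suc (suc k)) ⟩
  (suc n choose suc k + suc k * (suc n choose suc k)) + suc (suc k) * (suc n choose suc (suc k))
    ≡⟨ cong₂ (λ x y → (suc n choose suc k + x) + y) (absorption n k) (absorption n (suc k)) ⟩
  (suc n choose suc k + suc n * (n choose k)) + suc n * (n choose suc k)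
    ≡⟨ collect (suc n) (suc n choose suc k) (n choose k) (n choose suc k) ⟩
  suc n choose suc k + suc n * (n choose k + n choose suc k)
    ≡⟨ cong (λ x → suc n choose suc k + suc n * x) (pascal n k) ⟨
  suc (suc n) * (suc n choose suc k) ∎
  where
  open ≡-Reasoning
  expand : ∀ k x y → suc k * (x + y) ≡ (x + k * x) + suc k * y
  expand = solve-∀
  collect : ∀ n x y z → (x + n * y) + n * z ≡ x + n * (y + z)
  collect = solve-∀

-- Absorption lowers `n` and `a` together in every binomial coefficient, so induction on `a` works
-- once both sides are multiplied by `suc (a + b) * suc a`.
trinomial-revision : ∀ n a b → (n choose (a + b)) * ((a + b) choose a) ≡ (n choose a) * ((n ∸ a) choose b)
trinomial-revision n zero b = begin
  (n choose b) * (b choose 0) ≡⟨ cong ((n choose b) *_) (nC0≡1 b) ⟩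
  (n choose b) * 1            ≡⟨ *-comm (n choose b) 1 ⟩
  1 * (n choose b)            ≡⟨ cong (_* (n choose b)) (nC0≡1 n) ⟨
  (n choose 0) * (n choose b) ∎
  where open ≡-Reasoning
trinomial-revision zero (suc a) b = trans
  (cong (_* (suc (a + b) choose suc a)) (k>n⇒nCk≡0 {0} {suc (a + b)} (s≤s z≤n)))
  (sym (cong (_* (0 choose b)) (k>n⇒nCk≡0 {0} {suc a} (s≤s z≤n))))
trinomial-revision (suc n) (suc a) b = *-cancelˡ-≡ _ _ (suc (a + b) * suc a) (begin
  (suc (a + b) * suc a) * ((suc n choose suc (a + b)) * (suc (a + b) choose suc a))
    ≡⟨ [m*n]*[o*p]≡[m*o]*[n*p] (suc (a + b)) (suc a) (suc n choose suc (a + b)) (suc (a + b) choose suc a) ⟩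
  (suc (a + b) * (suc n choose suc (a + b))) * (suc a * (suc (a + b) choose suc a))
    ≡⟨ cong₂ _*_ (absorption n (a + b)) (absorption (a + b) a) ⟩
  (suc n * (n choose (a + b))) * (suc (a + b) * ((a + b) choose a))
    ≡⟨ regroup (suc n) (n choose (a + b)) (suc (a + b)) ((a + b) choose a) ⟩
  suc (a + b) * (suc n * ((n choose (a + b)) * ((a + b) choose a)))
    ≡⟨ cong (λ x → suc (a + b) * (suc n * x)) (trinomial-revision n a b) ⟩
  suc (a + b) * (suc n * ((n choose a) * ((n ∸ a) choose b)))
    ≡⟨ cong (suc (a + b) *_) (*-assoc (suc n) (n choose a) _) ⟨
  suc (a + b) * ((suc n * (n choose a)) * ((n ∸ a) choose b))
    ≡⟨ cong (λ x → suc (a + b) * (x * ((n ∸ a) choose b))) (absorption n a) ⟨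
  suc (a + b) * ((suc a * (suc n choose suc a)) * ((n ∸ a) choose b))
    ≡⟨ regroup₂ (suc (a + b)) (suc a) (suc n choose suc a) ((n ∸ a) choose b) ⟩
  (suc (a + b) * suc a) * ((suc n choose suc a) * ((n ∸ a) choose b)) ∎)
  where
  open ≡-Reasoning
  regroup : ∀ x y z w → (x * y) * (z * w) ≡ z * (x * (y * w))
  regroup = solve-∀
  regroup₂ : ∀ x y z w → x * ((y * z) * w) ≡ (x * y) * (z * w)
  regroup₂ = solve-∀

-- Binomial sums

-- binomialSum n w = ∑ᵢ (n choose i) w(i), in the form in which it arises as a sum over subsets.
binomialSum : ℕ → (ℕ → ℤ) → ℤ
binomialSum zero    w = w 0
binomialSum (suc n) w = binomialSum n (w ∘ suc) ℤ.+ binomialSum n w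

binomialSum-cong : ∀ n {v w} → (∀ i → i ≤ n → v i ≡ w i) → binomialSum n v ≡ binomialSum n w
binomialSum-cong zero    v≡w = v≡w 0 z≤n
binomialSum-cong (suc n) v≡w = cong₂ ℤ._+_
  (binomialSum-cong n (λ i i≤n → v≡w (suc i) (s≤s i≤n)))
  (binomialSum-cong n (λ i i≤n → v≡w i (m≤n⇒m≤1+n i≤n)))

binomialSum-+ : ∀ n v w → binomialSum n (λ i → v i ℤ.+ w i) ≡ binomialSum n v ℤ.+ binomialSum n w
binomialSum-+ zero    v w = refl
binomialSum-+ (suc n) v w = trans
  (cong₂ ℤ._+_ (binomialSum-+ n (v ∘ suc) (w ∘ suc)) (binomialSum-+ n v w))
  (interchange (binomialSum n (v ∘ suc)) (binomialSum n (w ∘ suc)) (binomialSum n v) (binomialSum n w))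

binomialSum-- : ∀ n v w → binomialSum n (λ i → v i ℤ.- w i) ≡ binomialSum n v ℤ.- binomialSum n w
binomialSum-- zero    v w = refl
binomialSum-- (suc n) v w = trans
  (cong₂ ℤ._+_ (binomialSum-- n (v ∘ suc) (w ∘ suc)) (binomialSum-- n v w))
  (shuffle (binomialSum n (v ∘ suc)) (binomialSum n (w ∘ suc)) (binomialSum n v) (binomialSum n w))
  where
  shuffle : ∀ x y z w → (x ℤ.- y) ℤ.+ (z ℤ.- w) ≡ (x ℤ.+ z) ℤ.- (y ℤ.+ w)
  shuffle = ℤ-solve

binomialSum-* : ∀ n a v → binomialSum n (λ i → a ℤ.* v i) ≡ a ℤ.* binomialSum n v
binomialSum-* zero    a v = refl
binomialSum-* (suc n) a v = trans
  (cong₂ ℤ._+_ (binomialSum-* n a (v ∘ suc)) (binomialSum-* n a v))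
  (sym (ℤ.*-distribˡ-+ a _ _))

binomialSum-0 : ∀ n {v} → (∀ i → i ≤ n → v i ≡ 0ℤ) → binomialSum n v ≡ 0ℤ
binomialSum-0 zero    v≡0 = v≡0 0 z≤n
binomialSum-0 (suc n) v≡0 = cong₂ ℤ._+_
  (binomialSum-0 n (λ i i≤n → v≡0 (suc i) (s≤s i≤n)))
  (binomialSum-0 n (λ i i≤n → v≡0 i (m≤n⇒m≤1+n i≤n)))

-- The last index has binomial coefficient one. The exchange of the two last values is written
-- additively, so no term has to be subtracted.
binomialSum-last : ∀ n v w → (∀ i → i < n → v i ≡ w i) →
                   binomialSum n v ℤ.+ w n ≡ binomialSum n w ℤ.+ v n
binomialSum-last zero    v w v≡w = ℤ.+-comm (v 0) (w 0)
binomialSum-last (suc n) v w v≡w = begin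
  (binomialSum n (v ∘ suc) ℤ.+ binomialSum n v) ℤ.+ w (suc n)
    ≡⟨ shuffle (binomialSum n (v ∘ suc)) _ _ ⟩
  (binomialSum n (v ∘ suc) ℤ.+ w (suc n)) ℤ.+ binomialSum n v
    ≡⟨ cong₂ ℤ._+_ (binomialSum-last n (v ∘ suc) (w ∘ suc) (λ i i<n → v≡w (suc i) (s≤s i<n)))
                   (binomialSum-cong n (λ i i≤n → v≡w i (s≤s i≤n))) ⟩
  (binomialSum n (w ∘ suc) ℤ.+ v (suc n)) ℤ.+ binomialSum n w
    ≡⟨ shuffle (binomialSum n (w ∘ suc)) _ _ ⟩
  (binomialSum n (w ∘ suc) ℤ.+ binomialSum n w) ℤ.+ v (suc n) ∎
  where
  open ≡-Reasoning
  shuffle : ∀ x y z → (x ℤ.+ y) ℤ.+ z ≡ (x ℤ.+ z) ℤ.+ y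
  shuffle = ℤ-solve

-- This is C(n, j) C(n - j, c) = C(n, c) C(n - c, j) under the sum. It removes the dependence of a
-- binomial factor on the size j of the contracted flat.
binomialSum-C : ∀ n c v → binomialSum n (λ j → + ((n ∸ j) choose c) ℤ.* v j) ≡
                + (n choose c) ℤ.* binomialSum (n ∸ c) v
binomialSum-C n       zero    v = trans
  (binomialSum-cong n (λ j _ → trans (cong (λ x → + x ℤ.* v j) (nC0≡1 (n ∸ j))) (ℤ.*-identityˡ (v j))))
  (trans (sym (ℤ.*-identityˡ _)) (cong (λ x → + x ℤ.* binomialSum n v) (sym (nC0≡1 n))))
binomialSum-C zero    (suc c) v =
  trans (cong (λ x → + x ℤ.* v 0) z) (sym (cong (λ x → + x ℤ.* v 0) z))
  where
  z : 0 choose suc c ≡ 0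
  z = k>n⇒nCk≡0 {0} {suc c} (s≤s z≤n)
binomialSum-C (suc n) (suc c) v = begin
  binomialSum n (λ j → + ((n ∸ j) choose suc c) ℤ.* v (suc j)) ℤ.+
  binomialSum n (λ j → + ((suc n ∸ j) choose suc c) ℤ.* v j)
    ≡⟨ cong₂ ℤ._+_ (binomialSum-C n (suc c) (v ∘ suc)) (binomialSum-cong n split) ⟩
  + (n choose suc c) ℤ.* binomialSum (n ∸ suc c) (v ∘ suc) ℤ.+
  binomialSum n (λ j → + ((n ∸ j) choose c) ℤ.* v j ℤ.+ + ((n ∸ j) choose suc c) ℤ.* v j)
    ≡⟨ cong (λ x → + (n choose suc c) ℤ.* binomialSum (n ∸ suc c) (v ∘ suc) ℤ.+ x) (trans
         (binomialSum-+ n (λ j → + ((n ∸ j) choose c) ℤ.* v j) (λ j → + ((n ∸ j) choose suc c) ℤ.* v j))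
         (cong₂ ℤ._+_ (binomialSum-C n c v) (binomialSum-C n (suc c) v))) ⟩
  + (n choose suc c) ℤ.* binomialSum (n ∸ suc c) (v ∘ suc) ℤ.+
  (+ (n choose c) ℤ.* binomialSum (n ∸ c) v ℤ.+ + (n choose suc c) ℤ.* binomialSum (n ∸ suc c) v)
    ≡⟨ shuffle (+ (n choose suc c)) (binomialSum (n ∸ suc c) (v ∘ suc))
         (+ (n choose c) ℤ.* binomialSum (n ∸ c) v) (binomialSum (n ∸ suc c) v) ⟩
  + (n choose c) ℤ.* binomialSum (n ∸ c) v ℤ.+ + (n choose suc c) ℤ.*
  (binomialSum (n ∸ suc c) (v ∘ suc) ℤ.+ binomialSum (n ∸ suc c) v)
    ≡⟨ cong (λ x → + (n choose c) ℤ.* binomialSum (n ∸ c) v ℤ.+ x) step ⟩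
  + (n choose c) ℤ.* binomialSum (n ∸ c) v ℤ.+ + (n choose suc c) ℤ.* binomialSum (n ∸ c) v
    ≡⟨ ℤ.*-distribʳ-+ (binomialSum (n ∸ c) v) (+ (n choose c)) (+ (n choose suc c)) ⟨
  + (n choose c + n choose suc c) ℤ.* binomialSum (n ∸ c) v
    ≡⟨ cong (λ x → + x ℤ.* binomialSum (n ∸ c) v) (pascal n c) ⟨
  + (suc n choose suc c) ℤ.* binomialSum (n ∸ c) v ∎
  where
  open ≡-Reasoning
  shuffle : ∀ a x y z → a ℤ.* x ℤ.+ (y ℤ.+ a ℤ.* z) ≡ y ℤ.+ a ℤ.* (x ℤ.+ z)
  shuffle = ℤ-solve
  split : ∀ j → j ≤ n → + ((suc n ∸ j) choose suc c) ℤ.* v j ≡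
          + ((n ∸ j) choose c) ℤ.* v j ℤ.+ + ((n ∸ j) choose suc c) ℤ.* v j
  split j j≤n = trans
    (cong (λ x → + x ℤ.* v j) (trans (cong (_choose suc c) (+-∸-assoc 1 j≤n)) (pascal (n ∸ j) c)))
    (ℤ.*-distribʳ-+ (v j) (+ ((n ∸ j) choose c)) (+ ((n ∸ j) choose suc c)))
  -- Truncation breaks `suc (n ∸ suc c) ≡ n ∸ c` when `n ≤ c`, but then the binomial factor in front
  -- is zero.
  step : + (n choose suc c) ℤ.* binomialSum (suc (n ∸ suc c)) v ≡ + (n choose suc c) ℤ.* binomialSum (n ∸ c) v
  step with c <? n
  ... | yes c<n = cong (λ x → + (n choose suc c) ℤ.* binomialSum x v) (sym (+-∸-assoc 1 c<n))
  ... | no  c≮n = trans (cong (λ x → + x ℤ.* binomialSum (suc (n ∸ suc c)) v) z)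
                        (sym (cong (λ x → + x ℤ.* binomialSum (n ∸ c) v) z))
    where
    z : n choose suc c ≡ 0
    z = k>n⇒nCk≡0 (s≤s (≮⇒≥ c≮n))

-- Polynomials as coefficient functions

δ : ℕ → ℕ → ℤ
δ zero    zero    = 1ℤ
δ zero    (suc k) = 0ℤ
δ (suc i) zero    = 0ℤ
δ (suc i) (suc k) = δ i k

shift : ℕ → (ℕ → ℤ) → ℕ → ℤ
shift zero    f k       = f k
shift (suc s) f zero    = 0ℤ
shift (suc s) f (suc k) = shift s f k

-- Multiplication by t − 1.
Δ : (ℕ → ℤ) → ℕ → ℤ
Δ f k = shift 1 f k ℤ.- f k

-- Multiplication by (t - 1)^j, the characteristic polynomial of the free matroid of rank j, hence
-- of the restriction to an independent flat of size j.
Δ^ : ℕ → (ℕ → ℤ) → ℕ → ℤ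
Δ^ zero    f = f
Δ^ (suc j) f = Δ^ j (Δ f)

-- t^d f(t⁻¹), with the coefficients of f beyond d discarded.
reverse : ℕ → (ℕ → ℤ) → ℕ → ℤ
reverse d       f zero    = f d
reverse zero    f (suc k) = 0ℤ
reverse (suc d) f (suc k) = reverse d f k

δ-diag : ∀ i → δ i i ≡ 1ℤ
δ-diag zero    = refl
δ-diag (suc i) = δ-diag i

δ-off : ∀ {i k} → i ≢ k → δ i k ≡ 0ℤ
δ-off {zero}  {zero}  i≢k = contradiction refl i≢k
δ-off {zero}  {suc k} i≢k = refl
δ-off {suc i} {zero}  i≢k = refl
δ-off {suc i} {suc k} i≢k = δ-off (i≢k ∘ cong suc)

shift-cong : ∀ s {f g} → (∀ k → f k ≡ g k) → ∀ k → shift s f k ≡ shift s g k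
shift-cong zero    f≡g k       = f≡g k
shift-cong (suc s) f≡g zero    = refl
shift-cong (suc s) f≡g (suc k) = shift-cong s f≡g k

shift-- : ∀ s f g k → shift s (λ i → f i ℤ.- g i) k ≡ shift s f k ℤ.- shift s g k
shift-- zero    f g k       = refl
shift-- (suc s) f g zero    = refl
shift-- (suc s) f g (suc k) = shift-- s f g k

shift-suc : ∀ s f k → shift s (shift 1 f) k ≡ shift (suc s) f k
shift-suc zero    f k       = refl
shift-suc (suc s) f zero    = refl
shift-suc (suc s) f (suc k) = shift-suc s f k

shift-δ : ∀ s i k → shift s (δ i) k ≡ δ (s + i) k
shift-δ zero    i k       = refl
shift-δ (suc s) i zero    = refl
shift-δ (suc s) i (suc k) = shift-δ s i k

Δ-cong : ∀ {f g} → (∀ k → f k ≡ g k) → ∀ k → Δ f k ≡ Δ g k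
Δ-cong f≡g k = cong₂ ℤ._-_ (shift-cong 1 f≡g k) (f≡g k)

Δ^-cong : ∀ j {f g} → (∀ k → f k ≡ g k) → ∀ k → Δ^ j f k ≡ Δ^ j g k
Δ^-cong zero    f≡g = f≡g
Δ^-cong (suc j) f≡g = Δ^-cong j (Δ-cong f≡g)

Δ^-Δ : ∀ j f k → Δ^ j (Δ f) k ≡ Δ (Δ^ j f) k
Δ^-Δ zero    f k = refl
Δ^-Δ (suc j) f k = Δ^-Δ j (Δ f) k

Δ-linear : ∀ a b f g k → Δ (λ i → a ℤ.* f i ℤ.+ b ℤ.* g i) k ≡ a ℤ.* Δ f k ℤ.+ b ℤ.* Δ g k
Δ-linear a b f g zero    = lemma a b (f 0) (g 0)
  where
  lemma : ∀ a b x y → 0ℤ ℤ.- (a ℤ.* x ℤ.+ b ℤ.* y) ≡ a ℤ.* (0ℤ ℤ.- x) ℤ.+ b ℤ.* (0ℤ ℤ.- y)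
  lemma = ℤ-solve
Δ-linear a b f g (suc k) = lemma a b (f k) (g k) (f (suc k)) (g (suc k))
  where
  lemma : ∀ a b x y z w → (a ℤ.* x ℤ.+ b ℤ.* y) ℤ.- (a ℤ.* z ℤ.+ b ℤ.* w) ≡
          a ℤ.* (x ℤ.- z) ℤ.+ b ℤ.* (y ℤ.- w)
  lemma = ℤ-solve

Δ^-linear : ∀ j a b f g k → Δ^ j (λ i → a ℤ.* f i ℤ.+ b ℤ.* g i) k ≡
            a ℤ.* Δ^ j f k ℤ.+ b ℤ.* Δ^ j g k
Δ^-linear zero    a b f g k = refl
Δ^-linear (suc j) a b f g k = trans (Δ^-cong j (Δ-linear a b f g) k) (Δ^-linear j a b (Δ f) (Δ g) k)

Δ^-0 : ∀ j {f} → (∀ k → f k ≡ 0ℤ) → ∀ k → Δ^ j f k ≡ 0ℤ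
Δ^-0 zero    f≡0 = f≡0
Δ^-0 (suc j) f≡0 = Δ^-0 j (λ { zero    → cong (λ x → 0ℤ ℤ.- x) (f≡0 0)
                              ; (suc k) → cong₂ ℤ._-_ (f≡0 k) (f≡0 (suc k)) })

Δ^-+ : ∀ j f g k → Δ^ j (λ i → f i ℤ.+ g i) k ≡ Δ^ j f k ℤ.+ Δ^ j g k
Δ^-+ j f g k = begin
  Δ^ j (λ i → f i ℤ.+ g i) k
    ≡⟨ Δ^-cong j (λ i → sym (cong₂ ℤ._+_ (ℤ.*-identityˡ (f i)) (ℤ.*-identityˡ (g i)))) k ⟩
  Δ^ j (λ i → 1ℤ ℤ.* f i ℤ.+ 1ℤ ℤ.* g i) k
    ≡⟨ Δ^-linear j 1ℤ 1ℤ f g k ⟩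
  1ℤ ℤ.* Δ^ j f k ℤ.+ 1ℤ ℤ.* Δ^ j g k
    ≡⟨ cong₂ ℤ._+_ (ℤ.*-identityˡ (Δ^ j f k)) (ℤ.*-identityˡ (Δ^ j g k)) ⟩
  Δ^ j f k ℤ.+ Δ^ j g k ∎
  where open ≡-Reasoning

Δ^-- : ∀ j f g k → Δ^ j (λ i → f i ℤ.- g i) k ≡ Δ^ j f k ℤ.- Δ^ j g k
Δ^-- j f g k = begin
  Δ^ j (λ i → f i ℤ.- g i) k
    ≡⟨ Δ^-cong j (λ i → lemma (f i) (g i)) k ⟩
  Δ^ j (λ i → 1ℤ ℤ.* f i ℤ.+ -1ℤ ℤ.* g i) k
    ≡⟨ Δ^-linear j 1ℤ -1ℤ f g k ⟩
  1ℤ ℤ.* Δ^ j f k ℤ.+ -1ℤ ℤ.* Δ^ j g k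
    ≡⟨ lemma (Δ^ j f k) (Δ^ j g k) ⟨
  Δ^ j f k ℤ.- Δ^ j g k ∎
  where
  open ≡-Reasoning
  lemma : ∀ x y → x ℤ.- y ≡ 1ℤ ℤ.* x ℤ.+ -1ℤ ℤ.* y
  lemma = ℤ-solve

binomialSum-shift : ∀ s n (w : ℕ → ℕ → ℤ) k →
                    shift s (λ i → binomialSum n (λ j → w j i)) k ≡ binomialSum n (λ j → shift s (w j) k)
binomialSum-shift zero    n w k       = refl
binomialSum-shift (suc s) n w zero    = sym (binomialSum-0 n (λ _ _ → refl))
binomialSum-shift (suc s) n w (suc k) = binomialSum-shift s n w k

Δ-binomialSum : ∀ n (w : ℕ → ℕ → ℤ) k →
                Δ (λ i → binomialSum n (λ j → w j i)) k ≡ binomialSum n (λ j → Δ (w j) k)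
Δ-binomialSum n w k = trans
  (cong (ℤ._- binomialSum n (λ j → w j k)) (binomialSum-shift 1 n w k))
  (sym (binomialSum-- n (λ j → shift 1 (w j) k) (λ j → w j k)))

-- (1 + (t − 1))ⁿ = tⁿ
binomialSum-Δ^ : ∀ n f k → binomialSum n (λ j → Δ^ j f k) ≡ shift n f k
binomialSum-Δ^ zero    f k = refl
binomialSum-Δ^ (suc n) f k = begin
  binomialSum n (λ j → Δ^ j (Δ f) k) ℤ.+ binomialSum n (λ j → Δ^ j f k)
    ≡⟨ cong₂ ℤ._+_ (binomialSum-Δ^ n (Δ f) k) (binomialSum-Δ^ n f k) ⟩
  shift n (Δ f) k ℤ.+ shift n f k
    ≡⟨ cong (ℤ._+ shift n f k) (shift-- n (shift 1 f) f k) ⟩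
  (shift n (shift 1 f) k ℤ.- shift n f k) ℤ.+ shift n f k
    ≡⟨ lemma _ _ ⟩
  shift n (shift 1 f) k
    ≡⟨ shift-suc n f k ⟩
  shift (suc n) f k ∎
  where
  open ≡-Reasoning
  lemma : ∀ x y → (x ℤ.- y) ℤ.+ y ≡ x
  lemma = ℤ-solve

sign : ℕ → ℤ
sign zero    = 1ℤ
sign (suc i) = ℤ.- sign i

binomialSum-sign : ∀ n → binomialSum (suc n) sign ≡ 0ℤ
binomialSum-sign n = begin
  binomialSum n (λ i → ℤ.- sign i) ℤ.+ binomialSum n sign
    ≡⟨ cong (ℤ._+ binomialSum n sign)
         (trans (binomialSum-cong n (λ i _ → sym (ℤ.-1*i≡-i (sign i)))) (binomialSum-* n -1ℤ sign)) ⟩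
  -1ℤ ℤ.* binomialSum n sign ℤ.+ binomialSum n sign
    ≡⟨ lemma (binomialSum n sign) ⟩
  0ℤ ∎
  where
  open ≡-Reasoning
  lemma : ∀ x → -1ℤ ℤ.* x ℤ.+ x ≡ 0ℤ
  lemma = ℤ-solve

binomialSum-neg : ∀ n v → binomialSum n (λ i → ℤ.- v i) ≡ ℤ.- binomialSum n v
binomialSum-neg zero    v = refl
binomialSum-neg (suc n) v = trans
  (cong₂ ℤ._+_ (binomialSum-neg n (v ∘ suc)) (binomialSum-neg n v))
  (sym (ℤ.neg-distrib-+ (binomialSum n (v ∘ suc)) (binomialSum n v)))

-- The binomial theorem for (t - 1)^j. It identifies the signed sum over flats of a free matroid
-- with `Δ^`.
Δ^-expand : ∀ j f k → binomialSum j (λ i → sign i ℤ.* shift (j ∸ i) f k) ≡ Δ^ j f k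
Δ^-expand zero    f k = ℤ.*-identityˡ (f k)
Δ^-expand (suc j) f k = begin
  binomialSum j (λ i → (ℤ.- sign i) ℤ.* shift (j ∸ i) f k) ℤ.+
  binomialSum j (λ i → sign i ℤ.* shift (suc j ∸ i) f k)
    ≡⟨ binomialSum-+ j _ _ ⟨
  binomialSum j (λ i → (ℤ.- sign i) ℤ.* shift (j ∸ i) f k ℤ.+ sign i ℤ.* shift (suc j ∸ i) f k)
    ≡⟨ binomialSum-cong j step ⟩
  binomialSum j (λ i → sign i ℤ.* shift (j ∸ i) (Δ f) k)
    ≡⟨ Δ^-expand j (Δ f) k ⟩
  Δ^ j (Δ f) k ∎
  where
  open ≡-Reasoning
  lemma : ∀ s x y → (ℤ.- s) ℤ.* x ℤ.+ s ℤ.* y ≡ s ℤ.* (y ℤ.- x)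
  lemma = ℤ-solve
  step : ∀ i → i ≤ j → (ℤ.- sign i) ℤ.* shift (j ∸ i) f k ℤ.+ sign i ℤ.* shift (suc j ∸ i) f k ≡
         sign i ℤ.* shift (j ∸ i) (Δ f) k
  step i i≤j = trans (lemma (sign i) _ _) (cong (sign i ℤ.*_) (begin
    shift (suc j ∸ i) f k ℤ.- shift (j ∸ i) f k
      ≡⟨ cong (λ s → shift s f k ℤ.- shift (j ∸ i) f k) (+-∸-assoc 1 i≤j) ⟩
    shift (suc (j ∸ i)) f k ℤ.- shift (j ∸ i) f k
      ≡⟨ cong (ℤ._- shift (j ∸ i) f k) (shift-suc (j ∸ i) f k) ⟨
    shift (j ∸ i) (shift 1 f) k ℤ.- shift (j ∸ i) f k
      ≡⟨ shift-- (j ∸ i) (shift 1 f) f k ⟨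
    shift (j ∸ i) (Δ f) k ∎))

∑< : ℕ → (ℕ → ℤ) → ℤ
∑< zero    f = 0ℤ
∑< (suc n) f = ∑< n f ℤ.+ f n

∑<-cong : ∀ n {f g} → (∀ i → i < n → f i ≡ g i) → ∑< n f ≡ ∑< n g
∑<-cong zero    f≡g = refl
∑<-cong (suc n) f≡g = cong₂ ℤ._+_ (∑<-cong n (λ i i<n → f≡g i (m≤n⇒m≤1+n i<n))) (f≡g n ≤-refl)

∑<-0 : ∀ n {f} → (∀ i → i < n → f i ≡ 0ℤ) → ∑< n f ≡ 0ℤ
∑<-0 zero    f≡0 = refl
∑<-0 (suc n) f≡0 = cong₂ ℤ._+_ (∑<-0 n (λ i i<n → f≡0 i (m≤n⇒m≤1+n i<n))) (f≡0 n ≤-refl)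

∑<-single : ∀ n {f} i → i < n → (∀ j → j ≢ i → f j ≡ 0ℤ) → ∑< n f ≡ f i
∑<-single (suc n) {f} i i<1+n f≡0 with i ≟ n
... | yes refl = trans (cong (ℤ._+ f n) (∑<-0 n (λ j j<n → f≡0 j (<⇒≢ j<n)))) (ℤ.+-identityˡ (f n))
... | no  i≢n  = trans
  (cong₂ ℤ._+_ (∑<-single n i (≤∧≢⇒< (≤-pred i<1+n) i≢n) f≡0) (f≡0 n (i≢n ∘ sym)))
  (ℤ.+-identityʳ (f i))

∑<-- : ∀ n f g → ∑< n (λ i → f i ℤ.- g i) ≡ ∑< n f ℤ.- ∑< n g
∑<-- zero    f g = refl
∑<-- (suc n) f g = trans (cong (ℤ._+ (f n ℤ.- g n)) (∑<-- n f g))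
  (shuffle (∑< n f) (∑< n g) (f n) (g n))
  where
  shuffle : ∀ x y z w → (x ℤ.- y) ℤ.+ (z ℤ.- w) ≡ (x ℤ.+ z) ℤ.- (y ℤ.+ w)
  shuffle = ℤ-solve

binomialSum-∑< : ∀ n N (w : ℕ → ℕ → ℤ) →
                 binomialSum n (λ j → ∑< N (w j)) ≡ ∑< N (λ i → binomialSum n (λ j → w j i))
binomialSum-∑< n zero    w = binomialSum-0 n (λ _ _ → refl)
binomialSum-∑< n (suc N) w = trans
  (binomialSum-+ n (λ j → ∑< N (w j)) (λ j → w j N))
  (cong (ℤ._+ binomialSum n (λ j → w j N)) (binomialSum-∑< n N w))

expand-δ : ∀ N (h : ℕ → ℤ) k → k < N → ∑< N (λ i → h i ℤ.* δ i k) ≡ h k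
expand-δ N h k k<N = trans
  (∑<-single N {λ i → h i ℤ.* δ i k} k k<N (λ i i≢k → trans (cong (h i ℤ.*_) (δ-off i≢k)) (ℤ.*-zeroʳ (h i))))
  (trans (cong (h k ℤ.*_) (δ-diag k)) (ℤ.*-identityʳ (h k)))

-- Multiplication by t - 1 looks only at the indices k and k - 1, so a decomposition valid below `N`
-- remains valid below `N`. Finite expansions into monomials can thus stand in for arbitrary
-- coefficient functions.
Δ-expand-δ : ∀ N f (w : ℕ → ℕ → ℤ) → (∀ k → k < N → f k ≡ ∑< N (λ i → w i k)) →
             ∀ k → k < N → Δ f k ≡ ∑< N (λ i → Δ (w i) k)
Δ-expand-δ N f w f≡ zero    k<N = begin
  0ℤ ℤ.- f 0                             ≡⟨ cong₂ ℤ._-_ (sym (∑<-0 N {λ _ → 0ℤ} (λ _ _ → refl))) (f≡ 0 k<N) ⟩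
  ∑< N (λ _ → 0ℤ) ℤ.- ∑< N (λ i → w i 0) ≡⟨ ∑<-- N (λ _ → 0ℤ) (λ i → w i 0) ⟨
  ∑< N (λ i → Δ (w i) 0)                 ∎
  where open ≡-Reasoning
Δ-expand-δ N f w f≡ (suc k) k<N = begin
  f k ℤ.- f (suc k)                               ≡⟨ cong₂ ℤ._-_ (f≡ k (<-trans (n<1+n k) k<N)) (f≡ (suc k) k<N) ⟩
  ∑< N (λ i → w i k) ℤ.- ∑< N (λ i → w i (suc k)) ≡⟨ ∑<-- N (λ i → w i k) (λ i → w i (suc k)) ⟨
  ∑< N (λ i → Δ (w i) (suc k))                    ∎
  where open ≡-Reasoning

Δ^-expand-δ : ∀ j N f (w : ℕ → ℕ → ℤ) → (∀ k → k < N → f k ≡ ∑< N (λ i → w i k)) →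
              ∀ k → k < N → Δ^ j f k ≡ ∑< N (λ i → Δ^ j (w i) k)
Δ^-expand-δ zero    N f w f≡ = f≡
Δ^-expand-δ (suc j) N f w f≡ = Δ^-expand-δ j N (Δ f) (Δ ∘ w) (Δ-expand-δ N f w f≡)

Δ^-* : ∀ j a f k → Δ^ j (λ i → a ℤ.* f i) k ≡ a ℤ.* Δ^ j f k
Δ^-* j a f k = begin
  Δ^ j (λ i → a ℤ.* f i) k
    ≡⟨ Δ^-cong j (λ i → sym (ℤ.+-identityʳ (a ℤ.* f i))) k ⟩
  Δ^ j (λ i → a ℤ.* f i ℤ.+ 0ℤ ℤ.* f i) k
    ≡⟨ Δ^-linear j a 0ℤ f f k ⟩
  a ℤ.* Δ^ j f k ℤ.+ 0ℤ
    ≡⟨ ℤ.+-identityʳ (a ℤ.* Δ^ j f k) ⟩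
  a ℤ.* Δ^ j f k ∎
  where open ≡-Reasoning

reverse-≤ : ∀ {d k} f → k ≤ d → reverse d f k ≡ f (d ∸ k)
reverse-≤ {d}     {zero}  f _         = refl
reverse-≤ {suc d} {suc k} f (s≤s k≤d) = reverse-≤ f k≤d

reverse-> : ∀ {d k} f → d < k → reverse d f k ≡ 0ℤ
reverse-> {zero}  {suc k} f _         = refl
reverse-> {suc d} {suc k} f (s≤s d<k) = reverse-> f d<k

reverse-+ : ∀ d f g k → reverse d (λ i → f i ℤ.+ g i) k ≡ reverse d f k ℤ.+ reverse d g k
reverse-+ d       f g zero    = refl
reverse-+ zero    f g (suc k) = refl
reverse-+ (suc d) f g (suc k) = reverse-+ d f g k

reverse-- : ∀ d f g k → reverse d (λ i → f i ℤ.- g i) k ≡ reverse d f k ℤ.- reverse d g k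
reverse-- d       f g zero    = refl
reverse-- zero    f g (suc k) = refl
reverse-- (suc d) f g (suc k) = reverse-- d f g k

reverse-cong : ∀ d {f g} → (∀ i → f i ≡ g i) → ∀ k → reverse d f k ≡ reverse d g k
reverse-cong d       f≡g zero    = f≡g d
reverse-cong zero    f≡g (suc k) = refl
reverse-cong (suc d) f≡g (suc k) = reverse-cong d f≡g k

reverse-shift : ∀ d f k → reverse (suc d) (shift 1 f) k ≡ reverse d f k
reverse-shift d       f zero          = refl
reverse-shift zero    f (suc zero)    = refl
reverse-shift zero    f (suc (suc k)) = refl
reverse-shift (suc d) f (suc k)       = reverse-shift d f k

shift-reverse : ∀ d f → f (suc d) ≡ 0ℤ → ∀ k → shift 1 (reverse d f) k ≡ reverse (suc d) f k
shift-reverse d f f≡0 zero    = sym f≡0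
shift-reverse d f f≡0 (suc k) = refl

-- Kazhdan-Lusztig coefficients of uniform matroids: recursion and reversal

-- The uniform matroid of rank d on m + d elements has Kazhdan–Lusztig polynomial uniform m d if
-- d > 0.  The recursion in m comes from deleting an element; its middle term involves the top
-- coefficient for the same m in rank 2i + 1.  By convention uniform m 0 is 0, not 1.
uniform : (m d i : ℕ) → ℤ
uniform m       d zero    = + (1 ⊓ d)
uniform zero    d (suc i) = 0ℤ
uniform (suc m) d (suc i) =
  (uniform m d (suc i) ℤ.+ + ((m + d) choose (m + 2 * suc i)) ℤ.* uniform (suc m) (suc (2 * i)) i)
    ℤ.- uniform (suc m) (pred d) i

-- The middle term of the recursion, isolated because it satisfies a reversal identity by itself.
gammaTerm : (m d i : ℕ) → ℤ
gammaTerm m d zero    = 0ℤ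
gammaTerm m d (suc i) = + ((m + d) choose (m + 2 * suc i)) ℤ.* uniform (suc m) (suc (2 * i)) i

-- A crude degree bound that the recursion yields directly; the sharp one, `d ≤ 2 * i`, has to wait
-- for the closed form.
uniform-≥ : ∀ m {d i} → d ≤ i → uniform m d i ≡ 0ℤ
uniform-≥ m       {zero} {zero}  _     = refl
uniform-≥ zero    {d}    {suc i} _     = refl
uniform-≥ (suc m) {d}    {suc i} d≤1+i = begin
  (uniform m d (suc i) ℤ.+ + ((m + d) choose (m + 2 * suc i)) ℤ.* t) ℤ.- uniform (suc m) (pred d) i
    ≡⟨ cong₂ ℤ._-_ (cong₂ ℤ._+_ (uniform-≥ m d≤1+i) (cong (λ x → + x ℤ.* t) C≡0))
                   (uniform-≥ (suc m) {pred d} {i} (pred-mono-≤ d≤1+i)) ⟩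
  0ℤ ∎
  where
  open ≡-Reasoning
  t = uniform (suc m) (suc (2 * i)) i
  C≡0 : (m + d) choose (m + 2 * suc i) ≡ 0
  C≡0 = k>n⇒nCk≡0 (+-monoʳ-< m (≤-<-trans d≤1+i (m<m+n (suc i) z<s)))

uniform-0 : ∀ m i → uniform m 0 i ≡ 0ℤ
uniform-0 m i = uniform-≥ m {0} {i} z≤n

-- The recursion as an identity of polynomials, with `shift 1` for multiplication by t. The rank
-- appears as `suc d ∸ j`, the form it takes after contracting j independent elements, including j
-- beyond the rank.
uniform-recursion : ∀ m d j i →
  uniform (suc m) (suc d ∸ j) i ℤ.+ shift 1 (uniform (suc m) (d ∸ j)) i ≡
  uniform m (suc d ∸ j) i ℤ.+ gammaTerm m (suc d ∸ j) i
uniform-recursion m d j zero    = refl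
uniform-recursion m d j (suc i) = trans
  (cong (λ r → ((x ℤ.+ y) ℤ.- uniform (suc m) r i) ℤ.+ uniform (suc m) (d ∸ j) i) (pred[m∸n]≡m∸[1+n] (suc d) j))
  (lemma x y (uniform (suc m) (d ∸ j) i))
  where
  x = uniform m (suc d ∸ j) (suc i)
  y = gammaTerm m (suc d ∸ j) (suc i)
  lemma : ∀ x y z → ((x ℤ.+ y) ℤ.- z) ℤ.+ z ≡ x ℤ.+ y
  lemma = ℤ-solve

-- Monomial by monomial: by `binomialSum-C` and the binomial theorem, the sum over j of C(m + d, j)
-- C(m + d - j, m + 2i) (t - 1)^j is C(m + d, m + 2i) t^(d - 2i). Hence t^i is carried to t^(d - i),
-- with the same coefficient.
gammaTerm-reverse : ∀ m d k →
  binomialSum (m + d) (λ j → Δ^ j (gammaTerm m (d ∸ j)) k) ≡ reverse d (gammaTerm m d) k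
gammaTerm-reverse m d k = begin
  binomialSum (m + d) (λ j → Δ^ j (gammaTerm m (d ∸ j)) k)
    ≡⟨ binomialSum-cong (m + d) (λ j _ → Δ^-expand-δ j N _ (λ i k → gammaTerm m (d ∸ j) i ℤ.* δ i k)
         (λ k k<N → sym (expand-δ N (gammaTerm m (d ∸ j)) k k<N)) k k<N) ⟩
  binomialSum (m + d) (λ j → ∑< N (λ i → Δ^ j (λ k → gammaTerm m (d ∸ j) i ℤ.* δ i k) k))
    ≡⟨ binomialSum-∑< (m + d) N _ ⟩
  ∑< N (λ i → binomialSum (m + d) (λ j → Δ^ j (λ k → gammaTerm m (d ∸ j) i ℤ.* δ i k) k))
    ≡⟨ ∑<-cong N (λ i _ → binomialSum-cong (m + d)
         (λ j _ → Δ^-* j (gammaTerm m (d ∸ j) i) (δ i) k)) ⟩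
  ∑< N (λ i → binomialSum (m + d) (λ j → gammaTerm m (d ∸ j) i ℤ.* Δ^ j (δ i) k))
    ≡⟨ ∑<-cong N (λ i _ → term i) ⟩
  ∑< N (λ i → gammaTerm m d i ℤ.* δ (d ∸ 2 * i + i) k)
    ≡⟨ collect ⟩
  reverse d (gammaTerm m d) k ∎
  where
  open ≡-Reasoning
  N = suc (k + d)
  k<N : k < N
  k<N = s≤s (m≤m+n k d)

  -- For `j > d` the two truncated differences disagree, but both stay below `m + 2 * suc i`, so
  -- both binomial coefficients vanish.
  top : ∀ i j → j ≤ m + d → (m + (d ∸ j)) choose (m + 2 * suc i) ≡ ((m + d) ∸ j) choose (m + 2 * suc i)
  top i j _ with j ≤? d
  ... | yes j≤d = cong (_choose (m + 2 * suc i)) (sym (+-∸-assoc m j≤d))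
  ... | no  j≰d = trans (k>n⇒nCk≡0 lt) (sym (k>n⇒nCk≡0 (≤-<-trans le lt)))
    where
    lt : m + (d ∸ j) < m + 2 * suc i
    lt = +-monoʳ-< m (subst (_< 2 * suc i) (sym (m≤n⇒m∸n≡0 (≰⇒≥ j≰d))) z<s)
    le : (m + d) ∸ j ≤ m + (d ∸ j)
    le = ≤-trans (∸-monoˡ-≤ j (+-monoʳ-≤ m (≰⇒≥ j≰d))) (≤-trans (≤-reflexive (m+n∸n≡m m j)) (m≤m+n m _))

  term : ∀ i → binomialSum (m + d) (λ j → gammaTerm m (d ∸ j) i ℤ.* Δ^ j (δ i) k) ≡
         gammaTerm m d i ℤ.* δ (d ∸ 2 * i + i) k
  term zero    = binomialSum-0 (m + d) (λ _ _ → refl)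
  term (suc i) = begin
    binomialSum (m + d) (λ j → (+ ((m + (d ∸ j)) choose c) ℤ.* t) ℤ.* Δ^ j (δ (suc i)) k)
      ≡⟨ binomialSum-cong (m + d) (λ j j≤ → trans
           (cong (λ x → (+ x ℤ.* t) ℤ.* Δ^ j (δ (suc i)) k) (top i j j≤))
           (swap (+ (((m + d) ∸ j) choose c)) t (Δ^ j (δ (suc i)) k))) ⟩
    binomialSum (m + d) (λ j → t ℤ.* (+ (((m + d) ∸ j) choose c) ℤ.* Δ^ j (δ (suc i)) k))
      ≡⟨ binomialSum-* (m + d) t _ ⟩
    t ℤ.* binomialSum (m + d) (λ j → + (((m + d) ∸ j) choose c) ℤ.* Δ^ j (δ (suc i)) k)
      ≡⟨ cong (t ℤ.*_) (binomialSum-C (m + d) c (λ j → Δ^ j (δ (suc i)) k)) ⟩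
    t ℤ.* (+ ((m + d) choose c) ℤ.* binomialSum ((m + d) ∸ c) (λ j → Δ^ j (δ (suc i)) k))
      ≡⟨ cong (λ x → t ℤ.* (+ ((m + d) choose c) ℤ.* x)) (trans (binomialSum-Δ^ ((m + d) ∸ c) (δ (suc i)) k)
           (trans (shift-δ ((m + d) ∸ c) (suc i) k)
                  (cong (λ x → δ (x + suc i) k) ([m+n]∸[m+o]≡n∸o m d (2 * suc i))))) ⟩
    t ℤ.* (+ ((m + d) choose c) ℤ.* δ (d ∸ 2 * suc i + suc i) k)
      ≡⟨ swap (+ ((m + d) choose c)) t _ ⟨
    (+ ((m + d) choose c) ℤ.* t) ℤ.* δ (d ∸ 2 * suc i + suc i) k ∎
    where
    c = m + 2 * suc i
    t = uniform (suc m) (suc (2 * i)) i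
    swap : ∀ x y z → (x ℤ.* y) ℤ.* z ≡ y ℤ.* (x ℤ.* z)
    swap = ℤ-solve

  -- Beyond d / 2 the coefficient is zero, so `d ∸ 2 * i` matters only where nothing is truncated.
  vanish : ∀ i → d < 2 * i → gammaTerm m d i ≡ 0ℤ
  vanish zero    _    = refl
  vanish (suc i) d<2i = cong (λ x → + x ℤ.* uniform (suc m) (suc (2 * i)) i) (k>n⇒nCk≡0 (+-monoʳ-< m d<2i))

  index : ∀ i → 2 * i ≤ d → d ∸ 2 * i + i ≡ d ∸ i
  index i 2i≤d = begin
    d ∸ 2 * i + i     ≡⟨ +-∸-comm i 2i≤d ⟨
    (d + i) ∸ 2 * i   ≡⟨ cong (λ x → (d + i) ∸ (i + x)) (+-identityʳ i) ⟩
    (d + i) ∸ (i + i) ≡⟨ ∸-+-assoc (d + i) i i ⟨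
    (d + i) ∸ i ∸ i   ≡⟨ cong (_∸ i) (m+n∸n≡m d i) ⟩
    d ∸ i             ∎

  i≤2i : ∀ i → i ≤ 2 * i
  i≤2i i = m≤m+n i _

  nonzero-at : ∀ i → d ∸ i ≢ k → gammaTerm m d i ℤ.* δ (d ∸ 2 * i + i) k ≡ 0ℤ
  nonzero-at i i≢ with 2 * i ≤? d
  ... | yes 2i≤d = trans (cong (gammaTerm m d i ℤ.*_) (δ-off (i≢ ∘ trans (sym (index i 2i≤d)))))
                         (ℤ.*-zeroʳ (gammaTerm m d i))
  ... | no  2i≰d = cong (ℤ._* δ (d ∸ 2 * i + i) k) (vanish i (≰⇒> 2i≰d))

  collect : ∑< N (λ i → gammaTerm m d i ℤ.* δ (d ∸ 2 * i + i) k) ≡ reverse d (gammaTerm m d) k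
  collect with k ≤? d
  ... | no  k≰d = trans
    (∑<-0 N (λ i _ → nonzero-at i (λ eq → k≰d (subst (_≤ d) eq (m∸n≤m d i)))))
    (sym (reverse-> (gammaTerm m d) (≰⇒> k≰d)))
  ... | yes k≤d = begin
    ∑< N (λ i → gammaTerm m d i ℤ.* δ (d ∸ 2 * i + i) k)
      ≡⟨ ∑<-single N (d ∸ k) (s≤s (≤-trans (m∸n≤m d k) (m≤n+m d k))) single ⟩
    gammaTerm m d (d ∸ k) ℤ.* δ (d ∸ 2 * (d ∸ k) + (d ∸ k)) k
      ≡⟨ last ⟩
    gammaTerm m d (d ∸ k)
      ≡⟨ reverse-≤ (gammaTerm m d) k≤d ⟨
    reverse d (gammaTerm m d) k ∎
    where
    single : ∀ i → i ≢ d ∸ k → gammaTerm m d i ℤ.* δ (d ∸ 2 * i + i) k ≡ 0ℤ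
    single i i≢ with i ≤? d
    ... | yes i≤d = nonzero-at i (λ { refl → i≢ (sym (m∸[m∸n]≡n i≤d)) })
    ... | no  i≰d = cong (ℤ._* δ (d ∸ 2 * i + i) k) (vanish i (<-≤-trans (≰⇒> i≰d) (i≤2i i)))
    last : gammaTerm m d (d ∸ k) ℤ.* δ (d ∸ 2 * (d ∸ k) + (d ∸ k)) k ≡ gammaTerm m d (d ∸ k)
    last with 2 * (d ∸ k) ≤? d
    ... | yes le = trans
      (cong (λ x → gammaTerm m d (d ∸ k) ℤ.* δ x k) (trans (index (d ∸ k) le) (m∸[m∸n]≡n k≤d)))
      (trans (cong (gammaTerm m d (d ∸ k) ℤ.*_) (δ-diag k)) (ℤ.*-identityʳ (gammaTerm m d (d ∸ k))))
    ... | no  ≰ = trans (cong (ℤ._* δ (d ∸ 2 * (d ∸ k) + (d ∸ k)) k) z) (sym z)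
      where
      z : gammaTerm m d (d ∸ k) ≡ 0ℤ
      z = vanish (d ∸ k) (≰⇒> ≰)

-- The product of q and the characteristic polynomial of the uniform matroid, whose constant term has
-- been eliminated by χ(1) = 0.
uniformχ : (m d : ℕ) → (ℕ → ℤ) → ℕ → ℤ
uniformχ m d q k = binomialSum (m + d) (λ i → sign i ℤ.* (shift (d ∸ i) q k ℤ.- q k))

uniformχ-0 : ∀ m q k → uniformχ m 0 q k ≡ 0ℤ
uniformχ-0 m q k = binomialSum-0 (m + 0) (λ i _ → trans
  (cong (λ s → sign i ℤ.* (shift s q k ℤ.- q k)) (0∸n≡0 i))
  (trans (cong (sign i ℤ.*_) (ℤ.+-inverseʳ (q k))) (ℤ.*-zeroʳ (sign i))))

-- Deletion-contraction for the uniform matroid, which on the level of subsets is Pascal's rule.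
uniformχ-suc : ∀ m d q k → uniformχ (suc m) (suc d) q k ≡ uniformχ m (suc d) q k ℤ.- uniformχ (suc m) d q k
uniformχ-suc m d q k = begin
  binomialSum (m + suc d) (λ i → (ℤ.- sign i) ℤ.* y (d ∸ i)) ℤ.+ uniformχ m (suc d) q k
    ≡⟨ cong (ℤ._+ uniformχ m (suc d) q k) (trans
         (binomialSum-cong (m + suc d) (λ i _ → sym (ℤ.neg-distribˡ-* (sign i) (y (d ∸ i)))))
         (binomialSum-neg (m + suc d) (λ i → sign i ℤ.* y (d ∸ i)))) ⟩
  ℤ.- binomialSum (m + suc d) (λ i → sign i ℤ.* y (d ∸ i)) ℤ.+ uniformχ m (suc d) q k
    ≡⟨ cong (λ n → ℤ.- binomialSum n (λ i → sign i ℤ.* y (d ∸ i)) ℤ.+ uniformχ m (suc d) q k) (+-suc m d) ⟩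
  ℤ.- uniformχ (suc m) d q k ℤ.+ uniformχ m (suc d) q k
    ≡⟨ ℤ.+-comm (ℤ.- uniformχ (suc m) d q k) _ ⟩
  uniformχ m (suc d) q k ℤ.- uniformχ (suc m) d q k ∎
  where
  open ≡-Reasoning
  y = λ s → shift s q k ℤ.- q k

-- For m = 0 every proper subset is a flat. The subtracted `q k` contributes nothing, because the
-- alternating sum of binomial coefficients vanishes in positive rank.
uniformχ-free : ∀ d q k → uniformχ 0 (suc d) q k ≡ Δ^ (suc d) q k
uniformχ-free d q k = begin
  binomialSum (suc d) (λ i → sign i ℤ.* (shift (suc d ∸ i) q k ℤ.- q k))
    ≡⟨ binomialSum-cong (suc d) (λ i _ → lemma (sign i) (shift (suc d ∸ i) q k) (q k)) ⟩
  binomialSum (suc d) (λ i → sign i ℤ.* shift (suc d ∸ i) q k ℤ.- q k ℤ.* sign i)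
    ≡⟨ binomialSum-- (suc d) (λ i → sign i ℤ.* shift (suc d ∸ i) q k) (λ i → q k ℤ.* sign i) ⟩
  binomialSum (suc d) (λ i → sign i ℤ.* shift (suc d ∸ i) q k) ℤ.- binomialSum (suc d) (λ i → q k ℤ.* sign i)
    ≡⟨ cong₂ ℤ._-_ (Δ^-expand (suc d) q k) (trans (binomialSum-* (suc d) (q k) sign)
         (trans (cong (q k ℤ.*_) (binomialSum-sign d)) (ℤ.*-zeroʳ (q k)))) ⟩
  Δ^ (suc d) q k ℤ.- 0ℤ
    ≡⟨ ℤ.+-identityʳ (Δ^ (suc d) q k) ⟩
  Δ^ (suc d) q k ∎
  where
  open ≡-Reasoning
  lemma : ∀ s x y → s ℤ.* (x ℤ.- y) ≡ s ℤ.* x ℤ.- y ℤ.* s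
  lemma = ℤ-solve

-- The terms of the proper flats in the Kazhdan–Lusztig recursion for the uniform matroid.
uniformΔ : (m d k : ℕ) → ℤ
uniformΔ m d k = binomialSum (m + d) (λ j → Δ^ j (uniform m (d ∸ j)) k)

uniformΔ-0 : ∀ m k → uniformΔ m 0 k ≡ 0ℤ
uniformΔ-0 m k = binomialSum-0 (m + 0) (λ j _ →
  Δ^-0 j (λ i → trans (cong (λ d → uniform m d i) (0∸n≡0 j)) (uniform-0 m i)) k)

-- Pascal's rule pairs (t - 1) U(d - j) with U(d + 1 - j). The t part completes the left side of
-- `uniform-recursion`, and the -1 part is the sum for rank d.
uniformΔ-suc : ∀ m d k → uniformΔ (suc m) (suc d) k ≡
  (uniformΔ m (suc d) k ℤ.+ reverse (suc d) (gammaTerm m (suc d)) k) ℤ.- uniformΔ (suc m) d k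
uniformΔ-suc m d k = begin
  binomialSum n (λ j → Δ^ j (Δ (u (d ∸ j))) k) ℤ.+ binomialSum n (λ j → Δ^ j (u (suc d ∸ j)) k)
    ≡⟨ binomialSum-+ n _ _ ⟨
  binomialSum n (λ j → Δ^ j (Δ (u (d ∸ j))) k ℤ.+ Δ^ j (u (suc d ∸ j)) k)
    ≡⟨ binomialSum-cong n (λ j _ → step j) ⟩
  binomialSum n (λ j → (Δ^ j (uniform m (suc d ∸ j)) k ℤ.+ Δ^ j (gammaTerm m (suc d ∸ j)) k) ℤ.- Δ^ j (u (d ∸ j)) k)
    ≡⟨ trans (binomialSum-- n _ _) (cong₂ ℤ._-_ (binomialSum-+ n _ _) refl) ⟩
  (uniformΔ m (suc d) k ℤ.+ binomialSum n (λ j → Δ^ j (gammaTerm m (suc d ∸ j)) k)) ℤ.-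
  binomialSum n (λ j → Δ^ j (u (d ∸ j)) k)
    ≡⟨ cong₂ (λ x y → (uniformΔ m (suc d) k ℤ.+ x) ℤ.- y)
         (gammaTerm-reverse m (suc d) k)
         (cong (λ x → binomialSum x (λ j → Δ^ j (u (d ∸ j)) k)) (+-suc m d)) ⟩
  (uniformΔ m (suc d) k ℤ.+ reverse (suc d) (gammaTerm m (suc d)) k) ℤ.- uniformΔ (suc m) d k ∎
  where
  open ≡-Reasoning
  n = m + suc d
  u = uniform (suc m)
  lemma₁ : ∀ x y z → (x ℤ.- y) ℤ.+ z ≡ (z ℤ.+ x) ℤ.- y
  lemma₁ = ℤ-solve
  step : ∀ j → Δ^ j (Δ (u (d ∸ j))) k ℤ.+ Δ^ j (u (suc d ∸ j)) k ≡
         (Δ^ j (uniform m (suc d ∸ j)) k ℤ.+ Δ^ j (gammaTerm m (suc d ∸ j)) k) ℤ.- Δ^ j (u (d ∸ j)) k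
  step j = begin
    Δ^ j (Δ (u (d ∸ j))) k ℤ.+ Δ^ j (u (suc d ∸ j)) k
      ≡⟨ cong (ℤ._+ Δ^ j (u (suc d ∸ j)) k) (Δ^-- j (shift 1 (u (d ∸ j))) (u (d ∸ j)) k) ⟩
    (Δ^ j (shift 1 (u (d ∸ j))) k ℤ.- Δ^ j (u (d ∸ j)) k) ℤ.+ Δ^ j (u (suc d ∸ j)) k
      ≡⟨ lemma₁ (Δ^ j (shift 1 (u (d ∸ j))) k) (Δ^ j (u (d ∸ j)) k) (Δ^ j (u (suc d ∸ j)) k) ⟩
    (Δ^ j (u (suc d ∸ j)) k ℤ.+ Δ^ j (shift 1 (u (d ∸ j))) k) ℤ.- Δ^ j (u (d ∸ j)) k
      ≡⟨ cong (ℤ._- Δ^ j (u (d ∸ j)) k) (trans (sym (Δ^-+ j (u (suc d ∸ j)) (shift 1 (u (d ∸ j))) k))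
           (trans (Δ^-cong j (uniform-recursion m d j) k)
                  (Δ^-+ j (uniform m (suc d ∸ j)) (gammaTerm m (suc d ∸ j)) k))) ⟩
    (Δ^ j (uniform m (suc d ∸ j)) k ℤ.+ Δ^ j (gammaTerm m (suc d ∸ j)) k) ℤ.- Δ^ j (u (d ∸ j)) k ∎

uniform-free : ∀ d i → uniform 0 (suc d) i ≡ δ 0 i
uniform-free d zero    = refl
uniform-free d (suc i) = refl

-- Both sides satisfy the same recursion in m and d: the left by `uniform-recursion`, as reversal
-- absorbs the factor t into the change of rank, the right by deletion-contraction in each summand.
-- The case m = 0 is the binomial theorem.
uniform-reverse : ∀ m d k → reverse d (uniform m d) k ≡ uniformΔ m d k ℤ.+ uniformχ m d (δ 0) k
uniform-reverse m zero k = trans (reverse-0 k) (sym (cong₂ ℤ._+_ (uniformΔ-0 m k) (uniformχ-0 m (δ 0) k)))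
  where
  reverse-0 : ∀ k → reverse 0 (uniform m 0) k ≡ 0ℤ
  reverse-0 zero    = uniform-0 m 0
  reverse-0 (suc k) = refl
uniform-reverse zero (suc d) k = begin
  reverse (suc d) (uniform 0 (suc d)) k
    ≡⟨ reverse-cong (suc d) (uniform-free d) k ⟩
  reverse (suc d) (δ 0) k
    ≡⟨ reverse-δ (suc d) k ⟩
  δ (suc d) k
    ≡⟨ trans (shift-δ (suc d) 0 k) (cong (λ r → δ r k) (+-identityʳ (suc d))) ⟨
  shift (suc d) (δ 0) k
    ≡⟨ binomialSum-Δ^ (suc d) (δ 0) k ⟨
  binomialSum (suc d) (λ j → Δ^ j (δ 0) k)
    -- Since `uniform 0 0` is zero, `uniformΔ` lacks precisely the last term of the binomial
    -- theorem, which is the one supplied by `uniformχ`.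
    ≡⟨ trans (sym (ℤ.+-identityʳ _)) (trans (cong (λ x → binomialSum (suc d) (λ j → Δ^ j (δ 0) k) ℤ.+ x) (sym last0))
         (binomialSum-last (suc d) (λ j → Δ^ j (δ 0) k) (λ j → Δ^ j (uniform 0 (suc d ∸ j)) k) agree)) ⟩
  uniformΔ 0 (suc d) k ℤ.+ Δ^ (suc d) (δ 0) k
    ≡⟨ cong (λ x → uniformΔ 0 (suc d) k ℤ.+ x) (uniformχ-free d (δ 0) k) ⟨
  uniformΔ 0 (suc d) k ℤ.+ uniformχ 0 (suc d) (δ 0) k ∎
  where
  open ≡-Reasoning
  reverse-δ : ∀ d k → reverse d (δ 0) k ≡ δ d k
  reverse-δ zero    zero    = refl
  reverse-δ (suc d) zero    = refl
  reverse-δ zero    (suc k) = refl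
  reverse-δ (suc d) (suc k) = reverse-δ d k
  last0 : Δ^ (suc d) (uniform 0 (suc d ∸ suc d)) k ≡ 0ℤ
  last0 = Δ^-0 (suc d) (λ i → uniform-≥ 0 {i = i} (≤-trans (≤-reflexive (n∸n≡0 d)) z≤n)) k
  agree : ∀ j → j < suc d → Δ^ j (δ 0) k ≡ Δ^ j (uniform 0 (suc d ∸ j)) k
  agree j (s≤s j≤d) = Δ^-cong j (λ i → sym (trans
    (cong (λ r → uniform 0 r i) (+-∸-assoc 1 j≤d)) (uniform-free (d ∸ j) i))) k
uniform-reverse (suc m) (suc d) k = begin
  reverse (suc d) (u (suc d)) k
    ≡⟨ lemma₁ (reverse (suc d) (u (suc d)) k) (reverse d (u d) k) ⟩
  (reverse (suc d) (u (suc d)) k ℤ.+ reverse d (u d) k) ℤ.- reverse d (u d) k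
    ≡⟨ cong (λ x → (reverse (suc d) (u (suc d)) k ℤ.+ x) ℤ.- reverse d (u d) k) (reverse-shift d (u d) k) ⟨
  (reverse (suc d) (u (suc d)) k ℤ.+ reverse (suc d) (shift 1 (u d)) k) ℤ.- reverse d (u d) k
    ≡⟨ cong (ℤ._- reverse d (u d) k) (trans (sym (reverse-+ (suc d) (u (suc d)) (shift 1 (u d)) k))
         (trans (reverse-cong (suc d) (uniform-recursion m d 0) k)
                (reverse-+ (suc d) (uniform m (suc d)) (gammaTerm m (suc d)) k))) ⟩
  (reverse (suc d) (uniform m (suc d)) k ℤ.+ reverse (suc d) (gammaTerm m (suc d)) k) ℤ.- reverse d (u d) k
    ≡⟨ cong₂ (λ x y → (x ℤ.+ reverse (suc d) (gammaTerm m (suc d)) k) ℤ.- y)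
         (uniform-reverse m (suc d) k) (uniform-reverse (suc m) d k) ⟩
  ((uniformΔ m (suc d) k ℤ.+ uniformχ m (suc d) (δ 0) k) ℤ.+ reverse (suc d) (gammaTerm m (suc d)) k) ℤ.-
  (uniformΔ (suc m) d k ℤ.+ uniformχ (suc m) d (δ 0) k)
    ≡⟨ lemma₂ (uniformΔ m (suc d) k) (uniformχ m (suc d) (δ 0) k) _ (uniformΔ (suc m) d k) (uniformχ (suc m) d (δ 0) k) ⟩
  ((uniformΔ m (suc d) k ℤ.+ reverse (suc d) (gammaTerm m (suc d)) k) ℤ.- uniformΔ (suc m) d k) ℤ.+
  (uniformχ m (suc d) (δ 0) k ℤ.- uniformχ (suc m) d (δ 0) k)
    ≡⟨ cong₂ ℤ._+_ (uniformΔ-suc m d k) (uniformχ-suc m d (δ 0) k) ⟨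
  uniformΔ (suc m) (suc d) k ℤ.+ uniformχ (suc m) (suc d) (δ 0) k ∎
  where
  open ≡-Reasoning
  u = uniform (suc m)
  lemma₁ : ∀ x y → x ≡ (x ℤ.+ y) ℤ.- y
  lemma₁ = ℤ-solve
  lemma₂ : ∀ a b c d e → ((a ℤ.+ b) ℤ.+ c) ℤ.- (d ℤ.+ e) ≡ ((a ℤ.+ c) ℤ.- d) ℤ.+ (b ℤ.- e)
  lemma₂ = ℤ-solve

-- The contribution of a single circuit-hyperplane

-- The amount by which a circuit-hyperplane lowers the Kazhdan–Lusztig polynomial in rank d.
-- Relaxing the circuit-hyperplane of U_{d-1,d} ⊕ U_{1,1} gives U_{d,d+1}, which determines it.
defect : (d k : ℕ) → ℤ
defect d k = uniform 1 d k ℤ.- uniform 1 (pred d) k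

-- For positive d, t - 1 times the characteristic polynomial of U_{d,d+1} is that of its sum with a
-- coloop. The last term is the change caused by relaxing the circuit-hyperplane of that sum.
uniformχ-1 : ∀ d k → uniformχ 1 (suc d) (δ 0) k ≡ Δ (uniformχ 1 d (δ 0)) k ℤ.+ sign d ℤ.* Δ (δ 0) k
uniformχ-1 zero k = begin
  uniformχ 1 1 (δ 0) k
    ≡⟨ uniformχ-suc 0 0 (δ 0) k ⟩
  uniformχ 0 1 (δ 0) k ℤ.- uniformχ 1 0 (δ 0) k
    ≡⟨ cong₂ ℤ._-_ (uniformχ-free 0 (δ 0) k) (uniformχ-0 1 (δ 0) k) ⟩
  Δ (δ 0) k ℤ.- 0ℤ
    ≡⟨ lemma (Δ (δ 0) k) ⟩
  0ℤ ℤ.+ 1ℤ ℤ.* Δ (δ 0) k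
    ≡⟨ cong (ℤ._+ 1ℤ ℤ.* Δ (δ 0) k) (Δ^-0 1 (uniformχ-0 1 (δ 0)) k) ⟨
  Δ (uniformχ 1 0 (δ 0)) k ℤ.+ 1ℤ ℤ.* Δ (δ 0) k ∎
  where
  open ≡-Reasoning
  lemma : ∀ x → x ℤ.- 0ℤ ≡ 0ℤ ℤ.+ 1ℤ ℤ.* x
  lemma = ℤ-solve
uniformχ-1 (suc d) k = begin
  X (2 + d) k
    ≡⟨ uniformχ-suc 0 (suc d) (δ 0) k ⟩
  uniformχ 0 (2 + d) (δ 0) k ℤ.- X (suc d) k
    ≡⟨ cong₂ ℤ._-_ (uniformχ-free (suc d) (δ 0) k) (uniformχ-1 d k) ⟩
  Δ^ (2 + d) (δ 0) k ℤ.- (Δ (X d) k ℤ.+ sign d ℤ.* Δ (δ 0) k)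
    ≡⟨ lemma (Δ^ (2 + d) (δ 0) k) (Δ (X d) k) (sign d) (Δ (δ 0) k) ⟩
  (Δ^ (2 + d) (δ 0) k ℤ.- Δ (X d) k) ℤ.+ (ℤ.- sign d) ℤ.* Δ (δ 0) k
    ≡⟨ cong (ℤ._+ (ℤ.- sign d) ℤ.* Δ (δ 0) k) (begin
         Δ^ (2 + d) (δ 0) k ℤ.- Δ (X d) k
           ≡⟨ cong (ℤ._- Δ (X d) k) (Δ^-Δ (suc d) (δ 0) k) ⟩
         Δ (Δ^ (suc d) (δ 0)) k ℤ.- Δ (X d) k
           ≡⟨ Δ^-- 1 (Δ^ (suc d) (δ 0)) (X d) k ⟨
         Δ (λ i → Δ^ (suc d) (δ 0) i ℤ.- X d i) k
           ≡⟨ Δ-cong (λ i → trans (uniformχ-suc 0 d (δ 0) i)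
                (cong (ℤ._- X d i) (uniformχ-free d (δ 0) i))) k ⟨
         Δ (X (suc d)) k ∎) ⟩
  Δ (X (suc d)) k ℤ.+ (ℤ.- sign d) ℤ.* Δ (δ 0) k ∎
  where
  open ≡-Reasoning
  X = λ d → uniformχ 1 d (δ 0)
  lemma : ∀ x y s z → x ℤ.- (y ℤ.+ s ℤ.* z) ≡ (x ℤ.- y) ℤ.+ (ℤ.- s) ℤ.* z
  lemma = ℤ-solve

-- The part of the Kazhdan-Lusztig recursion proportional to the number of circuit-hyperplanes, up
-- to sign. It is the reversal identity for `uniform 1` in rank d + 1 minus t times that in rank d.
defect-reverse : ∀ d k → reverse (suc d) (defect (suc d)) k ≡
  (binomialSum (suc d) (λ j → Δ^ j (defect (suc d ∸ j)) k) ℤ.- uniformχ 1 d (δ 0) k) ℤ.+ sign d ℤ.* Δ (δ 0) k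
defect-reverse d k = begin
  reverse (suc d) (defect (suc d)) k
    ≡⟨ reverse-- (suc d) (u (suc d)) (u d) k ⟩
  reverse (suc d) (u (suc d)) k ℤ.- reverse (suc d) (u d) k
    ≡⟨ cong₂ ℤ._-_ (uniform-reverse 1 (suc d) k) (trans
         (sym (shift-reverse d (u d) (uniform-≥ 1 (n≤1+n d)) k))
         (trans (shift-cong 1 (uniform-reverse 1 d) k) (shift-+ 1 (uniformΔ 1 d) (X d) k))) ⟩
  (uniformΔ 1 (suc d) k ℤ.+ X (suc d) k) ℤ.- (shift 1 (uniformΔ 1 d) k ℤ.+ shift 1 (X d) k)
    ≡⟨ cong₂ (λ x y → (x ℤ.+ y) ℤ.- (shift 1 (uniformΔ 1 d) k ℤ.+ shift 1 (X d) k))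
         sum (uniformχ-1 d k) ⟩
  ((s ℤ.+ shift 1 (uniformΔ 1 d) k) ℤ.+ (Δ (X d) k ℤ.+ sign d ℤ.* Δ (δ 0) k)) ℤ.-
  (shift 1 (uniformΔ 1 d) k ℤ.+ shift 1 (X d) k)
    ≡⟨ lemma s (shift 1 (uniformΔ 1 d) k) (shift 1 (X d) k) (X d k) (sign d ℤ.* Δ (δ 0) k) ⟩
  (s ℤ.- X d k) ℤ.+ sign d ℤ.* Δ (δ 0) k ∎
  where
  open ≡-Reasoning
  u = uniform 1
  X = λ d → uniformχ 1 d (δ 0)
  s = binomialSum (suc d) (λ j → Δ^ j (defect (suc d ∸ j)) k)
  shift-+ : ∀ s f g k → shift s (λ i → f i ℤ.+ g i) k ≡ shift s f k ℤ.+ shift s g k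
  shift-+ zero    f g k       = refl
  shift-+ (suc s) f g zero    = refl
  shift-+ (suc s) f g (suc k) = shift-+ s f g k
  lemma : ∀ s a b c e → ((s ℤ.+ a) ℤ.+ ((b ℤ.- c) ℤ.+ e)) ℤ.- (a ℤ.+ b) ≡ (s ℤ.- c) ℤ.+ e
  lemma = ℤ-solve
  lemma₂ : ∀ a b c → (a ℤ.- b) ℤ.+ c ≡ (c ℤ.- b) ℤ.+ a
  lemma₂ = ℤ-solve
  -- Pascal's rule splits off (t - 1) times the sum in rank d; its -1 part, combined with the
  -- remaining sum, turns `uniform 1` into `defect`.
  sum : uniformΔ 1 (suc d) k ≡ s ℤ.+ shift 1 (uniformΔ 1 d) k
  sum = begin
    binomialSum (suc d) (λ j → Δ^ j (Δ (u (d ∸ j))) k) ℤ.+ binomialSum (suc d) (λ j → Δ^ j (u (suc d ∸ j)) k)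
      ≡⟨ cong (ℤ._+ binomialSum (suc d) (λ j → Δ^ j (u (suc d ∸ j)) k)) (trans
           (binomialSum-cong (suc d) (λ j _ → Δ^-Δ j (u (d ∸ j)) k))
           (sym (Δ-binomialSum (suc d) (λ j → Δ^ j (u (d ∸ j))) k))) ⟩
    Δ (uniformΔ 1 d) k ℤ.+ binomialSum (suc d) (λ j → Δ^ j (u (suc d ∸ j)) k)
      ≡⟨ lemma₂ (shift 1 (uniformΔ 1 d) k) (uniformΔ 1 d k) _ ⟩
    (binomialSum (suc d) (λ j → Δ^ j (u (suc d ∸ j)) k) ℤ.- uniformΔ 1 d k) ℤ.+ shift 1 (uniformΔ 1 d) k
      ≡⟨ cong (ℤ._+ shift 1 (uniformΔ 1 d) k) (trans
           (sym (binomialSum-- (suc d) (λ j → Δ^ j (u (suc d ∸ j)) k) (λ j → Δ^ j (u (d ∸ j)) k)))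
           (binomialSum-cong (suc d) (λ j _ → trans (sym (Δ^-- j (u (suc d ∸ j)) (u (d ∸ j)) k))
             (Δ^-cong j (λ i → cong (λ r → u (suc d ∸ j) i ℤ.- u r i) (sym (pred[m∸n]≡m∸[1+n] (suc d) j))) k)))) ⟩
    s ℤ.+ shift 1 (uniformΔ 1 d) k ∎

-- Closed forms for the coefficients of uniform matroids

falling : ∀ k r → suc k * ((k + r) choose suc k) ≡ r * ((k + r) choose k)
falling k r = +-cancelˡ-≡ (suc k * ((k + r) choose k)) _ _ (begin
  suc k * ((k + r) choose k) + suc k * ((k + r) choose suc k) ≡⟨ *-distribˡ-+ (suc k) ((k + r) choose k) _ ⟨
  suc k * ((k + r) choose k + (k + r) choose suc k)           ≡⟨ cong (suc k *_) (pascal (k + r) k) ⟨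
  suc k * (suc (k + r) choose suc k)                          ≡⟨ absorption (k + r) k ⟩
  (suc k + r) * ((k + r) choose k)                            ≡⟨ *-distribʳ-+ ((k + r) choose k) (suc k) r ⟩
  suc k * ((k + r) choose k) + r * ((k + r) choose k)         ∎)
  where open ≡-Reasoning

-- C(i + h - 1, h), by a recursion that covers i = 0 without truncated subtraction.
multichoose : ℕ → ℕ → ℕ
multichoose i       zero    = 1
multichoose zero    (suc h) = 0
multichoose (suc i) (suc h) = multichoose (suc i) h + multichoose i (suc h)

multichoose-C : ∀ i h → multichoose (suc i) h ≡ (i + h) choose i
multichoose-C i       zero    = sym (trans (cong (_choose i) (+-identityʳ i)) (nCn≡1 i))
multichoose-C zero    (suc h) = trans (+-identityʳ (multichoose 1 h))
  (trans (multichoose-C zero h) (trans (nC0≡1 h) (sym (nC0≡1 (suc h)))))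
multichoose-C (suc i) (suc h) = begin
  multichoose (suc (suc i)) h + multichoose (suc i) (suc h)
    ≡⟨ cong₂ _+_ (multichoose-C (suc i) h) (multichoose-C i (suc h)) ⟩
  (suc i + h) choose suc i + (i + suc h) choose i
    ≡⟨ cong (λ n → n choose suc i + (i + suc h) choose i) (+-suc i h) ⟨
  (i + suc h) choose suc i + (i + suc h) choose i
    ≡⟨ +-comm ((i + suc h) choose suc i) _ ⟩
  (i + suc h) choose i + (i + suc h) choose suc i
    ≡⟨ pascal (i + suc h) i ⟨
  (suc i + suc h) choose suc i ∎
  where open ≡-Reasoning

multichoose-absorption : ∀ k m → suc m * multichoose k (suc m) ≡ k * multichoose (suc k) m
multichoose-absorption zero    m = *-zeroʳ m
multichoose-absorption (suc k) m = begin
  suc m * multichoose (suc k) (suc m) ≡⟨ cong (suc m *_) (multichoose-C k (suc m)) ⟩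
  suc m * ((k + suc m) choose k)      ≡⟨ falling k (suc m) ⟨
  suc k * ((k + suc m) choose suc k)  ≡⟨ cong (λ n → suc k * (n choose suc k)) (+-suc k m) ⟩
  suc k * ((suc k + m) choose suc k)  ≡⟨ cong (suc k *_) (multichoose-C (suc k) m) ⟨
  suc k * multichoose (suc (suc k)) m ∎
  where open ≡-Reasoning

-- The sum over h < m of C(e + h, h + i + 1) C(i + h - 1, h), the nontrivial factor in the closed
-- formula for coefficient i in rank i + e.
coefficientSum : (m i e : ℕ) → ℕ
coefficientSum zero    i e = 0
coefficientSum (suc m) i e = coefficientSum m i e + ((e + m) choose suc (m + i)) * multichoose i m

-- With `e` fixed, the pairs `suc i`, `i` belong to the ranks d and d - 1 that meet in the
-- recursion. Their sum telescopes to one product, by Pascal's rule in both factors.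
coefficientSum-+ : ∀ m i e → coefficientSum (suc m) (suc i) e + coefficientSum (suc m) i e ≡
                   ((suc m + e) choose (suc m + suc i)) * multichoose (suc i) m
coefficientSum-+ zero i e = begin
  ((e + 0) choose suc (suc i)) * 1 + ((e + 0) choose suc i) * 1
    ≡⟨ cong (λ n → (n choose suc (suc i)) * 1 + (n choose suc i) * 1) (+-identityʳ e) ⟩
  (e choose suc (suc i)) * 1 + (e choose suc i) * 1
    ≡⟨ lemma (e choose suc (suc i)) (e choose suc i) ⟩
  (e choose suc i + e choose suc (suc i)) * 1
    ≡⟨ cong (_* 1) (pascal e (suc i)) ⟨
  (suc e choose suc (suc i)) * 1 ∎
  where
  open ≡-Reasoning
  lemma : ∀ x y → x * 1 + y * 1 ≡ (y + x) * 1
  lemma = solve-∀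
coefficientSum-+ (suc m) i e = begin
  (coefficientSum (suc m) (suc i) e + ((e + suc m) choose suc (suc m + suc i)) * (p + q)) +
  (coefficientSum (suc m) i e + ((e + suc m) choose suc (suc m + i)) * q)
    ≡⟨ cong₂ (λ n x → (coefficientSum (suc m) (suc i) e + (n choose suc (suc m + suc i)) * (p + q)) +
                      (coefficientSum (suc m) i e + (n choose suc x) * q)) (+-comm e (suc m)) (sym (+-suc m i)) ⟩
  (coefficientSum (suc m) (suc i) e + ((suc m + e) choose suc (suc m + suc i)) * (p + q)) +
  (coefficientSum (suc m) i e + ((suc m + e) choose (suc m + suc i)) * q)
    ≡⟨ lemma₁ (coefficientSum (suc m) (suc i) e) ((suc m + e) choose suc (suc m + suc i)) (coefficientSum (suc m) i e)
              ((suc m + e) choose (suc m + suc i)) p q ⟩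
  (coefficientSum (suc m) (suc i) e + coefficientSum (suc m) i e) +
  (((suc m + e) choose suc (suc m + suc i)) * (p + q) + ((suc m + e) choose (suc m + suc i)) * q)
    ≡⟨ cong (_+ (((suc m + e) choose suc (suc m + suc i)) * (p + q) + ((suc m + e) choose (suc m + suc i)) * q))
         (coefficientSum-+ m i e) ⟩
  ((suc m + e) choose (suc m + suc i)) * p +
  (((suc m + e) choose suc (suc m + suc i)) * (p + q) + ((suc m + e) choose (suc m + suc i)) * q)
    ≡⟨ lemma₂ ((suc m + e) choose (suc m + suc i)) ((suc m + e) choose suc (suc m + suc i)) p q ⟩
  ((suc m + e) choose (suc m + suc i) + (suc m + e) choose suc (suc m + suc i)) * (p + q)
    ≡⟨ cong (_* (p + q)) (pascal (suc m + e) (suc m + suc i)) ⟨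
  ((suc (suc m) + e) choose (suc (suc m) + suc i)) * (p + q) ∎
  where
  open ≡-Reasoning
  p = multichoose (suc i) m
  q = multichoose i (suc m)
  lemma₁ : ∀ a b c d p q → (a + b * (p + q)) + (c + d * q) ≡ (a + c) + (b * (p + q) + d * q)
  lemma₁ = solve-∀
  lemma₂ : ∀ a b p q → a * p + (b * (p + q) + a * q) ≡ (a + b) * (p + q)
  lemma₂ = solve-∀

coefficientSum-0 : ∀ m e → coefficientSum (suc m) 0 e ≡ e
coefficientSum-0 zero    e = begin
  ((e + 0) choose 1) * 1 ≡⟨ *-identityʳ _ ⟩
  (e + 0) choose 1       ≡⟨ cong (_choose 1) (+-identityʳ e) ⟩
  e choose 1             ≡⟨ nC1≡n e ⟩
  e                      ∎
  where open ≡-Reasoning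
coefficientSum-0 (suc m) e = trans
  (cong₂ _+_ (coefficientSum-0 m e) (*-zeroʳ ((e + suc m) choose suc (suc m + 0)))) (+-identityʳ e)

coefficientSum-≤ : ∀ m {i e} → e ≤ i → coefficientSum m i e ≡ 0
coefficientSum-≤ zero    e≤i = refl
coefficientSum-≤ (suc m) {i} {e} e≤i = cong₂ _+_ (coefficientSum-≤ m e≤i)
  (cong (_* multichoose i m) (k>n⇒nCk≡0 (s≤s (≤-trans (≤-reflexive (+-comm e m)) (+-monoʳ-≤ m e≤i)))))

-- In rank 2i + 1 every first factor is of the form C(n, n), and what is left is summed by the
-- recursion of `multichoose`.
coefficientSum-1 : ∀ m i → coefficientSum (suc m) i (suc i) ≡ multichoose (suc i) m
coefficientSum-1 m i = go m
  where
  last : ∀ m → ((suc i + m) choose suc (m + i)) * multichoose i m ≡ multichoose i m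
  last m = trans (cong (_* multichoose i m)
    (trans (cong (λ n → suc n choose suc (m + i)) (+-comm i m)) (nCn≡1 (suc (m + i)))))
    (*-identityˡ _)
  go : ∀ m → coefficientSum (suc m) i (suc i) ≡ multichoose (suc i) m
  go zero    = last 0
  go (suc m) = cong₂ _+_ (go m) (last (suc m))

-- The factor `e` replaces a division by d - i. The recursion's middle coefficient lives in rank
-- `i + suc i`, where that factor is `suc i`; therefore the whole identity is multiplied by `suc i`
-- before the three known closed forms are inserted.
uniform-closed : ∀ i m e → + e ℤ.* uniform (suc m) (i + e) i ≡
                 + (((suc m + (i + e)) choose i) * coefficientSum (suc m) i e)
uniform-closed zero m e = begin
  + e ℤ.* + (1 ⊓ e)                                       ≡⟨ unit e ⟩
  + e                                                     ≡⟨ cong +_ (trans (cong₂ _*_ (nC0≡1 (suc m + e)) (coefficientSum-0 m e)) (*-identityˡ e)) ⟨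
  + (((suc m + e) choose 0) * coefficientSum (suc m) 0 e) ∎
  where
  open ≡-Reasoning
  unit : ∀ e → + e ℤ.* + (1 ⊓ e) ≡ + e
  unit zero    = refl
  unit (suc e) = ℤ.*-identityʳ (+ suc e)
uniform-closed (suc i) m e = ℤ.*-cancelˡ-≡ (+ suc i) _ _ (begin
  + suc i ℤ.* (+ e ℤ.* ((u₀ ℤ.+ + c ℤ.* t) ℤ.- u₁))
    ≡⟨ distribute (+ suc i) (+ e) u₀ (+ c) t u₁ ⟩
  (+ suc i ℤ.* (+ e ℤ.* u₀) ℤ.+ (+ e ℤ.* + c) ℤ.* (+ suc i ℤ.* t)) ℤ.- + suc i ℤ.* (+ e ℤ.* u₁)
    ≡⟨ cong₂ ℤ._-_ (cong₂ ℤ._+_ (cong (+ suc i ℤ.*_) (previous m)) (cong (+ e ℤ.* + c ℤ.*_) top))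
                   (cong (+ suc i ℤ.*_) (uniform-closed i m e)) ⟩
  (+ suc i ℤ.* + (c₁ * g₀) ℤ.+ (+ e ℤ.* + c) ℤ.* + (c₂ * s)) ℤ.- + suc i ℤ.* + (c₀ * g₁)
    ≡⟨ cong₂ ℤ._-_ (cong₂ ℤ._+_ (sym (ℤ.pos-* (suc i) (c₁ * g₀)))
         (trans (cong (ℤ._* + (c₂ * s)) (sym (ℤ.pos-* e c))) (sym (ℤ.pos-* (e * c) (c₂ * s)))))
         (sym (ℤ.pos-* (suc i) (c₀ * g₁))) ⟩
  + (suc i * (c₁ * g₀) + (e * c) * (c₂ * s)) ℤ.- + (suc i * (c₀ * g₁))
    ≡⟨ cong (λ x → + x ℤ.- + (suc i * (c₀ * g₁))) key ⟨
  (+ (suc i * (C′ * (g₀ + w))) ℤ.+ + (suc i * (c₀ * g₁))) ℤ.- + (suc i * (c₀ * g₁))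
    ≡⟨ cancel (+ (suc i * (C′ * (g₀ + w)))) (+ (suc i * (c₀ * g₁))) ⟩
  + (suc i * (C′ * (g₀ + w)))
    ≡⟨ ℤ.pos-* (suc i) (C′ * (g₀ + w)) ⟩
  + suc i ℤ.* + (C′ * (g₀ + w)) ∎)
  where
  open ≡-Reasoning
  N = m + (suc i + e)
  x = suc (m + suc i)
  s = multichoose (suc i) m
  u₀ = uniform m (suc i + e) (suc i)
  u₁ = uniform (suc m) (i + e) i
  t = uniform (suc m) (suc (2 * i)) i
  c = N choose (m + 2 * suc i)
  c₀ = (suc m + (i + e)) choose i
  c₁ = N choose suc i
  c₂ = (i + x) choose i
  C′ = suc N choose suc i
  g₀ = coefficientSum m (suc i) e
  g₁ = coefficientSum (suc m) i e
  w = ((e + m) choose suc (m + suc i)) * s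

  distribute : ∀ i e u c t v → i ℤ.* (e ℤ.* ((u ℤ.+ c ℤ.* t) ℤ.- v)) ≡
               (i ℤ.* (e ℤ.* u) ℤ.+ (e ℤ.* c) ℤ.* (i ℤ.* t)) ℤ.- i ℤ.* (e ℤ.* v)
  distribute = ℤ-solve
  cancel : ∀ x y → (x ℤ.+ y) ℤ.- y ≡ x
  cancel = ℤ-solve

  -- The closed form is stated for `suc m`; for m = 0 both sides are zero in positive degree.
  previous : ∀ m → + e ℤ.* uniform m (suc i + e) (suc i) ≡
             + (((m + (suc i + e)) choose suc i) * coefficientSum m (suc i) e)
  previous zero    = trans (ℤ.*-zeroʳ (+ e)) (cong +_ (sym (*-zeroʳ ((suc i + e) choose suc i))))
  previous (suc m) = uniform-closed (suc i) m e

  index₁ : ∀ i → i + suc i ≡ suc (2 * i)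
  index₁ = solve-∀
  index₂ : ∀ m i → suc m + (i + suc i) ≡ i + suc (m + suc i)
  index₂ = solve-∀
  index₃ : ∀ m i → m + 2 * suc i ≡ i + suc (m + suc i)
  index₃ = solve-∀
  index₄ : ∀ m i e → m + (suc i + e) ≡ i + suc (m + e)
  index₄ = solve-∀

  top : + suc i ℤ.* t ≡ + (c₂ * s)
  top = begin
    + suc i ℤ.* t
      ≡⟨ cong (λ d → + suc i ℤ.* uniform (suc m) d i) (index₁ i) ⟨
    + suc i ℤ.* uniform (suc m) (i + suc i) i
      ≡⟨ uniform-closed i m (suc i) ⟩
    + (((suc m + (i + suc i)) choose i) * coefficientSum (suc m) i (suc i))
      ≡⟨ cong₂ (λ n y → + ((n choose i) * y)) (index₂ m i) (coefficientSum-1 m i) ⟩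
    + (c₂ * s) ∎

  c₀≡ : c₀ ≡ N choose i
  c₀≡ = cong (_choose i) (sym (+-suc m (i + e)))

  revision : c * c₂ ≡ (N choose i) * (suc (m + e) choose x)
  revision = trans (cong (λ y → (N choose y) * c₂) (index₃ m i))
    (trans (trinomial-revision N i x) (cong (λ y → (N choose i) * (y choose x))
      (trans (cong (_∸ i) (index₄ m i e)) (m+n∸m≡n i (suc (m + e))))))

  drop : suc i * c₁ ≡ suc (m + e) * (N choose i)
  drop = subst (λ n → suc i * (n choose suc i) ≡ suc (m + e) * (n choose i)) (sym (index₄ m i e)) (falling i (suc (m + e)))

  shrink : suc i * (suc (m + e) choose x) + suc (m + e) * ((m + e) choose x) ≡ e * (suc (m + e) choose x)
  -- Adding `suc m * C₁` completes the factor `suc i` to `x`, so that absorption applies.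
  shrink = +-cancelˡ-≡ (suc m * C₁) _ _ (begin
    suc m * C₁ + (suc i * C₁ + suc (m + e) * C₀)
      ≡⟨ lemma₁ m i C₁ (suc (m + e) * C₀) ⟩
    x * C₁ + suc (m + e) * C₀
      ≡⟨ cong (_+ suc (m + e) * C₀) (absorption (m + e) (m + suc i)) ⟩
    suc (m + e) * ((m + e) choose (m + suc i)) + suc (m + e) * C₀
      ≡⟨ *-distribˡ-+ (suc (m + e)) ((m + e) choose (m + suc i)) C₀ ⟨
    suc (m + e) * ((m + e) choose (m + suc i) + C₀)
      ≡⟨ cong (suc (m + e) *_) (pascal (m + e) (m + suc i)) ⟨
    suc (m + e) * C₁
      ≡⟨ *-distribʳ-+ C₁ (suc m) e ⟩
    suc m * C₁ + e * C₁ ∎)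
    where
    C₀ = (m + e) choose x
    C₁ = suc (m + e) choose x
    lemma₁ : ∀ m i y z → suc m * y + (suc i * y + z) ≡ suc (m + suc i) * y + z
    lemma₁ = solve-∀

  -- The subtracted term of the recursion stands on the left, which keeps the identity within
  -- natural numbers.
  key : suc i * (C′ * (g₀ + w)) + suc i * (c₀ * g₁) ≡ suc i * (c₁ * g₀) + (e * c) * (c₂ * s)
  key = begin
    suc i * (C′ * (g₀ + w)) + suc i * (c₀ * g₁)
      ≡⟨ cong₂ (λ y z → suc i * (y * (g₀ + w)) + suc i * (z * g₁)) (pascal N i) c₀≡ ⟩
    suc i * ((k₀ + c₁) * (g₀ + w)) + suc i * (k₀ * g₁)
      ≡⟨ lemma₁ (suc i) k₀ c₁ g₀ w g₁ ⟩
    suc i * (c₁ * g₀) + (suc i * (k₀ * ((g₀ + w) + g₁)) + (suc i * c₁) * w)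
      ≡⟨ cong₂ (λ y z → suc i * (c₁ * g₀) + (suc i * (k₀ * y) + z * w)) (coefficientSum-+ m i e) drop ⟩
    suc i * (c₁ * g₀) + (suc i * (k₀ * ((suc (m + e) choose x) * s)) + (suc (m + e) * k₀) * w)
      ≡⟨ cong (λ y → suc i * (c₁ * g₀) + (suc i * (k₀ * ((suc (m + e) choose x) * s)) + (suc (m + e) * k₀) * ((y choose x) * s))) (+-comm e m) ⟩
    suc i * (c₁ * g₀) + (suc i * (k₀ * ((suc (m + e) choose x) * s)) + (suc (m + e) * k₀) * (((m + e) choose x) * s))
      ≡⟨ cong (λ y → suc i * (c₁ * g₀) + y) (lemma₂ (suc i) k₀ (suc (m + e) choose x) s (suc (m + e)) ((m + e) choose x)) ⟩
    suc i * (c₁ * g₀) + (k₀ * s) * (suc i * (suc (m + e) choose x) + suc (m + e) * ((m + e) choose x))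
      ≡⟨ cong (λ y → suc i * (c₁ * g₀) + (k₀ * s) * y) shrink ⟩
    suc i * (c₁ * g₀) + (k₀ * s) * (e * (suc (m + e) choose x))
      ≡⟨ cong (λ y → suc i * (c₁ * g₀) + y) (lemma₃ k₀ s e (suc (m + e) choose x)) ⟩
    suc i * (c₁ * g₀) + (e * (k₀ * (suc (m + e) choose x))) * s
      ≡⟨ cong (λ y → suc i * (c₁ * g₀) + (e * y) * s) revision ⟨
    suc i * (c₁ * g₀) + (e * (c * c₂)) * s
      ≡⟨ cong (λ y → suc i * (c₁ * g₀) + y) (lemma₄ e c c₂ s) ⟩
    suc i * (c₁ * g₀) + (e * c) * (c₂ * s) ∎
    where
    k₀ = N choose i
    lemma₁ : ∀ i k c g w h → i * ((k + c) * (g + w)) + i * (k * h) ≡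
             i * (c * g) + (i * (k * ((g + w) + h)) + (i * c) * w)
    lemma₁ = solve-∀
    lemma₂ : ∀ i k a s n b → i * (k * (a * s)) + (n * k) * (b * s) ≡ (k * s) * (i * a + n * b)
    lemma₂ = solve-∀
    lemma₃ : ∀ k s e a → (k * s) * (e * a) ≡ (e * (k * a)) * s
    lemma₃ = solve-∀
    lemma₄ : ∀ e c d s → (e * (c * d)) * s ≡ (e * c) * (d * s)
    lemma₄ = solve-∀

-- With `e` = d - i at most `i`, every binomial C(e + h, h + i + 1) in the closed form vanishes. The
-- range `d ≤ i` is treated apart, since there the factor `e` could not be cancelled.
uniform-degree : ∀ m {d i} → 0 < d → d ≤ 2 * i → uniform m d i ≡ 0ℤ
uniform-degree zero    {suc d} {suc i} 0<d d≤2i = refl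
uniform-degree zero    {suc d} {zero}  0<d ()
uniform-degree (suc m) {d}     {i}     0<d d≤2i with d ≤? i
... | yes d≤i = uniform-≥ (suc m) d≤i
... | no  d≰i with m≤n⇒∃[o]m+o≡n (≰⇒> d≰i)
... | e , refl = ℤ.*-cancelˡ-≡ (+ suc e) _ _ (begin
  + suc e ℤ.* uniform (suc m) (suc i + e) i
    ≡⟨ cong (λ d → + suc e ℤ.* uniform (suc m) d i) (+-suc i e) ⟨
  + suc e ℤ.* uniform (suc m) (i + suc e) i
    ≡⟨ uniform-closed i m (suc e) ⟩
  + (((suc m + (i + suc e)) choose i) * coefficientSum (suc m) i (suc e))
    ≡⟨ cong (λ x → + (((suc m + (i + suc e)) choose i) * x)) (coefficientSum-≤ (suc m) e<i) ⟩
  + (((suc m + (i + suc e)) choose i) * 0)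
    ≡⟨ cong +_ (*-zeroʳ ((suc m + (i + suc e)) choose i)) ⟩
  0ℤ
    ≡⟨ ℤ.*-zeroʳ (+ suc e) ⟨
  + suc e ℤ.* 0ℤ ∎)
  where
  open ≡-Reasoning
  e<i : suc e ≤ i
  e<i = +-cancelˡ-≤ i _ _ (≤-trans (≤-reflexive (+-suc i e)) (≤-trans d≤2i (≤-reflexive (cong (λ y → i + y) (+-identityʳ i)))))

uniform-top-odd : ∀ m k → + suc k ℤ.* uniform (suc m) (k + suc k) k ≡
                  + (((suc m + (k + suc k)) choose k) * ((k + m) choose k))
uniform-top-odd m k = trans (uniform-closed k m (suc k))
  (cong (λ x → + (((suc m + (k + suc k)) choose k) * x)) (trans (coefficientSum-1 m k) (multichoose-C k m)))

-- In rank 2k + 2 the first factors are the linear terms k + 2 + h. The factor `suc k` clears the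
-- denominator of the weighted sum, whose induction step is `multichoose-absorption`.
coefficientSum-2 : ∀ m k → suc k * coefficientSum (suc m) k (2 + k) ≡ ((k + m) choose k) * (suc k * (2 + k) + k * m)
coefficientSum-2 m k = trans (go m) (cong (_* (suc k * (2 + k) + k * m)) (multichoose-C k m))
  where
  open ≡-Reasoning
  last : ∀ m → (2 + k + m) choose suc (m + k) ≡ 2 + k + m
  last m = begin
    (2 + k + m) choose suc (m + k)               ≡⟨ cong (λ n → (2 + k + m) choose suc n) (+-comm m k) ⟩
    (2 + k + m) choose suc (k + m)               ≡⟨ nCk≡nC[n∸k] {suc (k + m)} {2 + k + m} (n≤1+n (suc (k + m))) ⟩
    (2 + k + m) choose (2 + k + m ∸ suc (k + m)) ≡⟨ cong ((2 + k + m) choose_) (m+n∸n≡m 1 (suc (k + m))) ⟩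
    (2 + k + m) choose 1                         ≡⟨ nC1≡n (2 + k + m) ⟩
    2 + k + m                                    ∎
  go : ∀ m → suc k * coefficientSum (suc m) k (2 + k) ≡ multichoose (suc k) m * (suc k * (2 + k) + k * m)
  go zero    = trans (cong (λ x → suc k * (x * 1)) (last 0)) (lemma k)
    where
    lemma : ∀ k → suc k * ((2 + k + 0) * 1) ≡ 1 * (suc k * (2 + k) + k * 0)
    lemma = solve-∀
  go (suc m) = begin
    suc k * (coefficientSum (suc m) k (2 + k) + ((2 + k + suc m) choose suc (suc m + k)) * q)
      ≡⟨ *-distribˡ-+ (suc k) (coefficientSum (suc m) k (2 + k)) _ ⟩
    suc k * coefficientSum (suc m) k (2 + k) + suc k * (((2 + k + suc m) choose suc (suc m + k)) * q)
      ≡⟨ cong₂ (λ x y → x + suc k * (y * q)) (go m) (last (suc m)) ⟩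
    p * (suc k * (2 + k) + k * m) + suc k * ((2 + k + suc m) * q)
      ≡⟨ lemma₁ k m p q ⟩
    (p * (suc k * (2 + k) + k * m) + q * (suc k * (2 + k) + k * suc m)) + suc m * q
      ≡⟨ cong (λ x → (p * (suc k * (2 + k) + k * m) + q * (suc k * (2 + k) + k * suc m)) + x) (multichoose-absorption k m) ⟩
    (p * (suc k * (2 + k) + k * m) + q * (suc k * (2 + k) + k * suc m)) + k * p
      ≡⟨ lemma₂ k m p q ⟩
    (p + q) * (suc k * (2 + k) + k * suc m) ∎
    where
    p = multichoose (suc k) m
    q = multichoose k (suc m)
    lemma₁ : ∀ k m p q → p * (suc k * (2 + k) + k * m) + suc k * ((2 + k + suc m) * q) ≡
             (p * (suc k * (2 + k) + k * m) + q * (suc k * (2 + k) + k * suc m)) + suc m * q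
    lemma₁ = solve-∀
    lemma₂ : ∀ k m p q → (p * (suc k * (2 + k) + k * m) + q * (suc k * (2 + k) + k * suc m)) + k * p ≡
             (p + q) * (suc k * (2 + k) + k * suc m)
    lemma₂ = solve-∀

uniform-top-even : ∀ m k → + (suc k * (2 + k)) ℤ.* uniform (suc m) (k + (2 + k)) k ≡
                   + (((suc m + (k + (2 + k))) choose k) * (((k + m) choose k) * (suc k * (2 + k) + k * m)))
uniform-top-even m k = begin
  + (suc k * (2 + k)) ℤ.* u
    ≡⟨ cong (ℤ._* u) (ℤ.pos-* (suc k) (2 + k)) ⟩
  (+ suc k ℤ.* + (2 + k)) ℤ.* u
    ≡⟨ ℤ.*-assoc (+ suc k) (+ (2 + k)) u ⟩
  + suc k ℤ.* (+ (2 + k) ℤ.* u)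
    ≡⟨ cong (+ suc k ℤ.*_) (uniform-closed k m (2 + k)) ⟩
  + suc k ℤ.* + (c * coefficientSum (suc m) k (2 + k))
    ≡⟨ ℤ.pos-* (suc k) _ ⟨
  + (suc k * (c * coefficientSum (suc m) k (2 + k)))
    ≡⟨ cong +_ (trans (*-swap (suc k) c _) (cong (c *_) (coefficientSum-2 m k))) ⟩
  + (c * (((k + m) choose k) * (suc k * (2 + k) + k * m))) ∎
  where
  open ≡-Reasoning
  u = uniform (suc m) (k + (2 + k)) k
  c = (suc m + (k + (2 + k))) choose k

-- Subset sums and polynomial coefficients

private
  variable
    n m d : ℕ
    A B : Set

when : Dec A → ℤ → ℤ
when A? x = if does A? then x else 0ℤ

when-yes : (A? : Dec A) → A → ∀ x → when A? x ≡ x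
when-yes A? p x = cong (λ b → if b then x else 0ℤ) (dec-true A? p)

when-no : (A? : Dec A) → ¬ A → ∀ x → when A? x ≡ 0ℤ
when-no A? ¬p x = cong (λ b → if b then x else 0ℤ) (dec-false A? ¬p)

when-cong : (A? : Dec A) (B? : Dec B) → (A → B) → (B → A) → ∀ {x y} → (A → x ≡ y) → when A? x ≡ when B? y
when-cong (yes p) B? f g {y = y} x≡y = trans (x≡y p) (sym (when-yes B? (f p) y))
when-cong (no ¬p) B? f g {y = y} x≡y = sym (when-no B? (¬p ∘ g) y)

when-0 : (A? : Dec A) → when A? 0ℤ ≡ 0ℤ
when-0 (yes p) = refl
when-0 (no ¬p) = refl

when-≡0 : (A? : Dec A) → ∀ {x} → (A → x ≡ 0ℤ) → when A? x ≡ 0ℤ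
when-≡0 (yes p) x≡0 = x≡0 p
when-≡0 (no ¬p) x≡0 = refl

when-* : (A? : Dec A) → ∀ a x → when A? (a ℤ.* x) ≡ a ℤ.* when A? x
when-* (yes p) a x = refl
when-* (no ¬p) a x = sym (ℤ.*-zeroʳ a)

when-comm : (A? : Dec A) (B? : Dec B) → ∀ x → when A? (when B? x) ≡ when B? (when A? x)
when-comm (yes p) B? x = refl
when-comm (no ¬p) B? x = sym (when-0 B?)

subsetSum : (Subset n → ℤ) → ℤ
subsetSum {zero}  φ = φ []
subsetSum {suc n} φ = subsetSum (φ ∘ (inside ∷_)) ℤ.+ subsetSum (φ ∘ (outside ∷_))

subsetSum-cong : {φ ψ : Subset n → ℤ} → (∀ S → φ S ≡ ψ S) → subsetSum φ ≡ subsetSum ψ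
subsetSum-cong {zero}  φ≡ψ = φ≡ψ []
subsetSum-cong {suc n} φ≡ψ = cong₂ ℤ._+_ (subsetSum-cong (φ≡ψ ∘ (inside ∷_))) (subsetSum-cong (φ≡ψ ∘ (outside ∷_)))

subsetSum-0 : {φ : Subset n → ℤ} → (∀ S → φ S ≡ 0ℤ) → subsetSum φ ≡ 0ℤ
subsetSum-0 {zero}  φ≡0 = φ≡0 []
subsetSum-0 {suc n} φ≡0 = cong₂ ℤ._+_ (subsetSum-0 (φ≡0 ∘ (inside ∷_))) (subsetSum-0 (φ≡0 ∘ (outside ∷_)))

subsetSum-+ : (φ ψ : Subset n → ℤ) → subsetSum (λ S → φ S ℤ.+ ψ S) ≡ subsetSum φ ℤ.+ subsetSum ψ
subsetSum-+ {zero}  φ ψ = refl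
subsetSum-+ {suc n} φ ψ = trans
  (cong₂ ℤ._+_ (subsetSum-+ (φ ∘ (inside ∷_)) (ψ ∘ (inside ∷_))) (subsetSum-+ (φ ∘ (outside ∷_)) (ψ ∘ (outside ∷_))))
  (interchange (subsetSum (φ ∘ (inside ∷_))) (subsetSum (ψ ∘ (inside ∷_)))
               (subsetSum (φ ∘ (outside ∷_))) (subsetSum (ψ ∘ (outside ∷_))))

subsetSum-* : ∀ a (φ : Subset n → ℤ) → subsetSum (λ S → a ℤ.* φ S) ≡ a ℤ.* subsetSum φ
subsetSum-* {zero}  a φ = refl
subsetSum-* {suc n} a φ = trans
  (cong₂ ℤ._+_ (subsetSum-* a (φ ∘ (inside ∷_))) (subsetSum-* a (φ ∘ (outside ∷_))))
  (sym (ℤ.*-distribˡ-+ a (subsetSum (φ ∘ (inside ∷_))) (subsetSum (φ ∘ (outside ∷_)))))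

subsetSum-- : (φ ψ : Subset n → ℤ) → subsetSum (λ S → φ S ℤ.- ψ S) ≡ subsetSum φ ℤ.- subsetSum ψ
subsetSum-- φ ψ = begin
  subsetSum (λ S → φ S ℤ.- ψ S)
    ≡⟨ subsetSum-cong (λ S → cong (λ x → φ S ℤ.+ x) (sym (ℤ.-1*i≡-i (ψ S)))) ⟩
  subsetSum (λ S → φ S ℤ.+ -1ℤ ℤ.* ψ S)
    ≡⟨ subsetSum-+ φ (λ S → -1ℤ ℤ.* ψ S) ⟩
  subsetSum φ ℤ.+ subsetSum (λ S → -1ℤ ℤ.* ψ S)
    ≡⟨ cong (λ x → subsetSum φ ℤ.+ x) (trans (subsetSum-* -1ℤ ψ) (ℤ.-1*i≡-i (subsetSum ψ))) ⟩
  subsetSum φ ℤ.- subsetSum ψ ∎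
  where open ≡-Reasoning

subsetSum-swap : ∀ {k} (φ : Subset n → Subset k → ℤ) →
                 subsetSum (λ S → subsetSum (φ S)) ≡ subsetSum (λ T → subsetSum (λ S → φ S T))
subsetSum-swap {zero}  φ = refl
subsetSum-swap {suc n} φ = trans
  (cong₂ ℤ._+_ (subsetSum-swap (φ ∘ (inside ∷_))) (subsetSum-swap (φ ∘ (outside ∷_))))
  (sym (subsetSum-+ (λ T → subsetSum (λ S → φ (inside ∷ S) T)) (λ T → subsetSum (λ S → φ (outside ∷ S) T))))

subsetSum-when : (A? : Dec A) (φ : Subset n → ℤ) → subsetSum (λ S → when A? (φ S)) ≡ when A? (subsetSum φ)
subsetSum-when (yes p) φ = refl
subsetSum-when {n = n} (no ¬p) φ = subsetSum-0 {n} (λ _ → refl)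

subsetSum-mono : {φ ψ : Subset n → ℤ} → (∀ S → φ S ℤ.≤ ψ S) → subsetSum φ ℤ.≤ subsetSum ψ
subsetSum-mono {zero}  φ≤ψ = φ≤ψ []
subsetSum-mono {suc n} φ≤ψ = ℤ.+-mono-≤ (subsetSum-mono (φ≤ψ ∘ (inside ∷_))) (subsetSum-mono (φ≤ψ ∘ (outside ∷_)))

subsetSum-single : {φ : Subset n → ℤ} → ∀ C → (∀ S → S ≢ C → φ S ≡ 0ℤ) → subsetSum φ ≡ φ C
subsetSum-single []            φ≡0 = refl
subsetSum-single {φ = φ} (true ∷ C)  φ≡0 = trans (cong₂ ℤ._+_
  (subsetSum-single C (λ S S≢C → φ≡0 (true ∷ S) (S≢C ∘ ∷-injectiveʳ)))
  (subsetSum-0 (λ S → φ≡0 (false ∷ S) (λ ())))) (ℤ.+-identityʳ (φ (true ∷ C)))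
subsetSum-single {φ = φ} (false ∷ C) φ≡0 = trans (cong₂ ℤ._+_
  (subsetSum-0 (λ S → φ≡0 (true ∷ S) (λ ())))
  (subsetSum-single C (λ S S≢C → φ≡0 (false ∷ S) (S≢C ∘ ∷-injectiveʳ)))) (ℤ.+-identityˡ (φ (false ∷ C)))

subsetSum-⊆ : (E : Subset n) (w : ℕ → ℤ) → subsetSum (λ S → when (S ⊆? E) (w ∣ S ∣)) ≡ binomialSum ∣ E ∣ w
subsetSum-⊆         []          w = refl
subsetSum-⊆         (true ∷ E)  w = cong₂ ℤ._+_ (subsetSum-⊆ E (w ∘ suc)) (subsetSum-⊆ E w)
subsetSum-⊆ {suc n} (false ∷ E) w = trans
  (cong₂ ℤ._+_ (subsetSum-0 {n} (λ _ → refl)) (subsetSum-⊆ E w)) (ℤ.+-identityˡ (binomialSum ∣ E ∣ w))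

-- Adding `F` is a bijection from the subsets of `E ─ F` to the sets between `F` and `E`, visible
-- coordinate by coordinate.
subsetSum-∪ : (E F : Subset n) → F ⊆ E → (φ : Subset n → ℤ) →
  subsetSum (λ S → when (S ⊆? (E ─ F)) (φ (S ∪ F))) ≡ subsetSum (λ C → when (F ⊆? C) (when (C ⊆? E) (φ C)))
subsetSum-∪         []          []          F⊆E φ = refl
subsetSum-∪ {suc n} (true ∷ E)  (true ∷ F)  F⊆E φ = trans
  (cong₂ ℤ._+_ (subsetSum-0 {n} (λ _ → refl)) (subsetSum-∪ E F (drop-∷-⊆ F⊆E) (φ ∘ (true ∷_))))
  (trans (ℤ.+-comm 0ℤ (subsetSum (λ C → when (F ⊆? C) (when (C ⊆? E) (φ (true ∷ C))))))
         (cong (λ x → subsetSum (λ C → when (F ⊆? C) (when (C ⊆? E) (φ (true ∷ C)))) ℤ.+ x)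
               (sym (subsetSum-0 {n} (λ _ → refl)))))
subsetSum-∪         (true ∷ E)  (false ∷ F) F⊆E φ = cong₂ ℤ._+_
  (subsetSum-∪ E F (drop-∷-⊆ F⊆E) (φ ∘ (true ∷_))) (subsetSum-∪ E F (drop-∷-⊆ F⊆E) (φ ∘ (false ∷_)))
subsetSum-∪         (false ∷ E) (true ∷ F)  F⊆E φ = contradiction (F⊆E here) λ ()
subsetSum-∪ {suc n} (false ∷ E) (false ∷ F) F⊆E φ = cong₂ ℤ._+_
  (trans (subsetSum-0 {n} (λ _ → refl)) (sym (subsetSum-0 (λ C → when-0 (F ⊆? C)))))
  (subsetSum-∪ E F (drop-∷-⊆ F⊆E) (φ ∘ (false ∷_)))

sumℤ-++ : ∀ xs ys → sumℤ (xs ++ ys) ≡ sumℤ xs ℤ.+ sumℤ ys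
sumℤ-++ []       ys = sym (ℤ.+-identityˡ (sumℤ ys))
sumℤ-++ (x ∷ xs) ys = trans (cong (λ s → x ℤ.+ s) (sumℤ-++ xs ys)) (sym (ℤ.+-assoc x (sumℤ xs) (sumℤ ys)))

sumℤ-subsets : ∀ n (φ : Subset n → ℤ) → sumℤ (map φ (subsets n)) ≡ subsetSum φ
sumℤ-subsets zero    φ = ℤ.+-identityʳ (φ [])
sumℤ-subsets (suc n) φ = begin
  sumℤ (map φ (map (inside ∷_) (subsets n) ++ map (outside ∷_) (subsets n)))
    ≡⟨ cong sumℤ (List.map-++ φ (map (inside ∷_) (subsets n)) _) ⟩
  sumℤ (map φ (map (inside ∷_) (subsets n)) ++ map φ (map (outside ∷_) (subsets n)))
    ≡⟨ sumℤ-++ (map φ (map (inside ∷_) (subsets n))) _ ⟩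
  sumℤ (map φ (map (inside ∷_) (subsets n))) ℤ.+ sumℤ (map φ (map (outside ∷_) (subsets n)))
    ≡⟨ cong₂ (λ xs ys → sumℤ xs ℤ.+ sumℤ ys) (List.map-∘ (subsets n)) (List.map-∘ (subsets n)) ⟨
  sumℤ (map (φ ∘ (inside ∷_)) (subsets n)) ℤ.+ sumℤ (map (φ ∘ (outside ∷_)) (subsets n))
    ≡⟨ cong₂ ℤ._+_ (sumℤ-subsets n (φ ∘ (inside ∷_))) (sumℤ-subsets n (φ ∘ (outside ∷_))) ⟩
  subsetSum φ ∎
  where open ≡-Reasoning

sumℤ-filter : ∀ {A : Set} {P : Pred A 0ℓ} (P? : Decidable P) (φ : A → ℤ) xs →
              sumℤ (map φ (filter P? xs)) ≡ sumℤ (map (λ x → when (P? x) (φ x)) xs)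
sumℤ-filter P? φ []       = refl
sumℤ-filter P? φ (x ∷ xs) with does (P? x)
... | true  = cong (λ s → φ x ℤ.+ s) (sumℤ-filter P? φ xs)
... | false = trans (sumℤ-filter P? φ xs) (sym (ℤ.+-identityˡ _))

sumℤ-filter-subsets : {P : Pred (Subset n) 0ℓ} (P? : Decidable P) (φ : Subset n → ℤ) →
                      sumℤ (map φ (filter P? (subsets n))) ≡ subsetSum (λ S → when (P? S) (φ S))
sumℤ-filter-subsets {n} P? φ = trans (sumℤ-filter P? φ (subsets n)) (sumℤ-subsets n (λ S → when (P? S) (φ S)))

sumℤ-length : ∀ {A : Set} (xs : List A) → sumℤ (map (λ _ → 1ℤ) xs) ≡ + length xs
sumℤ-length []       = refl
sumℤ-length (x ∷ xs) = cong (λ s → 1ℤ ℤ.+ s) (sumℤ-length xs)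

coeff-⊕ : ∀ p q k → coeff (p ⊕ q) k ≡ coeff p k ℤ.+ coeff q k
coeff-⊕ []      q       k       = sym (ℤ.+-identityˡ (coeff q k))
coeff-⊕ (a ∷ p) []      k       = sym (ℤ.+-identityʳ (coeff (a ∷ p) k))
coeff-⊕ (a ∷ p) (b ∷ q) zero    = refl
coeff-⊕ (a ∷ p) (b ∷ q) (suc k) = coeff-⊕ p q k

coeff-∑ : ∀ ps k → coeff (∑ ps) k ≡ sumℤ (map (λ p → coeff p k) ps)
coeff-∑ []       k = refl
coeff-∑ (p ∷ ps) k = trans (coeff-⊕ p (∑ ps) k) (cong (λ s → coeff p k ℤ.+ s) (coeff-∑ ps k))

coeff-map-* : ∀ a q k → coeff (map (a ℤ.*_) q) k ≡ a ℤ.* coeff q k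
coeff-map-* a []      k       = sym (ℤ.*-zeroʳ a)
coeff-map-* a (b ∷ q) zero    = refl
coeff-map-* a (b ∷ q) (suc k) = coeff-map-* a q k

coeff-0∷ : ∀ p k → coeff (0ℤ ∷ p) k ≡ shift 1 (coeff p) k
coeff-0∷ p zero    = refl
coeff-0∷ p (suc k) = refl

coeff-∷-⊗ : ∀ a p q k → coeff ((a ∷ p) ⊗ q) k ≡ a ℤ.* coeff q k ℤ.+ shift 1 (coeff (p ⊗ q)) k
coeff-∷-⊗ a p q k = trans (coeff-⊕ (map (a ℤ.*_) q) (0ℤ ∷ (p ⊗ q)) k)
  (cong₂ ℤ._+_ (coeff-map-* a q k) (coeff-0∷ (p ⊗ q) k))

coeff-⊕-⊗ : ∀ p p′ q k → coeff ((p ⊕ p′) ⊗ q) k ≡ coeff (p ⊗ q) k ℤ.+ coeff (p′ ⊗ q) k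
coeff-⊕-⊗ []      p′       q k = sym (ℤ.+-identityˡ (coeff (p′ ⊗ q) k))
coeff-⊕-⊗ (a ∷ p) []       q k = sym (ℤ.+-identityʳ (coeff ((a ∷ p) ⊗ q) k))
coeff-⊕-⊗ (a ∷ p) (b ∷ p′) q k = begin
  coeff (((a ℤ.+ b) ∷ (p ⊕ p′)) ⊗ q) k
    ≡⟨ coeff-∷-⊗ (a ℤ.+ b) (p ⊕ p′) q k ⟩
  (a ℤ.+ b) ℤ.* coeff q k ℤ.+ shift 1 (coeff ((p ⊕ p′) ⊗ q)) k
    ≡⟨ cong (λ x → (a ℤ.+ b) ℤ.* coeff q k ℤ.+ x) (shifted k) ⟩
  (a ℤ.+ b) ℤ.* coeff q k ℤ.+ (shift 1 (coeff (p ⊗ q)) k ℤ.+ shift 1 (coeff (p′ ⊗ q)) k)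
    ≡⟨ lemma a b (coeff q k) (shift 1 (coeff (p ⊗ q)) k) (shift 1 (coeff (p′ ⊗ q)) k) ⟩
  (a ℤ.* coeff q k ℤ.+ shift 1 (coeff (p ⊗ q)) k) ℤ.+ (b ℤ.* coeff q k ℤ.+ shift 1 (coeff (p′ ⊗ q)) k)
    ≡⟨ cong₂ ℤ._+_ (coeff-∷-⊗ a p q k) (coeff-∷-⊗ b p′ q k) ⟨
  coeff ((a ∷ p) ⊗ q) k ℤ.+ coeff ((b ∷ p′) ⊗ q) k ∎
  where
  open ≡-Reasoning
  shifted : ∀ k → shift 1 (coeff ((p ⊕ p′) ⊗ q)) k ≡ shift 1 (coeff (p ⊗ q)) k ℤ.+ shift 1 (coeff (p′ ⊗ q)) k
  shifted zero    = refl
  shifted (suc k) = coeff-⊕-⊗ p p′ q k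
  lemma : ∀ a b x y z → (a ℤ.+ b) ℤ.* x ℤ.+ (y ℤ.+ z) ≡ (a ℤ.* x ℤ.+ y) ℤ.+ (b ℤ.* x ℤ.+ z)
  lemma = ℤ-solve

coeff-∑-⊗ : ∀ ps q k → coeff (∑ ps ⊗ q) k ≡ sumℤ (map (λ p → coeff (p ⊗ q) k) ps)
coeff-∑-⊗ []       q k = refl
coeff-∑-⊗ (p ∷ ps) q k = trans (coeff-⊕-⊗ p (∑ ps) q k) (cong (λ s → coeff (p ⊗ q) k ℤ.+ s) (coeff-∑-⊗ ps q k))

coeff-monomial-⊗ : ∀ a r q k → coeff (monomial a r ⊗ q) k ≡ a ℤ.* shift r (coeff q) k
coeff-monomial-⊗ a zero    q k       = trans (coeff-∷-⊗ a [] q k)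
  (trans (cong (λ x → a ℤ.* coeff q k ℤ.+ x) (z k)) (ℤ.+-identityʳ (a ℤ.* coeff q k)))
  where
  z : ∀ k → shift 1 (coeff []) k ≡ 0ℤ
  z zero    = refl
  z (suc k) = refl
coeff-monomial-⊗ a (suc r) q zero    = trans (coeff-∷-⊗ 0ℤ (monomial a r) q 0) (sym (ℤ.*-zeroʳ a))
coeff-monomial-⊗ a (suc r) q (suc k) = trans (coeff-∷-⊗ 0ℤ (monomial a r) q (suc k))
  (trans (ℤ.+-identityˡ _) (coeff-monomial-⊗ a r q k))

coeff-reflect : ∀ r p k → k ≤ r → coeff (reflect r p) k ≡ coeff p (r ∸ k)
coeff-reflect r p k k≤r = trans
  (cong (λ q → coeff q k) (List.map-upTo (λ k → coeff p (r ∸ k)) (suc r)))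
  (coeff-applyUpTo (λ k → coeff p (r ∸ k)) (suc r) k (s≤s k≤r))
  where
  coeff-applyUpTo : ∀ f n k → k < n → coeff (applyUpTo f n) k ≡ f k
  coeff-applyUpTo f (suc n) zero    _         = refl
  coeff-applyUpTo f (suc n) (suc k) (s≤s k<n) = coeff-applyUpTo (f ∘ suc) n k k<n

-- The Möbius function

private
  -- The summand of `möbius-acc` is local to its definition. An existential whose witness is found
  -- by unification gives access to it.
  möbius-unfold : (M : Matroid n) (G F : Subset n) (rs : ∀ {H} → H ⊂ F → Acc _⊂_ H) →
    ∃ λ t → möbius-acc M G F (acc rs) ≡
      (if does (≡-dec Bool._≟_ G F) then 1ℤ
       else if does (G ⊂? F) then ℤ.- sumℤ (map t (flats M))
       else 0ℤ)
  möbius-unfold M G F rs = _ , refl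

  möbius-term : (M : Matroid n) (F : Subset n) (rs : ∀ {H} → H ⊂ F → Acc _⊂_ H) (H : Subset n) {x : ℤ} →
    (∀ (H⊂F : H ⊂ F) → möbius-acc M ⊥ H (rs H⊂F) ≡ x) →
    proj₁ (möbius-unfold M ⊥ F rs) H ≡ when (H ⊂? F) x
  möbius-term M F rs H {x} μ≡ with H ⊂? F
  ... | yes H⊂F = trans (when-yes (⊥ ⊆? H) (⊆-min H) (möbius-acc M ⊥ H (rs H⊂F))) (μ≡ H⊂F)
  ... | no  _   = refl

⊥-or-⊥⊂ : (F : Subset n) → F ≢ ⊥ → ⊥ ⊂ F
⊥-or-⊥⊂ F F≢⊥ with nonempty? F
... | yes (x , x∈F) = ⊆-min F , x , x∈F , ∉⊥
... | no  ¬ne       = contradiction (Empty-unique ¬ne) F≢⊥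

möbius-⊥ : (M : Matroid n) (a : Acc _⊂_ ⊥) → möbius-acc M ⊥ ⊥ a ≡ 1ℤ
möbius-⊥ {n} M (acc rs) = trans (proj₂ (möbius-unfold M ⊥ ⊥ rs))
  (cong (λ b → if b then 1ℤ else if does (⊥ ⊂? ⊥ {n}) then ℤ.- sumℤ (map (proj₁ (möbius-unfold M ⊥ ⊥ rs)) (flats M)) else 0ℤ)
    (dec-true (≡-dec Bool._≟_ (⊥ {n}) ⊥) refl))

-- All accessibility proofs are quantified over, because the recursive calls use `rs H⊂F` and not
-- the canonical proof.
möbius-recursion : (M : Matroid n) (F : Subset n) (v : Subset n → ℤ) → F ≢ ⊥ →
  (∀ H → IsFlat M H → H ⊂ F → ∀ a → möbius-acc M ⊥ H a ≡ v H) →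
  ∀ a → möbius-acc M ⊥ F a ≡ ℤ.- subsetSum (λ H → when (isFlat? M H) (when (H ⊂? F) (v H)))
möbius-recursion {n} M F v F≢⊥ μ≡ (acc rs) = begin
  möbius-acc M ⊥ F (acc rs)
    ≡⟨ proj₂ (möbius-unfold M ⊥ F rs) ⟩
  (if does (≡-dec Bool._≟_ ⊥ F) then 1ℤ else if does (⊥ ⊂? F) then ℤ.- sumℤ (map t (flats M)) else 0ℤ)
    ≡⟨ cong (λ b → if b then 1ℤ else if does (⊥ ⊂? F) then ℤ.- sumℤ (map t (flats M)) else 0ℤ)
         (dec-false (≡-dec Bool._≟_ ⊥ F) (F≢⊥ ∘ sym)) ⟩
  (if does (⊥ ⊂? F) then ℤ.- sumℤ (map t (flats M)) else 0ℤ)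
    ≡⟨ cong (λ b → if b then ℤ.- sumℤ (map t (flats M)) else 0ℤ) (dec-true (⊥ ⊂? F) (⊥-or-⊥⊂ F F≢⊥)) ⟩
  ℤ.- sumℤ (map t (flats M))
    ≡⟨ cong (λ x → ℤ.- x) (sumℤ-filter-subsets (isFlat? M) t) ⟩
  ℤ.- subsetSum (λ H → when (isFlat? M H) (t H))
    ≡⟨ cong (λ x → ℤ.- x) (subsetSum-cong (λ H → when-cong (isFlat? M H) (isFlat? M H) (λ f → f) (λ f → f)
         (λ f → möbius-term M F rs H {v H} (λ H⊂F → μ≡ H f H⊂F (rs H⊂F))))) ⟩
  ℤ.- subsetSum (λ H → when (isFlat? M H) (when (H ⊂? F) (v H))) ∎
  where
  open ≡-Reasoning
  t = proj₁ (möbius-unfold M ⊥ F rs)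

-- Sparse paving matroids

_≟ₛ_ : (S T : Subset n) → Dec (S ≡ T)
_≟ₛ_ = ≡-dec Bool._≟_

⊆∧∣≥∣⇒≡ : {p q : Subset n} → p ⊆ q → ∣ q ∣ ≤ ∣ p ∣ → p ≡ q
⊆∧∣≥∣⇒≡ {p = []}        {[]}        p⊆q q≤p = refl
⊆∧∣≥∣⇒≡ {p = true ∷ p}  {true ∷ q}  p⊆q q≤p = cong (true ∷_) (⊆∧∣≥∣⇒≡ (drop-∷-⊆ p⊆q) (≤-pred q≤p))
⊆∧∣≥∣⇒≡ {p = true ∷ p}  {false ∷ q} p⊆q q≤p = contradiction (p⊆q here) λ ()
⊆∧∣≥∣⇒≡ {p = false ∷ p} {true ∷ q}  p⊆q q≤p = contradiction (p⊆q⇒∣p∣≤∣q∣ (drop-∷-⊆ p⊆q)) (<⇒≱ q≤p)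
⊆∧∣≥∣⇒≡ {p = false ∷ p} {false ∷ q} p⊆q q≤p = cong (false ∷_) (⊆∧∣≥∣⇒≡ (drop-∷-⊆ p⊆q) q≤p)

⊆∧≢⇒∃ : {p q : Subset n} → p ⊆ q → p ≢ q → ∃ λ x → x ∈ q × x ∉ p
⊆∧≢⇒∃ {p = p} {q} p⊆q p≢q with nonempty? (q ─ p)
... | yes (x , x∈) = x , p─q⊆p q p x∈ , ─-∈⁻ q p x∈
... | no  ¬ne      = contradiction (⊆-antisym p⊆q q⊆p) p≢q
  where
  q⊆p : q ⊆ p
  q⊆p {x} x∈q with x ∈? p
  ... | yes x∈p = x∈p
  ... | no  x∉p = contradiction (x , x∈p∧x∉q⇒x∈p─q x∈q x∉p) ¬ne

⊆∧≢⇒⊂ : {p q : Subset n} → p ⊆ q → p ≢ q → p ⊂ q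
⊆∧≢⇒⊂ p⊆q p≢q = p⊆q , ⊆∧≢⇒∃ p⊆q p≢q

∣∪∣-disjoint : (p q : Subset n) → (∀ {x} → x ∈ p → x ∉ q) → ∣ p ∪ q ∣ ≡ ∣ p ∣ + ∣ q ∣
∣∪∣-disjoint {n} p q disjoint = trans (sym (+-identityʳ _)) (trans
  (cong (λ k → ∣ p ∪ q ∣ + k) (sym (trans (cong ∣_∣ empty) (∣⊥∣≡0 n))))
  (∣∪∣+∣∩∣ p q))
  where
  empty : p ∩ q ≡ ⊥
  empty = Empty-unique (λ (x , x∈) → let x∈p , x∈q = x∈p∩q⁻ p q x∈ in disjoint x∈p x∈q)

∣p∪⁅x⁆∣ : {p : Subset n} {x : Fin n} → x ∉ p → ∣ p ∪ ⁅ x ⁆ ∣ ≡ suc ∣ p ∣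
∣p∪⁅x⁆∣ {p = p} {x} x∉p = trans
  (∣∪∣-disjoint p ⁅ x ⁆ (λ y∈p y∈x → x∉p (subst (_∈ p) (x∈⁅y⁆⇒x≡y x y∈x) y∈p)))
  (trans (cong (λ k → ∣ p ∣ + k) (∣⁅x⁆∣≡1 x)) (+-comm ∣ p ∣ 1))

∪⁅⁆-⊆ : {p q : Subset n} {x : Fin n} → p ⊆ q → x ∈ q → p ∪ ⁅ x ⁆ ⊆ q
∪⁅⁆-⊆ {q = q} {x} p⊆q x∈q = ∪-least p⊆q (λ y∈x → subst (_∈ q) (sym (x∈⁅y⁆⇒x≡y x y∈x)) x∈q)

∣p∣≡0⇒p≡⊥ : {p : Subset n} → ∣ p ∣ ≡ 0 → p ≡ ⊥
∣p∣≡0⇒p≡⊥ {n} {p} ∣p∣≡0 = sym (⊆∧∣≥∣⇒≡ (⊆-min p) (≤-trans (≤-reflexive ∣p∣≡0) z≤n))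

subsetSum-≡ : (C : Subset n) (φ : Subset n → ℤ) → subsetSum (λ S → when (S ≟ₛ C) (φ S)) ≡ φ C
subsetSum-≡ C φ = trans
  (subsetSum-single C (λ S S≢C → when-no (S ≟ₛ C) S≢C (φ S)))
  (when-yes (C ≟ₛ C) refl (φ C))

subsetSum-⊂ : (G : Subset n) (w : ℕ → ℤ) →
              subsetSum (λ S → when (S ⊂? G) (w ∣ S ∣)) ≡ binomialSum (∣ G ∣) w ℤ.- w (∣ G ∣)
subsetSum-⊂ {n} G w = begin
  subsetSum (λ S → when (S ⊂? G) (w ∣ S ∣))
    ≡⟨ subsetSum-cong pointwise ⟩
  subsetSum (λ S → when (S ⊆? G) (w ∣ S ∣) ℤ.- when (S ≟ₛ G) (w ∣ S ∣))
    ≡⟨ subsetSum-- {n} _ _ ⟩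
  subsetSum (λ S → when (S ⊆? G) (w ∣ S ∣)) ℤ.- subsetSum (λ S → when (S ≟ₛ G) (w ∣ S ∣))
    ≡⟨ cong₂ ℤ._-_ (subsetSum-⊆ G w) (subsetSum-≡ G (λ S → w ∣ S ∣)) ⟩
  binomialSum (∣ G ∣) w ℤ.- w (∣ G ∣) ∎
  where
  open ≡-Reasoning
  pointwise : ∀ S → when (S ⊂? G) (w ∣ S ∣) ≡ when (S ⊆? G) (w ∣ S ∣) ℤ.- when (S ≟ₛ G) (w ∣ S ∣)
  pointwise S with S ≟ₛ G
  ... | yes refl = trans (when-no (S ⊂? S) (⊂-irref refl) (w ∣ S ∣))
    (sym (trans (cong (ℤ._- w (∣ S ∣)) (when-yes (S ⊆? S) (λ x∈ → x∈) (w ∣ S ∣))) (ℤ.+-inverseʳ (w ∣ S ∣))))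
  ... | no  S≢G  = trans
    (when-cong (S ⊂? G) (S ⊆? G) p⊂q⇒p⊆q (λ S⊆G → ⊆∧≢⇒⊂ S⊆G S≢G) (λ _ → refl))
    (sym (ℤ.+-identityʳ _))

-- A matroid of rank d on m + d elements is sparse paving if and only if all sets of size less than d
-- are independent, all sets of size greater than d are spanning, and all sets of size d have rank
-- d or d − 1.  The latter, if non-bases, are the circuit-hyperplanes.
record IsSparsePaving (M : Matroid n) (m d : ℕ) : Set where
  field
    card     : ∣ E M ∣ ≡ m + d
    rk-E     : rank M ≡ d
    rk-small : ∀ {S} → S ⊆ E M → ∣ S ∣ < d → rk M S ≡ ∣ S ∣
    rk-equal : ∀ {S} → S ⊆ E M → ∣ S ∣ ≡ d → rk M S ≢ d → suc (rk M S) ≡ d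
    rk-large : ∀ {S} → S ⊆ E M → d < ∣ S ∣ → rk M S ≡ d

NonBasis : Matroid n → ℕ → Subset n → Set
NonBasis M d S = S ⊆ E M × ∣ S ∣ ≡ d × suc (rk M S) ≡ d

nonBasis? : (M : Matroid n) (d : ℕ) → Decidable (NonBasis M d)
nonBasis? M d S = S ⊆? E M ×-dec ∣ S ∣ ≟ d ×-dec suc (rk M S) ≟ d

nonBases : Matroid n → ℕ → ℤ
nonBases M d = subsetSum (λ S → when (nonBasis? M d S) 1ℤ)

-- For small `F` this is the number of circuit-hyperplanes of the contraction by `F`, expressed
-- inside `M`.
nonBasesAbove : Matroid n → ℕ → Subset n → ℤ
nonBasesAbove M d F = subsetSum (λ C → when (nonBasis? M d C) (when (F ⊆? C) 1ℤ))

nonBasesAbove-* : (M : Matroid n) (d : ℕ) (F : Subset n) → ∀ a →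
  subsetSum (λ C → when (nonBasis? M d C) (when (F ⊆? C) a)) ≡ a ℤ.* nonBasesAbove M d F
nonBasesAbove-* {n} M d F a = trans
  (subsetSum-cong (λ C → trans
    (cong (when (nonBasis? M d C)) (trans (cong (when (F ⊆? C)) (sym (ℤ.*-identityʳ a))) (when-* (F ⊆? C) a 1ℤ)))
    (when-* (nonBasis? M d C) a (when (F ⊆? C) 1ℤ))))
  (subsetSum-* {n} a _)

-- Double counting of pairs `F ⊆ C`: summed over `C` first, each circuit-hyperplane offers all
-- subsets of a d-set.
nonBases-⊆ : (M : Matroid n) (d : ℕ) (w : ℕ → ℤ) →
  subsetSum (λ F → subsetSum (λ C → when (nonBasis? M d C) (when (F ⊆? C) (w ∣ F ∣)))) ≡
  nonBases M d ℤ.* binomialSum d w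
nonBases-⊆ {n} M d w = begin
  subsetSum (λ F → subsetSum (λ C → when (nonBasis? M d C) (when (F ⊆? C) (w ∣ F ∣))))
    ≡⟨ subsetSum-swap {n} {n} _ ⟩
  subsetSum (λ C → subsetSum (λ F → when (nonBasis? M d C) (when (F ⊆? C) (w ∣ F ∣))))
    ≡⟨ subsetSum-cong (λ C → subsetSum-when {n = n} (nonBasis? M d C) _) ⟩
  subsetSum (λ C → when (nonBasis? M d C) (subsetSum (λ F → when (F ⊆? C) (w ∣ F ∣))))
    ≡⟨ subsetSum-cong (λ C → when-cong (nonBasis? M d C) (nonBasis? M d C) (λ c → c) (λ c → c) (λ (_ , ∣C∣≡d , _) →
         trans (subsetSum-⊆ C w) (trans (cong (λ k → binomialSum k w) ∣C∣≡d) (sym (ℤ.*-identityʳ _))))) ⟩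
  subsetSum (λ C → when (nonBasis? M d C) (binomialSum d w ℤ.* 1ℤ))
    ≡⟨ subsetSum-cong (λ C → when-* (nonBasis? M d C) (binomialSum d w) 1ℤ) ⟩
  subsetSum (λ C → binomialSum d w ℤ.* when (nonBasis? M d C) 1ℤ)
    ≡⟨ subsetSum-* {n} (binomialSum d w) _ ⟩
  binomialSum d w ℤ.* nonBases M d
    ≡⟨ ℤ.*-comm (binomialSum d w) _ ⟩
  nonBases M d ℤ.* binomialSum d w ∎
  where open ≡-Reasoning

module SparsePavingFlats {M : Matroid n} (sp : IsSparsePaving M m d) where
  open IsSparsePaving sp

  rk≤d : ∀ {S} → S ⊆ E M → rk M S ≤ d
  rk≤d S⊆E = ≤-trans (rk-mono M _ _ S⊆E (λ x∈ → x∈)) (≤-reflexive rk-E)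

  E-flat : IsFlat M (E M)
  E-flat = (λ x∈ → x∈) , λ e e∈ e∉ → contradiction e∈ e∉

  d≤∣E∣ : d ≤ ∣ E M ∣
  d≤∣E∣ = ≤-trans (m≤n+m d m) (≤-reflexive (sym card))

  nonBasis⇒⊂ : ∀ {C} → NonBasis M d C → C ⊂ E M
  nonBasis⇒⊂ {C} (C⊆E , _ , rk≡) = ⊆∧≢⇒⊂ C⊆E (λ { refl → 1+n≢n (trans rk≡ (sym rk-E)) })

  nonBasis-flat : ∀ {C} → NonBasis M d C → IsFlat M C
  nonBasis-flat {C} (C⊆E , ∣C∣≡d , rk≡) = C⊆E , λ e e∈E e∉C → ≤-reflexive (trans rk≡ (sym
    (rk-large (∪⁅⁆-⊆ C⊆E e∈E) (≤-reflexive (sym (trans (∣p∪⁅x⁆∣ e∉C) (cong suc ∣C∣≡d)))))))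

  small-flat : ∀ {S} → S ⊆ E M → suc ∣ S ∣ < d → IsFlat M S
  small-flat {S} S⊆E lt = S⊆E , λ e e∈E e∉S → ≤-reflexive (trans
    (cong suc (rk-small S⊆E (<-trans (n<1+n _) lt)))
    (trans (sym (∣p∪⁅x⁆∣ e∉S)) (sym (rk-small (∪⁅⁆-⊆ S⊆E e∈E) (subst (_< d) (sym (∣p∪⁅x⁆∣ e∉S)) lt)))))

  -- Were `C` and `C′` distinct, their union would have rank d and their intersection rank at least
  -- d - 1, while submodularity allows only 2(d - 1) in total.
  nonBasis-unique : ∀ {S C C′} → suc ∣ S ∣ ≡ d → NonBasis M d C → NonBasis M d C′ → S ⊆ C → S ⊆ C′ → C ≡ C′
  nonBasis-unique {S} {C} {C′} ∣S∣≡ (C⊆E , ∣C∣≡ , rkC≡) (C′⊆E , ∣C′∣≡ , rkC′≡) S⊆C S⊆C′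
    with d <? ∣ C ∪ C′ ∣
  ... | no  ≮ = trans (eq (p⊆p∪q C′) ∣C∣≡) (sym (eq (q⊆p∪q C C′) ∣C′∣≡))
    where
    eq : ∀ {D} → D ⊆ C ∪ C′ → ∣ D ∣ ≡ d → D ≡ C ∪ C′
    eq D⊆ ∣D∣≡ = ⊆∧∣≥∣⇒≡ D⊆ (≤-trans (≮⇒≥ ≮) (≤-reflexive (sym ∣D∣≡)))
  ... | yes lt = contradiction submod (<⇒≱ (≤-reflexive arith))
    where
    S⊆∩ : S ⊆ C ∩ C′
    S⊆∩ x∈ = x∈p∩q⁺ (S⊆C x∈ , S⊆C′ x∈)
    rkS : rk M S ≡ ∣ S ∣
    rkS = rk-small (C⊆E ∘ S⊆C) (≤-reflexive ∣S∣≡)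
    submod : d + ∣ S ∣ ≤ rk M C + rk M C′
    submod = ≤-trans (+-mono-≤ (≤-reflexive (sym (rk-large (∪-least C⊆E C′⊆E) lt)))
                               (≤-trans (≤-reflexive (sym rkS)) (rk-mono M S (C ∩ C′) S⊆∩ (C⊆E ∘ p∩q⊆p C C′))))
                     (rk-submod M C C′ C⊆E C′⊆E)
    arith : suc (rk M C + rk M C′) ≡ d + ∣ S ∣
    arith = cong₂ _+_ rkC≡ (suc-injective (trans rkC′≡ (sym ∣S∣≡)))

  -- Sets of size d − 1 are hyperplanes unless contained in a, necessarily unique, circuit-hyperplane.
  size-d-1 : ∀ {S} → S ⊆ E M → suc ∣ S ∣ ≡ d →
    (IsFlat M S × nonBasesAbove M d S ≡ 0ℤ) ⊎ (¬ IsFlat M S × nonBasesAbove M d S ≡ 1ℤ)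
  size-d-1 {S} S⊆E ∣S∣≡ with anySubset? (λ C → nonBasis? M d C ×-dec S ⊆? C)
  ... | yes (C , nb@(C⊆E , ∣C∣≡ , rkC≡) , S⊆C) = inj₂ (notFlat , count)
    where
    notFlat : ¬ IsFlat M S
    notFlat (_ , flat) with ⊆∧≢⇒∃ S⊆C (λ { refl → 1+n≢n (trans ∣S∣≡ (sym ∣C∣≡)) })
    ... | e , e∈C , e∉S = <⇒≱ (flat e (C⊆E e∈C) e∉S) (begin
      rk M (S ∪ ⁅ e ⁆) ≤⟨ rk-mono M _ C (∪⁅⁆-⊆ S⊆C e∈C) C⊆E ⟩
      rk M C           ≡⟨ suc-injective (trans rkC≡ (sym ∣S∣≡)) ⟩
      ∣ S ∣            ≡⟨ rk-small S⊆E (≤-reflexive ∣S∣≡) ⟨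
      rk M S           ∎)
      where open ≤-Reasoning
    count : nonBasesAbove M d S ≡ 1ℤ
    count = trans
      (subsetSum-single C (λ C′ C′≢C → other C′ C′≢C))
      (trans (when-yes (nonBasis? M d C) nb (when (S ⊆? C) 1ℤ)) (when-yes (S ⊆? C) S⊆C 1ℤ))
      where
      other : ∀ C′ → C′ ≢ C → when (nonBasis? M d C′) (when (S ⊆? C′) 1ℤ) ≡ 0ℤ
      other C′ C′≢C = when-≡0 (nonBasis? M d C′) (λ nb′ →
        when-no (S ⊆? C′) (λ S⊆C′ → C′≢C (nonBasis-unique ∣S∣≡ nb′ nb S⊆C′ S⊆C)) 1ℤ)
  ... | no  none = inj₁ ((S⊆E , flat) , count)
    where
    rkS : rk M S ≡ ∣ S ∣
    rkS = rk-small S⊆E (≤-reflexive ∣S∣≡)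
    flat : ∀ e → e ∈ E M → e ∉ S → rk M S < rk M (S ∪ ⁅ e ⁆)
    flat e e∈E e∉S with rk M (S ∪ ⁅ e ⁆) ≟ d
    ... | yes ≡d = ≤-reflexive (trans (cong suc rkS) (trans ∣S∣≡ (sym ≡d)))
    ... | no  ≢d = ⊥-elim (none
      (S ∪ ⁅ e ⁆ , (S∪e⊆E , ∣S∪e∣ , rk-equal S∪e⊆E ∣S∪e∣ ≢d) , p⊆p∪q ⁅ e ⁆))
      where
      S∪e⊆E : S ∪ ⁅ e ⁆ ⊆ E M
      S∪e⊆E = ∪⁅⁆-⊆ S⊆E e∈E
      ∣S∪e∣ : ∣ S ∪ ⁅ e ⁆ ∣ ≡ d
      ∣S∪e∣ = trans (∣p∪⁅x⁆∣ e∉S) ∣S∣≡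
    count : nonBasesAbove M d S ≡ 0ℤ
    count = subsetSum-0 (λ C → when-≡0 (nonBasis? M d C) (λ nb →
      when-no (S ⊆? C) (λ S⊆C → none (C , nb , S⊆C)) 1ℤ))

  spanning-flat : ∀ {S} → d ≤ ∣ S ∣ → ¬ NonBasis M d S → IsFlat M S → S ≡ E M
  spanning-flat {S} d≤ ¬nb (S⊆E , flat) with S ≟ₛ E M
  ... | yes S≡E = S≡E
  ... | no  S≢E with ⊆∧≢⇒∃ S⊆E S≢E
  ...   | e , e∈E , e∉S = contradiction (flat e e∈E e∉S)
    (≤⇒≯ (≤-trans (rk≤d (∪⁅⁆-⊆ S⊆E e∈E)) (≤-reflexive (sym rkS))))
    where
    rkS : rk M S ≡ d
    rkS with m≤n⇒m<n∨m≡n d≤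
    ... | inj₁ d<    = rk-large S⊆E d<
    ... | inj₂ d≡ with rk M S ≟ d
    ...   | yes ≡d = ≡d
    ...   | no  ≢d = ⊥-elim (¬nb (S⊆E , sym d≡ , rk-equal S⊆E (sym d≡) ≢d))

  ⊂-E : ∀ {S} → S ⊆ E M → ∣ S ∣ < d → S ⊂ E M
  ⊂-E S⊆E lt = ⊆∧≢⇒⊂ S⊆E (λ { refl → <⇒≱ lt d≤∣E∣ })

  -- A sum over all flats, if the summand of a small flat depends only on its size and the number of
  -- circuit-hyperplanes above it.  The condition a ≡ b in size d − 1 makes the expression for small
  -- flats vanish on the sets of that size that are not flats.
  module _ (f : Subset n → ℤ) (a b : ℕ → ℤ) (c e : ℤ)
    (small : ∀ {F} → F ⊆ E M → ∣ F ∣ < d → IsFlat M F → f F ≡ a (∣ F ∣) ℤ.- b (∣ F ∣) ℤ.* nonBasesAbove M d F)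
    (a≡b : ∀ {j} → suc j ≡ d → a j ≡ b j) (a≡0 : ∀ {j} → d ≤ j → a j ≡ 0ℤ) (b≡0 : ∀ {j} → d ≤ j → b j ≡ 0ℤ)
    (nonBasis : ∀ {C} → NonBasis M d C → f C ≡ c) (whole : f (E M) ≡ e) where
    open ≡-Reasoning

    private
      first second third fourth : Subset n → ℤ
      first  F = when (F ⊆? E M) (a (∣ F ∣))
      second F = subsetSum (λ C → when (nonBasis? M d C) (when (F ⊆? C) (b (∣ F ∣))))
      third  F = when (nonBasis? M d F) c
      fourth F = when (F ≟ₛ E M) e

      classify : ∀ F → when (isFlat? M F) (f F) ≡ ((first F ℤ.- second F) ℤ.+ third F) ℤ.+ fourth F
      classify F = helper (F ⊆? E M) (∣ F ∣ <? d) (nonBasis? M d F) (F ≟ₛ E M)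
        where
        assemble : ∀ {p q r s x} → x ≡ ((p ℤ.- q) ℤ.+ r) ℤ.+ s →
          first F ≡ p → second F ≡ q → third F ≡ r → fourth F ≡ s →
          x ≡ ((first F ℤ.- second F) ℤ.+ third F) ℤ.+ fourth F
        assemble x≡ refl refl refl refl = x≡

        only-12 : ∀ x y → x ℤ.- y ≡ ((x ℤ.- y) ℤ.+ 0ℤ) ℤ.+ 0ℤ
        only-12 = ℤ-solve
        only-3 : ∀ x → x ≡ ((0ℤ ℤ.- 0ℤ) ℤ.+ x) ℤ.+ 0ℤ
        only-3 = ℤ-solve
        only-4 : ∀ x → x ≡ ((0ℤ ℤ.- 0ℤ) ℤ.+ 0ℤ) ℤ.+ x
        only-4 = ℤ-solve

        first≡0 : ¬ ∣ F ∣ < d → first F ≡ 0ℤ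
        first≡0 ≮d = when-≡0 (F ⊆? E M) (λ _ → a≡0 (≮⇒≥ ≮d))
        second≡0 : ¬ ∣ F ∣ < d → second F ≡ 0ℤ
        second≡0 ≮d = subsetSum-0 (λ C → when-≡0 (nonBasis? M d C) (λ _ → when-≡0 (F ⊆? C) (λ _ → b≡0 (≮⇒≥ ≮d))))
        third≡0 : ∣ F ∣ < d → third F ≡ 0ℤ
        third≡0 lt = when-no (nonBasis? M d F) (λ (_ , ≡d , _) → <⇒≢ lt ≡d) c
        fourth≡0 : ∣ F ∣ < d → fourth F ≡ 0ℤ
        fourth≡0 lt = when-no (F ≟ₛ E M) (λ { refl → <⇒≱ lt d≤∣E∣ }) e

        small-case : ∀ {x} → F ⊆ E M → ∣ F ∣ < d →
          x ≡ a (∣ F ∣) ℤ.- b (∣ F ∣) ℤ.* nonBasesAbove M d F →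
          x ≡ ((first F ℤ.- second F) ℤ.+ third F) ℤ.+ fourth F
        small-case F⊆E lt x≡ = assemble
          (trans x≡ (only-12 (a (∣ F ∣)) (b (∣ F ∣) ℤ.* nonBasesAbove M d F)))
          (when-yes (F ⊆? E M) F⊆E _) (nonBasesAbove-* M d F (b (∣ F ∣))) (third≡0 lt) (fourth≡0 lt)

        helper : Dec (F ⊆ E M) → Dec (∣ F ∣ < d) → Dec (NonBasis M d F) → Dec (F ≡ E M) →
          when (isFlat? M F) (f F) ≡ ((first F ℤ.- second F) ℤ.+ third F) ℤ.+ fourth F
        helper (no F⊈E) _ _ _ = assemble
          (when-no (isFlat? M F) (λ flat → F⊈E (proj₁ flat)) _)
          (when-no (F ⊆? E M) F⊈E _)
          (subsetSum-0 (λ C → when-≡0 (nonBasis? M d C) (λ (C⊆E , _) → when-no (F ⊆? C) (λ F⊆C → F⊈E (C⊆E ∘ F⊆C)) _)))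
          (when-no (nonBasis? M d F) (λ (F⊆E , _) → F⊈E F⊆E) _)
          (when-no (F ≟ₛ E M) (λ { refl → F⊈E (λ x∈ → x∈) }) _)
        helper (yes F⊆E) (yes lt) _ _ with m≤n⇒m<n∨m≡n lt
        ... | inj₁ suc< = small-case F⊆E lt (trans (when-yes (isFlat? M F) flat _) (small F⊆E lt flat))
          where flat = small-flat F⊆E suc<
        ... | inj₂ suc≡ with size-d-1 F⊆E suc≡
        ...   | inj₁ (flat , _)        = small-case F⊆E lt (trans (when-yes (isFlat? M F) flat _) (small F⊆E lt flat))
        ...   | inj₂ (¬flat , above≡1) = small-case F⊆E lt (begin
          when (isFlat? M F) (f F)                        ≡⟨ when-no (isFlat? M F) ¬flat _ ⟩
          0ℤ                                              ≡⟨ ℤ.+-inverseʳ (b (∣ F ∣)) ⟨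
          b (∣ F ∣) ℤ.- b (∣ F ∣)                         ≡⟨ cong₂ ℤ._-_ (a≡b suc≡) (ℤ.*-identityʳ (b (∣ F ∣))) ⟨
          a (∣ F ∣) ℤ.- b (∣ F ∣) ℤ.* 1ℤ                  ≡⟨ cong (λ x → a (∣ F ∣) ℤ.- b (∣ F ∣) ℤ.* x) above≡1 ⟨
          a (∣ F ∣) ℤ.- b (∣ F ∣) ℤ.* nonBasesAbove M d F ∎)
        helper (yes F⊆E) (no ≮d) (yes nb) _ = assemble
          (trans (when-yes (isFlat? M F) (nonBasis-flat nb) _) (trans (nonBasis nb) (only-3 c)))
          (first≡0 ≮d) (second≡0 ≮d) (when-yes (nonBasis? M d F) nb _)
          (when-no (F ≟ₛ E M) (λ F≡E → ⊂-irref F≡E (nonBasis⇒⊂ nb)) _)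
        helper (yes F⊆E) (no ≮d) (no ¬nb) (yes F≡E) = assemble
          (trans (when-yes (isFlat? M F) (subst (IsFlat M) (sym F≡E) E-flat) _) (trans (cong f F≡E) (trans whole (only-4 e))))
          (first≡0 ≮d) (second≡0 ≮d) (when-no (nonBasis? M d F) ¬nb _) (when-yes (F ≟ₛ E M) F≡E _)
        helper (yes F⊆E) (no ≮d) (no ¬nb) (no F≢E) = assemble
          (when-no (isFlat? M F) (λ flat → F≢E (spanning-flat (≮⇒≥ ≮d) ¬nb flat)) _)
          (first≡0 ≮d) (second≡0 ≮d) (when-no (nonBasis? M d F) ¬nb _) (when-no (F ≟ₛ E M) F≢E _)

    flatSum : subsetSum (λ F → when (isFlat? M F) (f F)) ≡
      ((binomialSum (m + d) a ℤ.- nonBases M d ℤ.* binomialSum d b) ℤ.+ c ℤ.* nonBases M d) ℤ.+ e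
    flatSum = begin
      subsetSum (λ F → when (isFlat? M F) (f F))
        ≡⟨ subsetSum-cong classify ⟩
      subsetSum (λ F → ((first F ℤ.- second F) ℤ.+ third F) ℤ.+ fourth F)
        ≡⟨ trans (subsetSum-+ {n} _ _) (cong (ℤ._+ subsetSum fourth) (trans (subsetSum-+ {n} _ _)
             (cong (ℤ._+ subsetSum third) (subsetSum-- first second)))) ⟩
      ((subsetSum first ℤ.- subsetSum second) ℤ.+ subsetSum third) ℤ.+ subsetSum fourth
        ≡⟨ cong₂ ℤ._+_ (cong₂ ℤ._+_ (cong₂ ℤ._-_
             (trans (subsetSum-⊆ (E M) a) (cong (λ r → binomialSum r a) card)) (nonBases-⊆ M d b))
             (trans (subsetSum-cong (λ F → trans (cong (when (nonBasis? M d F)) (sym (ℤ.*-identityʳ c)))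
                      (when-* (nonBasis? M d F) c 1ℤ))) (subsetSum-* {n} c _)))
             (subsetSum-≡ (E M) (λ _ → e)) ⟩
      ((binomialSum (m + d) a ℤ.- nonBases M d ℤ.* binomialSum d b) ℤ.+ c ℤ.* nonBases M d) ℤ.+ e ∎

-- The characteristic polynomial of a sparse paving matroid

does-true : {P : Set} (P? : Dec P) → does P? ≡ true → P
does-true (yes p) _ = p

closure-⊥ : (M : Matroid n) → Loopless M → closure M ⊥ ≡ ⊥
closure-⊥ {n} M loopless = Empty-unique λ (e , e∈) →
  let e∈E , rk≡ = does-true ((e ∈? E M) ×-dec (rk M (⊥ ∪ ⁅ e ⁆) ≟ rk M ⊥))
                    (trans (sym (lookup∘tabulate _ e)) ([]=⇒lookup e∈))
  in loopless e e∈E (trans (cong (rk M) (sym (∪-identityˡ ⁅ e ⁆))) (trans rk≡ rk-⊥))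
  where
  rk-⊥ : rk M ⊥ ≡ 0
  rk-⊥ = n≤0⇒n≡0 (≤-trans (rk-card M ⊥ (⊆-min (E M))) (≤-reflexive (∣⊥∣≡0 n)))

coeff-χ-⊗ : (M : Matroid n) → Loopless M → ∀ q k → coeff (χ M ⊗ q) k ≡
  subsetSum (λ F → when (isFlat? M F) (möbius M ⊥ F ℤ.* shift (rank M ∸ rk M F) (coeff q) k))
coeff-χ-⊗ {n} M loopless q k = begin
  coeff (∑ (map (λ F → monomial (möbius M (closure M ⊥) F) (rank M ∸ rk M F)) (flats M)) ⊗ q) k
    ≡⟨ cong (λ G → coeff (∑ (map (λ F → monomial (möbius M G F) (rank M ∸ rk M F)) (flats M)) ⊗ q) k) (closure-⊥ M loopless) ⟩
  coeff (∑ (map (λ F → monomial (möbius M ⊥ F) (rank M ∸ rk M F)) (flats M)) ⊗ q) k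
    ≡⟨ coeff-∑-⊗ (map (λ F → monomial (möbius M ⊥ F) (rank M ∸ rk M F)) (flats M)) q k ⟩
  sumℤ (map (λ p → coeff (p ⊗ q) k) (map (λ F → monomial (möbius M ⊥ F) (rank M ∸ rk M F)) (flats M)))
    ≡⟨ cong sumℤ (List.map-∘ (flats M)) ⟨
  sumℤ (map (λ F → coeff (monomial (möbius M ⊥ F) (rank M ∸ rk M F) ⊗ q) k) (flats M))
    ≡⟨ cong sumℤ (List.map-cong (λ F → coeff-monomial-⊗ (möbius M ⊥ F) (rank M ∸ rk M F) q k) (flats M)) ⟩
  sumℤ (map (λ F → möbius M ⊥ F ℤ.* shift (rank M ∸ rk M F) (coeff q) k) (flats M))
    ≡⟨ sumℤ-filter-subsets (isFlat? M) _ ⟩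
  subsetSum (λ F → when (isFlat? M F) (möbius M ⊥ F ℤ.* shift (rank M ∸ rk M F) (coeff q) k)) ∎
  where open ≡-Reasoning

binomialSum-sign′ : ∀ {k} → 0 < k → binomialSum k sign ≡ 0ℤ
binomialSum-sign′ {suc k} _ = binomialSum-sign k

module SparsePavingχ {M : Matroid n} (sp : IsSparsePaving M m d) (0<d : 0 < d) where
  open IsSparsePaving sp
  open SparsePavingFlats sp
  open ≡-Reasoning

  -- The proper flats inside a circuit-hyperplane are its subsets of size at most d - 2; those of
  -- size d - 1 span it and are not flats.
  nonBasisMöbius : ℤ
  nonBasisMöbius = ℤ.- binomialSum d (λ i → when (suc i <? d) (sign i))

  flatMöbius : Subset n → ℤ
  flatMöbius F = if does (nonBasis? M d F) then nonBasisMöbius else sign ∣ F ∣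

  flatMöbius-small : ∀ F → ∣ F ∣ < d → flatMöbius F ≡ sign ∣ F ∣
  flatMöbius-small F lt = cong (λ b → if b then nonBasisMöbius else sign ∣ F ∣)
    (dec-false (nonBasis? M d F) (λ (_ , ≡d , _) → <⇒≢ lt ≡d))

  flatMöbius-nonBasis : ∀ {F} → NonBasis M d F → flatMöbius F ≡ nonBasisMöbius
  flatMöbius-nonBasis {F} nb = cong (λ b → if b then nonBasisMöbius else sign ∣ F ∣) (dec-true (nonBasis? M d F) nb)

  möbius-small : ∀ F → Acc _⊂_ F → F ⊆ E M → ∣ F ∣ < d → ∀ a → möbius-acc M ⊥ F a ≡ sign ∣ F ∣
  möbius-small F (acc rs) F⊆E lt a with F ≟ₛ ⊥
  ... | yes refl = trans (möbius-⊥ M a) (cong sign (sym (∣⊥∣≡0 n)))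
  ... | no  F≢⊥  = begin
    möbius-acc M ⊥ F a
      ≡⟨ möbius-recursion M F (λ H → sign ∣ H ∣) F≢⊥
           (λ H _ H⊂F → möbius-small H (rs H⊂F) (F⊆E ∘ p⊂q⇒p⊆q H⊂F) (<-trans (p⊂q⇒∣p∣<∣q∣ H⊂F) lt)) a ⟩
    ℤ.- subsetSum (λ H → when (isFlat? M H) (when (H ⊂? F) (sign ∣ H ∣)))
      ≡⟨ cong (λ x → ℤ.- x) (subsetSum-cong allFlat) ⟩
    ℤ.- subsetSum (λ H → when (H ⊂? F) (sign ∣ H ∣))
      ≡⟨ cong (λ x → ℤ.- x) (subsetSum-⊂ F sign) ⟩
    ℤ.- (binomialSum (∣ F ∣) sign ℤ.- sign (∣ F ∣))
      ≡⟨ cong (λ x → ℤ.- (x ℤ.- sign (∣ F ∣))) (binomialSum-sign′ (n≢0⇒n>0 (F≢⊥ ∘ ∣p∣≡0⇒p≡⊥))) ⟩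
    ℤ.- (0ℤ ℤ.- sign (∣ F ∣))
      ≡⟨ lemma (sign (∣ F ∣)) ⟩
    sign ∣ F ∣ ∎
    where
    lemma : ∀ x → ℤ.- (0ℤ ℤ.- x) ≡ x
    lemma = ℤ-solve
    allFlat : ∀ H → when (isFlat? M H) (when (H ⊂? F) (sign ∣ H ∣)) ≡ when (H ⊂? F) (sign ∣ H ∣)
    allFlat H = trans (when-comm (isFlat? M H) (H ⊂? F) (sign ∣ H ∣))
      (when-cong (H ⊂? F) (H ⊂? F) (λ x → x) (λ x → x) (λ H⊂F →
        when-yes (isFlat? M H) (small-flat (F⊆E ∘ p⊂q⇒p⊆q H⊂F) (≤-<-trans (p⊂q⇒∣p∣<∣q∣ H⊂F) lt)) (sign ∣ H ∣)))

  möbius-nonBasis : ∀ C → NonBasis M d C → ∀ a → möbius-acc M ⊥ C a ≡ nonBasisMöbius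
  möbius-nonBasis C nb@(C⊆E , ∣C∣≡d , _) a = begin
    möbius-acc M ⊥ C a
      ≡⟨ möbius-recursion M C (λ H → sign ∣ H ∣) C≢⊥
           (λ H _ H⊂C → möbius-small H (⊂-wellFounded H) (C⊆E ∘ p⊂q⇒p⊆q H⊂C) (small H⊂C)) a ⟩
    ℤ.- subsetSum (λ H → when (isFlat? M H) (when (H ⊂? C) (sign ∣ H ∣)))
      ≡⟨ cong (λ x → ℤ.- x) (subsetSum-cong pointwise) ⟩
    ℤ.- subsetSum (λ H → when (H ⊆? C) (when (suc ∣ H ∣ <? d) (sign ∣ H ∣)))
      ≡⟨ cong (λ x → ℤ.- x) (trans (subsetSum-⊆ C (λ i → when (suc i <? d) (sign i)))
           (cong (λ k → binomialSum k (λ i → when (suc i <? d) (sign i))) ∣C∣≡d)) ⟩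
    nonBasisMöbius ∎
    where
    C≢⊥ : C ≢ ⊥
    C≢⊥ refl = <⇒≢ 0<d (trans (sym (∣⊥∣≡0 n)) ∣C∣≡d)
    small : ∀ {H} → H ⊂ C → ∣ H ∣ < d
    small H⊂C = <-≤-trans (p⊂q⇒∣p∣<∣q∣ H⊂C) (≤-reflexive ∣C∣≡d)
    pointwise : ∀ H → when (isFlat? M H) (when (H ⊂? C) (sign ∣ H ∣)) ≡
                when (H ⊆? C) (when (suc ∣ H ∣ <? d) (sign ∣ H ∣))
    pointwise H with H ⊂? C
    ... | no  H⊄C = trans (when-0 (isFlat? M H)) (sym (when-≡0 (H ⊆? C) (λ H⊆C →
      when-no (suc ∣ H ∣ <? d) (λ lt → H⊄C (⊆∧≢⇒⊂ H⊆C (λ { refl → <⇒≢ (<-trans (n<1+n _) lt) ∣C∣≡d }))) (sign ∣ H ∣))))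
    ... | yes H⊂C = trans
      (when-cong (isFlat? M H) (suc ∣ H ∣ <? d) flat⇒ (small-flat H⊆E) (λ _ → refl))
      (sym (when-yes (H ⊆? C) (p⊂q⇒p⊆q H⊂C) _))
      where
      H⊆E : H ⊆ E M
      H⊆E = C⊆E ∘ p⊂q⇒p⊆q H⊂C
      flat⇒ : IsFlat M H → suc ∣ H ∣ < d
      flat⇒ flat = ≤∧≢⇒< (small H⊂C) (λ ≡d → noFlat ≡d (size-d-1 H⊆E ≡d))
        where
        noFlat : suc ∣ H ∣ ≡ d → ¬ ((IsFlat M H × nonBasesAbove M d H ≡ 0ℤ) ⊎ (¬ IsFlat M H × nonBasesAbove M d H ≡ 1ℤ))
        noFlat _ (inj₂ (¬flat , _)) = ¬flat flat
        noFlat ≡d (inj₁ ((_ , grow) , _)) with ⊆∧≢⇒∃ (p⊂q⇒p⊆q H⊂C) (λ { refl → ⊂-irref refl H⊂C })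
        ... | e , e∈C , e∉H = <⇒≱ (grow e (C⊆E e∈C) e∉H) (≤-trans
          (rk-mono M _ C (∪⁅⁆-⊆ (p⊂q⇒p⊆q H⊂C) e∈C) C⊆E)
          (≤-reflexive (trans (suc-injective (trans (proj₂ (proj₂ nb)) (sym ≡d))) (sym (rk-small H⊆E (≤-reflexive ≡d))))))

  möbius-flat : ∀ F → IsFlat M F → F ⊂ E M → ∀ a → möbius-acc M ⊥ F a ≡ flatMöbius F
  möbius-flat F flat F⊂E a with ∣ F ∣ <? d
  ... | yes lt = trans (möbius-small F (⊂-wellFounded F) (proj₁ flat) lt a) (sym (flatMöbius-small F lt))
  ... | no  ≮d = helper (nonBasis? M d F)
    where
    helper : Dec (NonBasis M d F) → möbius-acc M ⊥ F a ≡ flatMöbius F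
    helper (yes nb) = trans (möbius-nonBasis F nb a) (sym (flatMöbius-nonBasis nb))
    helper (no ¬nb) = ⊥-elim (⊂-irref (spanning-flat (≮⇒≥ ≮d) ¬nb flat) F⊂E)

  E≢⊥ : E M ≢ ⊥
  E≢⊥ E≡⊥ = <⇒≱ 0<d (≤-trans d≤∣E∣ (≤-reflexive (trans (cong ∣_∣ E≡⊥) (∣⊥∣≡0 n))))

  module _ (f : ℕ → ℤ) (k : ℕ) where
    y : ℕ → ℤ
    y r = shift r f k ℤ.- f k

    -- The Möbius value at `E` is minus the sum of all the others. Distributing it turns each power
    -- t^r into t^r - 1 and leaves only values that are already known.
    proper-flats : subsetSum (λ F → when (isFlat? M F) (möbius M ⊥ F ℤ.* shift (rank M ∸ rk M F) f k)) ≡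
                   subsetSum (λ F → when (isFlat? M F) (when (F ⊂? E M) (flatMöbius F ℤ.* y (d ∸ rk M F))))
    proper-flats = begin
      subsetSum (λ F → when (isFlat? M F) (möbius M ⊥ F ℤ.* shift (rank M ∸ rk M F) f k))
        ≡⟨ subsetSum-cong split ⟩
      subsetSum (λ F → when (isFlat? M F) (when (F ⊂? E M) (flatMöbius F ℤ.* shift (d ∸ rk M F) f k)) ℤ.+
                       when (F ≟ₛ E M) (möbius M ⊥ F ℤ.* f k))
        ≡⟨ subsetSum-+ {n} _ _ ⟩
      s ℤ.+ subsetSum (λ F → when (F ≟ₛ E M) (möbius M ⊥ F ℤ.* f k))
        ≡⟨ cong (λ x → s ℤ.+ x) (subsetSum-≡ (E M) (λ F → möbius M ⊥ F ℤ.* f k)) ⟩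
      s ℤ.+ möbius M ⊥ (E M) ℤ.* f k
        ≡⟨ cong (λ x → s ℤ.+ x ℤ.* f k) (möbius-recursion M (E M) flatMöbius E≢⊥ möbius-flat (⊂-wellFounded (E M))) ⟩
      s ℤ.+ (ℤ.- subsetSum (λ F → when (isFlat? M F) (when (F ⊂? E M) (flatMöbius F)))) ℤ.* f k
        ≡⟨ lemma s (subsetSum (λ F → when (isFlat? M F) (when (F ⊂? E M) (flatMöbius F)))) (f k) ⟩
      s ℤ.- f k ℤ.* subsetSum (λ F → when (isFlat? M F) (when (F ⊂? E M) (flatMöbius F)))
        ≡⟨ cong (λ x → s ℤ.- x) (subsetSum-* {n} (f k) _) ⟨
      s ℤ.- subsetSum (λ F → f k ℤ.* when (isFlat? M F) (when (F ⊂? E M) (flatMöbius F)))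
        ≡⟨ subsetSum-- {n} _ _ ⟨
      subsetSum (λ F → when (isFlat? M F) (when (F ⊂? E M) (flatMöbius F ℤ.* shift (d ∸ rk M F) f k)) ℤ.-
                       f k ℤ.* when (isFlat? M F) (when (F ⊂? E M) (flatMöbius F)))
        ≡⟨ subsetSum-cong combine ⟩
      subsetSum (λ F → when (isFlat? M F) (when (F ⊂? E M) (flatMöbius F ℤ.* y (d ∸ rk M F)))) ∎
      where
      s = subsetSum (λ F → when (isFlat? M F) (when (F ⊂? E M) (flatMöbius F ℤ.* shift (d ∸ rk M F) f k)))
      lemma : ∀ s t a → s ℤ.+ (ℤ.- t) ℤ.* a ≡ s ℤ.- a ℤ.* t
      lemma = ℤ-solve
      split : ∀ F → when (isFlat? M F) (möbius M ⊥ F ℤ.* shift (rank M ∸ rk M F) f k) ≡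
              when (isFlat? M F) (when (F ⊂? E M) (flatMöbius F ℤ.* shift (d ∸ rk M F) f k)) ℤ.+
              when (F ≟ₛ E M) (möbius M ⊥ F ℤ.* f k)
      split F with F ≟ₛ E M
      ... | yes refl = begin
        when (isFlat? M F) (möbius M ⊥ F ℤ.* shift (rank M ∸ rank M) f k)
          ≡⟨ when-yes (isFlat? M F) E-flat _ ⟩
        möbius M ⊥ F ℤ.* shift (rank M ∸ rank M) f k
          ≡⟨ cong (λ r → möbius M ⊥ F ℤ.* shift r f k) (n∸n≡0 (rank M)) ⟩
        möbius M ⊥ F ℤ.* f k
          ≡⟨ ℤ.+-identityˡ _ ⟨
        0ℤ ℤ.+ möbius M ⊥ F ℤ.* f k
          ≡⟨ cong (λ x → x ℤ.+ möbius M ⊥ F ℤ.* f k) (trans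
               (cong (when (isFlat? M F)) (when-no (F ⊂? F) (⊂-irref refl) (flatMöbius F ℤ.* shift (d ∸ rk M F) f k)))
               (when-0 (isFlat? M F))) ⟨
        when (isFlat? M F) (when (F ⊂? F) (flatMöbius F ℤ.* shift (d ∸ rk M F) f k)) ℤ.+ möbius M ⊥ F ℤ.* f k ∎
      ... | no  F≢E  = trans
        (when-cong (isFlat? M F) (isFlat? M F) (λ x → x) (λ x → x) (λ flat →
          let F⊂E = ⊆∧≢⇒⊂ (proj₁ flat) F≢E in trans
          (cong₂ (λ μ r → μ ℤ.* shift (r ∸ rk M F) f k) (möbius-flat F flat F⊂E (⊂-wellFounded F)) rk-E)
          (sym (when-yes (F ⊂? E M) F⊂E _))))
        (sym (ℤ.+-identityʳ _))
      combine : ∀ F → when (isFlat? M F) (when (F ⊂? E M) (flatMöbius F ℤ.* shift (d ∸ rk M F) f k)) ℤ.-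
                      f k ℤ.* when (isFlat? M F) (when (F ⊂? E M) (flatMöbius F)) ≡
                when (isFlat? M F) (when (F ⊂? E M) (flatMöbius F ℤ.* y (d ∸ rk M F)))
      combine F with does (isFlat? M F) | does (F ⊂? E M)
      ... | true  | true  = lemma₂ (flatMöbius F) (shift (d ∸ rk M F) f k) (f k)
        where
        lemma₂ : ∀ a b c → a ℤ.* b ℤ.- c ℤ.* a ≡ a ℤ.* (b ℤ.- c)
        lemma₂ = ℤ-solve
      ... | true  | false = cong (λ x → 0ℤ ℤ.- x) (ℤ.*-zeroʳ (f k))
      ... | false | _     = cong (λ x → 0ℤ ℤ.- x) (ℤ.*-zeroʳ (f k))

    -- Taken off once for each circuit-hyperplane and each of its subsets of size d - 1, which the
    -- sum over all small sets counts although they are not flats.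
    correction : ℕ → ℤ
    correction i = when (suc i ≟ d) (sign i ℤ.* y 1)

    -- The Möbius value accounts for the sizes below d - 1 and the correction for size d - 1.
    -- Together they form the alternating sum over the proper subsets of a d-set, which is minus
    -- `sign d`.
    nonBasis-contribution : nonBasisMöbius ℤ.* y 1 ℤ.- binomialSum d correction ≡ sign d ℤ.* y 1
    nonBasis-contribution = begin
      nonBasisMöbius ℤ.* y 1 ℤ.- binomialSum d correction
        ≡⟨ cong (λ x → nonBasisMöbius ℤ.* y 1 ℤ.- x) (trans
             (binomialSum-cong d (λ i _ → trans (cong (when (suc i ≟ d)) (ℤ.*-comm (sign i) (y 1))) (when-* (suc i ≟ d) (y 1) (sign i))))
             (binomialSum-* d (y 1) last)) ⟩
      nonBasisMöbius ℤ.* y 1 ℤ.- y 1 ℤ.* binomialSum d last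
        ≡⟨ lemma (binomialSum d rest) (binomialSum d last) (y 1) ⟩
      ℤ.- ((binomialSum d rest ℤ.+ binomialSum d last) ℤ.* y 1)
        ≡⟨ cong (λ x → ℤ.- (x ℤ.* y 1)) (sym (binomialSum-+ d rest last)) ⟩
      ℤ.- (binomialSum d both ℤ.* y 1)
        ≡⟨ cong (λ x → ℤ.- (x ℤ.* y 1)) both≡ ⟩
      ℤ.- ((ℤ.- sign d) ℤ.* y 1)
        ≡⟨ lemma₂ (sign d) (y 1) ⟩
      sign d ℤ.* y 1 ∎
      where
      rest last both : ℕ → ℤ
      rest i = when (suc i <? d) (sign i)
      last i = when (suc i ≟ d) (sign i)
      both i = rest i ℤ.+ last i
      lemma : ∀ r l y → (ℤ.- r) ℤ.* y ℤ.- y ℤ.* l ≡ ℤ.- ((r ℤ.+ l) ℤ.* y)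
      lemma = ℤ-solve
      lemma₂ : ∀ s y → ℤ.- ((ℤ.- s) ℤ.* y) ≡ s ℤ.* y
      lemma₂ = ℤ-solve
      agree : ∀ i → i < d → both i ≡ sign i
      agree i i<d with m≤n⇒m<n∨m≡n i<d
      ... | inj₁ lt = trans (cong₂ ℤ._+_ (when-yes (suc i <? d) lt (sign i)) (when-no (suc i ≟ d) (<⇒≢ lt) (sign i))) (ℤ.+-identityʳ (sign i))
      ... | inj₂ eq = trans (cong₂ ℤ._+_ (when-no (suc i <? d) (λ lt → <⇒≢ lt eq) (sign i)) (when-yes (suc i ≟ d) eq (sign i))) (ℤ.+-identityˡ (sign i))
      both-d : both d ≡ 0ℤ
      both-d = cong₂ ℤ._+_ (when-no (suc d <? d) (<-asym (n<1+n d)) (sign d)) (when-no (suc d ≟ d) 1+n≢n (sign d))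
      both≡ : binomialSum d both ≡ ℤ.- sign d
      both≡ = begin
        binomialSum d both
          ≡⟨ lemma₃ (binomialSum d both) (sign d) ⟩
        (binomialSum d both ℤ.+ sign d) ℤ.- sign d
          ≡⟨ cong (λ x → x ℤ.- sign d) (binomialSum-last d both sign agree) ⟩
        (binomialSum d sign ℤ.+ both d) ℤ.- sign d
          ≡⟨ cong₂ (λ x z → (x ℤ.+ z) ℤ.- sign d) (binomialSum-sign′ 0<d) both-d ⟩
        0ℤ ℤ.- sign d
          ≡⟨ ℤ.+-identityˡ _ ⟩
        ℤ.- sign d ∎
        where
        lemma₃ : ∀ x s → x ≡ (x ℤ.+ s) ℤ.- s
        lemma₃ = ℤ-solve

  χ-⊗ : Loopless M → ∀ q k → coeff (χ M ⊗ q) k ≡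
        uniformχ m d (coeff q) k ℤ.+ nonBases M d ℤ.* (sign d ℤ.* Δ (coeff q) k)
  χ-⊗ loopless q k = begin
    coeff (χ M ⊗ q) k
      ≡⟨ trans (coeff-χ-⊗ M loopless q k) (proper-flats f k) ⟩
    subsetSum (λ F → when (isFlat? M F) (summand F))
      ≡⟨ flatSum summand (λ i → sign i ℤ.* y f k (d ∸ i)) (correction f k) (nonBasisMöbius ℤ.* y f k 1) 0ℤ
           small a≡b a≡0 b≡0 nonBasis (when-no (E M ⊂? E M) (⊂-irref refl) _) ⟩
    ((uniformχ m d f k ℤ.- nonBases M d ℤ.* binomialSum d (correction f k)) ℤ.+
    (nonBasisMöbius ℤ.* y f k 1) ℤ.* nonBases M d) ℤ.+ 0ℤ
      ≡⟨ lemma (uniformχ m d f k) (nonBases M d) (binomialSum d (correction f k)) (nonBasisMöbius ℤ.* y f k 1) ⟩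
    uniformχ m d f k ℤ.+ nonBases M d ℤ.* (nonBasisMöbius ℤ.* y f k 1 ℤ.- binomialSum d (correction f k))
      ≡⟨ cong (λ x → uniformχ m d f k ℤ.+ nonBases M d ℤ.* x) (nonBasis-contribution f k) ⟩
    uniformχ m d f k ℤ.+ nonBases M d ℤ.* (sign d ℤ.* Δ f k) ∎
    where
    f = coeff q
    summand : Subset n → ℤ
    summand F = when (F ⊂? E M) (flatMöbius F ℤ.* y f k (d ∸ rk M F))
    lemma : ∀ u n b z → ((u ℤ.- n ℤ.* b) ℤ.+ z ℤ.* n) ℤ.+ 0ℤ ≡ u ℤ.+ n ℤ.* (z ℤ.- b)
    lemma = ℤ-solve
    a≡b : ∀ {j} → suc j ≡ d → sign j ℤ.* y f k (d ∸ j) ≡ correction f k j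
    a≡b {j} suc≡ = trans
      (cong (λ r → sign j ℤ.* y f k r) (trans (cong (_∸ j) (sym suc≡)) (m+n∸n≡m 1 j)))
      (sym (when-yes (suc j ≟ d) suc≡ _))
    a≡0 : ∀ {j} → d ≤ j → sign j ℤ.* y f k (d ∸ j) ≡ 0ℤ
    a≡0 {j} d≤j = trans
      (cong (λ x → sign j ℤ.* x) (trans (cong (y f k) (m≤n⇒m∸n≡0 d≤j)) (ℤ.+-inverseʳ (f k)))) (ℤ.*-zeroʳ (sign j))
    b≡0 : ∀ {j} → d ≤ j → correction f k j ≡ 0ℤ
    b≡0 {j} d≤j = when-no (suc j ≟ d) (λ suc≡ → <⇒≱ (≤-reflexive suc≡) d≤j) _
    nonBasis : ∀ {C} → NonBasis M d C → summand C ≡ nonBasisMöbius ℤ.* y f k 1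
    nonBasis {C} nb@(_ , _ , rk≡) = trans (when-yes (C ⊂? E M) (nonBasis⇒⊂ nb) _)
      (cong₂ (λ v r → v ℤ.* y f k r) (flatMöbius-nonBasis nb) (trans (cong (_∸ rk M C) (sym rk≡)) (m+n∸n≡m 1 (rk M C))))
    small : ∀ {F} → F ⊆ E M → ∣ F ∣ < d → IsFlat M F →
      summand F ≡ sign (∣ F ∣) ℤ.* y f k (d ∸ ∣ F ∣) ℤ.- correction f k (∣ F ∣) ℤ.* nonBasesAbove M d F
    small {F} F⊆E lt flat = trans
      (trans (when-yes (F ⊂? E M) (⊂-E F⊆E lt) _)
        (cong₂ (λ v r → v ℤ.* y f k (d ∸ r)) (flatMöbius-small F lt) (rk-small F⊆E lt)))
      (trans (sym (ℤ.+-identityʳ _)) (cong (λ x → sign (∣ F ∣) ℤ.* y f k (d ∸ ∣ F ∣) ℤ.- x) (sym (vanish (suc ∣ F ∣ ≟ d)))))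
      where
      -- The correction is nonzero only in size d - 1, and a flat of that size lies in no
      -- circuit-hyperplane.
      vanish : Dec (suc ∣ F ∣ ≡ d) → correction f k (∣ F ∣) ℤ.* nonBasesAbove M d F ≡ 0ℤ
      vanish (no  ≢d) = cong (ℤ._* nonBasesAbove M d F) (when-no (suc ∣ F ∣ ≟ d) ≢d _)
      vanish (yes ≡d) with size-d-1 F⊆E ≡d
      ... | inj₁ (_ , above≡0) = trans (cong (λ x → correction f k (∣ F ∣) ℤ.* x) above≡0) (ℤ.*-zeroʳ (correction f k (∣ F ∣)))
      ... | inj₂ (¬flat , _)   = contradiction flat ¬flat

-- Restrictions and contractions of sparse paving matroids

when-× : ∀ {P Q : Set} (P? : Dec P) (Q? : Dec Q) → ∀ x → when (P? ×-dec Q?) x ≡ when P? (when Q? x)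
when-× (yes p) Q? x = refl
when-× (no ¬p) Q? x = refl

⊆⇒∩≡ : {E F : Subset n} → F ⊆ E → E ∩ F ≡ F
⊆⇒∩≡ {E = E} {F} F⊆E = ⊆-antisym (p∩q⊆q E F) (λ x∈ → x∈p∩q⁺ (F⊆E x∈ , x∈))

─-∪-cancel : {E F : Subset n} → F ⊆ E → (E ─ F) ∪ F ≡ E
─-∪-cancel {E = E} {F} F⊆E = ⊆-antisym (∪-least (p─q⊆p E F) F⊆E) λ {x} x∈E → cover x x∈E
  where
  cover : ∀ x → x ∈ E → x ∈ (E ─ F) ∪ F
  cover x x∈E with x ∈? F
  ... | yes x∈F = q⊆p∪q (E ─ F) F x∈F
  ... | no  x∉F = p⊆p∪q F (x∈p∧x∉q⇒x∈p─q x∈E x∉F)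

∣∪∣-─ : {E F S : Subset n} → S ⊆ E ─ F → ∣ S ∪ F ∣ ≡ ∣ S ∣ + ∣ F ∣
∣∪∣-─ {E = E} {F} {S} S⊆ = ∣∪∣-disjoint S F (λ x∈S → ─-∈⁻ E F (S⊆ x∈S))

∣─∣ : {E F : Subset n} → F ⊆ E → ∣ E ─ F ∣ + ∣ F ∣ ≡ ∣ E ∣
∣─∣ {E = E} {F} F⊆E = trans (sym (∣∪∣-─ {E = E} (λ x∈ → x∈))) (cong ∣_∣ (─-∪-cancel F⊆E))

∪-⊆ : {E F S : Subset n} → S ⊆ E ─ F → F ⊆ E → S ∪ F ⊆ E
∪-⊆ {E = E} {F} S⊆ F⊆E = ∪-least (p─q⊆p E F ∘ S⊆) F⊆E

restrict-loopless : (M : Matroid n) (F : Subset n) → Loopless M → Loopless (restrict M F)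
restrict-loopless M F loopless e e∈ = loopless e (p∩q⊆p (E M) F e∈)

contract-rk : (M : Matroid n) {F : Subset n} → F ⊆ E M → ∀ S → rk (contract M F) S ≡ rk M (S ∪ F) ∸ rk M F
contract-rk M F⊆E S = cong (λ G → rk M (S ∪ G) ∸ rk M G) (⊆⇒∩≡ F⊆E)

contract-loopless : (M : Matroid n) (F : Subset n) → IsFlat M F → Loopless (contract M F)
contract-loopless M F (F⊆E , flat) e e∈ rk≡0 = <⇒≱ (flat e (p─q⊆p (E M) F e∈) (─-∈⁻ (E M) F e∈))
  (≤-trans (≤-reflexive (cong (rk M) (∪-comm F ⁅ e ⁆)))
           (m∸n≡0⇒m≤n (trans (sym (contract-rk M F⊆E ⁅ e ⁆)) rk≡0)))

nonBases-loopless : (M : Matroid n) → Loopless M → ∀ C → ¬ NonBasis M 1 C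
nonBases-loopless M loopless C (C⊆E , ∣C∣≡1 , rk≡) with nonempty? C
... | yes (e , e∈C) = loopless e (C⊆E e∈C) (n≤0⇒n≡0 (≤-trans
  (rk-mono M ⁅ e ⁆ C (λ x∈ → subst (_∈ C) (sym (x∈⁅y⁆⇒x≡y e x∈)) e∈C) C⊆E) (≤-reflexive (suc-injective rk≡))))
nonBases-loopless {n} M loopless C (C⊆E , ∣C∣≡1 , rk≡) | no ¬ne =
  1+n≢0 (trans (sym ∣C∣≡1) (trans (cong ∣_∣ (Empty-unique ¬ne)) (∣⊥∣≡0 n)))

nonBases-0 : (M : Matroid n) (d : ℕ) → (∀ C → ¬ NonBasis M d C) → nonBases M d ≡ 0ℤ
nonBases-0 M d none = subsetSum-0 (λ C → when-no (nonBasis? M d C) (none C) 1ℤ)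

module SparsePavingMinors {M : Matroid n} (sp : IsSparsePaving M m d) where
  open IsSparsePaving sp
  open SparsePavingFlats sp

  private
    ∩⊆ : ∀ {F S : Subset n} → S ⊆ E M ∩ F → S ⊆ F
    ∩⊆ {F} S⊆ = p∩q⊆q (E M) F ∘ S⊆

  restrict-free : ∀ {F} → F ⊆ E M → ∣ F ∣ < d → IsSparsePaving (restrict M F) 0 ∣ F ∣
  restrict-free {F} F⊆E lt = record
    { card     = cong ∣_∣ (⊆⇒∩≡ F⊆E)
    ; rk-E     = trans (cong (rk M) (⊆⇒∩≡ F⊆E)) (rk-small F⊆E lt)
    ; rk-small = λ S⊆ S< → rk-small (F⊆E ∘ ∩⊆ S⊆) (<-trans S< lt)
    ; rk-equal = λ S⊆ S≡ rk≢ → contradiction (trans (rk-small (F⊆E ∘ ∩⊆ S⊆) (subst (_< d) (sym S≡) lt)) S≡) rk≢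
    ; rk-large = λ S⊆ S> → contradiction (p⊆q⇒∣p∣≤∣q∣ (∩⊆ S⊆)) (<⇒≱ S>)
    }

  restrict-free-nonBases : ∀ {F} → F ⊆ E M → ∣ F ∣ < d → nonBases (restrict M F) (∣ F ∣) ≡ 0ℤ
  restrict-free-nonBases {F} F⊆E lt = nonBases-0 (restrict M F) (∣ F ∣) (λ C (C⊆ , C≡ , rk≡) →
    1+n≢n (trans rk≡ (trans (sym C≡) (sym (rk-small (F⊆E ∘ ∩⊆ C⊆) (subst (_< d) (sym C≡) lt))))))

  -- The proper subsets of `C` have fewer than d elements and are independent, so the restriction is
  -- the uniform matroid U_{d-1,d}.
  restrict-circuit : ∀ {C} → NonBasis M d C → IsSparsePaving (restrict M C) 1 (pred d)
  restrict-circuit {C} (C⊆E , C≡d , rk≡) = record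
    { card     = trans (cong ∣_∣ (⊆⇒∩≡ C⊆E)) (trans C≡d (sym d≡))
    ; rk-E     = trans (cong (rk M) (⊆⇒∩≡ C⊆E)) rkC
    ; rk-small = λ S⊆ S< → rk-small (C⊆E ∘ ∩⊆ S⊆) (<-≤-trans S< pred[n]≤n)
    ; rk-equal = λ S⊆ S≡ rk≢ → contradiction
        (trans (rk-small (C⊆E ∘ ∩⊆ S⊆) (≤-reflexive (trans (cong suc S≡) d≡))) S≡) rk≢
    ; rk-large = λ S⊆ S> → trans
        (cong (rk M) (⊆∧∣≥∣⇒≡ (∩⊆ S⊆) (≤-trans (≤-reflexive (trans C≡d (sym d≡))) S>))) rkC
    }
    where
    d≡ : suc (pred d) ≡ d
    d≡ = trans (cong (suc ∘ pred) (sym rk≡)) rk≡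
    rkC : rk M C ≡ pred d
    rkC = cong pred rk≡

  restrict-circuit-nonBases : ∀ {C} → NonBasis M d C → nonBases (restrict M C) (pred d) ≡ 0ℤ
  restrict-circuit-nonBases {C} (C⊆E , C≡d , rk≡) = nonBases-0 (restrict M C) (pred d) (λ S (S⊆ , S≡ , rkS≡) →
    1+n≢n (trans rkS≡ (trans (sym S≡) (sym (rk-small (C⊆E ∘ ∩⊆ S⊆) (≤-reflexive (trans (cong suc S≡) d≡)))))))
    where
    d≡ : suc (pred d) ≡ d
    d≡ = trans (cong (suc ∘ pred) (sym rk≡)) rk≡

  restrict-E : IsSparsePaving (restrict M (E M)) m d
  restrict-E = record
    { card     = trans (cong ∣_∣ E∩E) card
    ; rk-E     = trans (cong (rk M) E∩E) rk-E
    ; rk-small = λ S⊆ → rk-small (∩⊆ S⊆)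
    ; rk-equal = λ S⊆ → rk-equal (∩⊆ S⊆)
    ; rk-large = λ S⊆ → rk-large (∩⊆ S⊆)
    }
    where
    E∩E : E M ∩ E M ≡ E M
    E∩E = ∩-idem (E M)

  restrict-E-nonBases : nonBases (restrict M (E M)) d ≡ nonBases M d
  restrict-E-nonBases = subsetSum-cong (λ S → when-cong (nonBasis? (restrict M (E M)) d S) (nonBasis? M d S)
    (λ (S⊆ , rest) → ∩⊆ S⊆ , rest)
    (λ (S⊆ , rest) → (λ x∈ → x∈p∩q⁺ (S⊆ x∈ , S⊆ x∈)) , rest) (λ _ → refl))

  module _ {F : Subset n} (F⊆E : F ⊆ E M) {r : ℕ} (r≡ : r + ∣ F ∣ ≡ d) (0<r : 0 < r) where
    private
      F<d : ∣ F ∣ < d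
      F<d = ≤-trans (+-monoˡ-≤ (∣ F ∣) 0<r) (≤-reflexive r≡)
      rkF : rk M F ≡ ∣ F ∣
      rkF = rk-small F⊆E F<d
      ∸-rk : ∀ {S x} → rk M (S ∪ F) ≡ x + ∣ F ∣ → rk (contract M F) S ≡ x
      ∸-rk {S} {x} eq = trans (contract-rk M F⊆E S) (trans (cong₂ _∸_ eq rkF) (m+n∸n≡m x (∣ F ∣)))
      rk-∪F : ∀ {S} → S ⊆ E M ─ F → rk M (S ∪ F) ≡ rk (contract M F) S + ∣ F ∣
      rk-∪F {S} S⊆ = trans
        (sym (m∸n+n≡m (rk-mono M F (S ∪ F) (q⊆p∪q S F) (∪-⊆ S⊆ F⊆E))))
        (cong₂ _+_ (sym (contract-rk M F⊆E S)) rkF)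
      ∣S∪F∣ : ∀ {S} → S ⊆ E M ─ F → ∣ S ∣ ≡ r → ∣ S ∪ F ∣ ≡ d
      ∣S∪F∣ S⊆ S≡ = trans (∣∪∣-─ {E = E M} S⊆) (trans (cong (_+ ∣ F ∣) S≡) r≡)

    contract-free : IsSparsePaving (contract M F) m r
    contract-free = record
      { card     = +-cancelʳ-≡ (∣ F ∣) _ _ (trans (∣─∣ F⊆E) (trans card
                     (trans (cong (λ x → m + x) (sym r≡)) (sym (+-assoc m r (∣ F ∣))))))
      ; rk-E     = ∸-rk (trans (cong (rk M) (─-∪-cancel F⊆E)) (trans rk-E (sym r≡)))
      ; rk-small = λ {S} S⊆ S< → ∸-rk (trans
          (rk-small (∪-⊆ S⊆ F⊆E) (<-≤-trans (≤-<-trans (≤-reflexive (∣∪∣-─ {E = E M} S⊆)) (+-monoˡ-< (∣ F ∣) S<)) (≤-reflexive r≡)))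
          (∣∪∣-─ {E = E M} S⊆))
      ; rk-equal = λ {S} S⊆ S≡ rk≢ → +-cancelʳ-≡ (∣ F ∣) _ _ (trans
          (cong suc (sym (rk-∪F S⊆)))
          (trans (rk-equal (∪-⊆ S⊆ F⊆E) (∣S∪F∣ S⊆ S≡) (λ rk≡d → rk≢ (∸-rk (trans rk≡d (sym r≡))))) (sym r≡)))
      ; rk-large = λ {S} S⊆ S> → ∸-rk (trans
          (rk-large (∪-⊆ S⊆ F⊆E) (≤-<-trans (≤-reflexive (sym r≡)) (<-≤-trans (+-monoˡ-< (∣ F ∣) S>) (≤-reflexive (sym (∣∪∣-─ {E = E M} S⊆))))))
          (sym r≡))
      }

    contract-free-nonBases : nonBases (contract M F) r ≡ nonBasesAbove M d F
    contract-free-nonBases = begin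
      subsetSum (λ S → when (nonBasis? (contract M F) r S) 1ℤ)
        ≡⟨ subsetSum-cong (λ S → trans
             (when-× (S ⊆? (E M ─ F)) (∣ S ∣ ≟ r ×-dec suc (rk (contract M F) S) ≟ r) 1ℤ)
             (when-cong (S ⊆? (E M ─ F)) (S ⊆? (E M ─ F)) (λ x → x) (λ x → x) (λ S⊆ →
               when-cong (∣ S ∣ ≟ r ×-dec suc (rk (contract M F) S) ≟ r) (sized? (S ∪ F))
                 (λ (S≡ , rk≡) → ∣S∪F∣ S⊆ S≡ , trans (cong suc (rk-∪F S⊆)) (trans (cong (_+ ∣ F ∣) rk≡) r≡))
                 (λ (S≡ , rk≡) → +-cancelʳ-≡ (∣ F ∣) _ _ (trans (sym (∣∪∣-─ {E = E M} S⊆)) (trans S≡ (sym r≡)))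
                               , +-cancelʳ-≡ (∣ F ∣) _ _ (trans (cong suc (sym (rk-∪F S⊆))) (trans rk≡ (sym r≡))))
                 (λ _ → refl)))) ⟩
      subsetSum (λ S → when (S ⊆? (E M ─ F)) (when (sized? (S ∪ F)) 1ℤ))
        ≡⟨ subsetSum-∪ (E M) F F⊆E (λ C → when (sized? C) 1ℤ) ⟩
      subsetSum (λ C → when (F ⊆? C) (when (C ⊆? E M) (when (sized? C) 1ℤ)))
        ≡⟨ subsetSum-cong (λ C → trans
             (cong (when (F ⊆? C)) (sym (when-× (C ⊆? E M) (sized? C) 1ℤ)))
             (when-comm (F ⊆? C) (nonBasis? M d C) 1ℤ)) ⟩
      nonBasesAbove M d F ∎
      where
      open ≡-Reasoning
      sized? : ∀ C → Dec (∣ C ∣ ≡ d × suc (rk M C) ≡ d)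
      sized? C = ∣ C ∣ ≟ d ×-dec suc (rk M C) ≟ d

  contract-circuit : ∀ {C} → NonBasis M d C → IsSparsePaving (contract M C) (pred m) 1
  contract-circuit {C} nb@(C⊆E , C≡d , rk≡) = record
    { card     = trans ∣E─C∣ (trans m≡ (+-comm 1 (pred m)))
    ; rk-E     = spanning (λ x∈ → x∈) (subst (0 <_) (sym ∣E─C∣) 0<m)
    ; rk-small = λ {S} S⊆ S<1 → trans (contract-rk M C⊆E S) (trans
        (m≤n⇒m∸n≡0 (≤-reflexive (cong (rk M) (trans (cong (_∪ C) (∣p∣≡0⇒p≡⊥ (n<1⇒n≡0 S<1))) (∪-identityˡ C)))))
        (sym (n<1⇒n≡0 S<1)))
    ; rk-equal = λ S⊆ S≡1 rk≢1 → contradiction (spanning S⊆ (≤-reflexive (sym S≡1))) rk≢1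
    ; rk-large = λ S⊆ 1<S → spanning S⊆ (<-trans z<s 1<S)
    }
    where
    ∣E─C∣ : ∣ E M ─ C ∣ ≡ m
    ∣E─C∣ = +-cancelʳ-≡ d _ _ (trans (cong (λ x → ∣ E M ─ C ∣ + x) (sym C≡d)) (trans (∣─∣ C⊆E) card))
    0<m : 0 < m
    0<m = +-cancelʳ-< d 0 m (≤-trans (≤-reflexive (cong suc (sym C≡d))) (≤-trans (p⊂q⇒∣p∣<∣q∣ (nonBasis⇒⊂ nb)) (≤-reflexive card)))
    m≡ : m ≡ suc (pred m)
    m≡ = sym (suc-pred m {{>-nonZero 0<m}})
    -- One element added to a circuit-hyperplane already gives more than d elements, hence a
    -- spanning set.
    spanning : ∀ {S} → S ⊆ E M ─ C → 0 < ∣ S ∣ → rk (contract M C) S ≡ 1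
    spanning {S} S⊆ 0<S = trans (contract-rk M C⊆E S) (trans
      (cong (_∸ rk M C) (trans (rk-large (∪-⊆ S⊆ C⊆E)
        (≤-trans (+-monoˡ-≤ d 0<S) (≤-reflexive (trans (cong (λ x → ∣ S ∣ + x) (sym C≡d)) (sym (∣∪∣-─ {E = E M} S⊆)))))) (sym rk≡)))
      (m+n∸n≡m 1 (rk M C)))

  contract-E-rank : rank (contract M (E M)) ≡ 0
  contract-E-rank = trans (contract-rk M (λ x∈ → x∈) (E M ─ E M))
    (m≤n⇒m∸n≡0 (≤-reflexive (cong (rk M) (─-∪-cancel (λ x∈ → x∈)))))

-- Kazhdan–Lusztig polynomials of sparse paving matroids

uniformχ-cong : ∀ m d {f g} → (∀ k → f k ≡ g k) → ∀ k → uniformχ m d f k ≡ uniformχ m d g k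
uniformχ-cong m d f≡g k = binomialSum-cong (m + d) (λ i _ →
  cong₂ (λ x y → sign i ℤ.* (x ℤ.- y)) (shift-cong (d ∸ i) f≡g k) (f≡g k))

uniform-degree′ : ∀ m {d} i → d ≤ 2 * i → uniform m d i ≡ 0ℤ
uniform-degree′ m {zero}  i _    = uniform-0 m i
uniform-degree′ m {suc d} i d≤2i = uniform-degree m {suc d} {i} z<s d≤2i

uniform-rank1 : ∀ m i → uniform m 1 i ≡ δ 0 i
uniform-rank1 m zero    = refl
uniform-rank1 m (suc i) = uniform-degree m {1} {suc i} z<s (s≤s z≤n)

defect-degree : ∀ {d} i → d ≤ 2 * i → defect d i ≡ 0ℤ
defect-degree {d} i d≤2i = cong₂ ℤ._-_ (uniform-degree′ 1 i d≤2i)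
  (uniform-degree′ 1 i (≤-trans pred[n]≤n d≤2i))

upper-half : ∀ {d k} → k ≤ d → 2 * k ≤ d → d ≤ 2 * (d ∸ k)
upper-half {d} {k} k≤d 2k≤d = +-cancelʳ-≤ (2 * k) _ _ (begin
  d + 2 * k           ≤⟨ +-monoʳ-≤ d 2k≤d ⟩
  d + d               ≡⟨ cong (λ x → d + x) (+-identityʳ d) ⟨
  2 * d               ≡⟨ cong (2 *_) (m∸n+n≡m k≤d) ⟨
  2 * ((d ∸ k) + k)   ≡⟨ *-distribˡ-+ 2 (d ∸ k) k ⟩
  2 * (d ∸ k) + 2 * k ∎)
  where open ≤-Reasoning

coeff-1 : ∀ k → coeff [ 1ℤ ] k ≡ δ 0 k
coeff-1 zero    = refl
coeff-1 (suc k) = refl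

module _ (KL : KazhdanLusztig) where
  open KazhdanLusztig KL

  P-degree : (M : Matroid n) → Loopless M → 0 < rank M → ∀ k → rank M ≤ 2 * k → coeff (P M) k ≡ 0ℤ
  P-degree M loopless 0<rk k rk≤2k = decidable-stable (coeff (P M) k ℤ.≟ 0ℤ)
    (λ ≢0 → <⇒≱ (P-deg M loopless 0<rk k ≢0) rk≤2k)

  -- All `m` are included, because contracting a circuit-hyperplane lowers `m` along with the rank.
  HasSparsePavingCoefficients : ℕ → Set
  HasSparsePavingCoefficients d = ∀ {n} {m} (M : Matroid n) → Loopless M → IsSparsePaving M m d →
    ∀ k → coeff (P M) k ≡ uniform m d k ℤ.- nonBases M d ℤ.* defect d k

  -- Above the middle degree the term of the empty flat vanishes, so that the recursion expresses the
  -- upper half of the reversed polynomial in terms of proper contractions.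
  module _ {M : Matroid n} (loopless : Loopless M) (sp : IsSparsePaving M m d) (0<d : 0 < d)
           (rec : ∀ r → 0 < r → r < d → HasSparsePavingCoefficients r)
           (k : ℕ) (d≤2k : d ≤ 2 * k) where
    open IsSparsePaving sp
    open SparsePavingFlats sp
    open SparsePavingMinors sp
    open ≡-Reasoning

    private
      summand : Subset n → ℤ
      summand F = coeff (χ (restrict M F) ⊗ P (contract M F)) k

    summand-⊥ : ∀ {F} → F ⊆ E M → ∣ F ∣ ≡ 0 → IsFlat M F → summand F ≡ 0ℤ
    summand-⊥ {F} F⊆E F≡0 flat = trans
      (coeff-χ-⊗ (restrict M F) (restrict-loopless M F loopless) (P (contract M F)) k)
      (subsetSum-0 (λ G → when-≡0 (isFlat? (restrict M F) G) (λ _ → trans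
        (cong (λ r → möbius (restrict M F) ⊥ G ℤ.* shift (r ∸ rk M G) (coeff (P (contract M F))) k) rank0)
        (trans (cong (λ r → möbius (restrict M F) ⊥ G ℤ.* shift r (coeff (P (contract M F))) k) (0∸n≡0 (rk M G)))
        (trans (cong (λ x → möbius (restrict M F) ⊥ G ℤ.* x) (P-degree (contract M F) (contract-loopless M F flat)
          (subst (0 <_) (sym rank-d) 0<d) k (≤-trans (≤-reflexive rank-d) d≤2k)))
        (ℤ.*-zeroʳ (möbius (restrict M F) ⊥ G)))))))
      where
      rank0 : rank (restrict M F) ≡ 0
      rank0 = trans (cong (rk M) (⊆⇒∩≡ F⊆E)) (trans (rk-small F⊆E (subst (_< d) (sym F≡0) 0<d)) F≡0)
      rank-d : rank (contract M F) ≡ d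
      rank-d = IsSparsePaving.rk-E (contract-free F⊆E (trans (cong (λ x → d + x) F≡0) (+-identityʳ d)) 0<d)

    freeTerm circuitTerm : ℕ → ℤ
    freeTerm j    = Δ^ j (uniform m (d ∸ j)) k
    circuitTerm j = Δ^ j (defect (d ∸ j)) k

    summand-small : ∀ {F} → F ⊆ E M → ∣ F ∣ < d → IsFlat M F →
                    summand F ≡ freeTerm (∣ F ∣) ℤ.- circuitTerm (∣ F ∣) ℤ.* nonBasesAbove M d F
    summand-small {F} F⊆E lt flat = go (∣ F ∣) refl
      where
      go : ∀ j → ∣ F ∣ ≡ j → summand F ≡ freeTerm j ℤ.- circuitTerm j ℤ.* nonBasesAbove M d F
      -- At an index of at least d / 2, the summand of the empty flat and both of its predicted
      -- terms vanish, all for reasons of degree.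
      go zero    F≡ = trans (summand-⊥ F⊆E F≡ flat) (sym (cong₂ (λ x y → x ℤ.- y ℤ.* nonBasesAbove M d F)
        (uniform-degree′ m k d≤2k) (defect-degree k d≤2k)))
      go (suc j) F≡ = begin
        summand F
          ≡⟨ SparsePavingχ.χ-⊗ (restrict-free F⊆E lt) (subst (0 <_) (sym F≡) z<s)
               (restrict-loopless M F loopless) (P (contract M F)) k ⟩
        uniformχ 0 (∣ F ∣) q k ℤ.+ nonBases (restrict M F) (∣ F ∣) ℤ.* (sign (∣ F ∣) ℤ.* Δ q k)
          ≡⟨ cong₂ (λ i x → uniformχ 0 i q k ℤ.+ x ℤ.* (sign (∣ F ∣) ℤ.* Δ q k)) F≡ (restrict-free-nonBases F⊆E lt) ⟩
        uniformχ 0 (suc j) q k ℤ.+ 0ℤ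
          ≡⟨ trans (ℤ.+-identityʳ _) (uniformχ-free j q k) ⟩
        Δ^ (suc j) q k
          ≡⟨ Δ^-cong (suc j) q≡ k ⟩
        Δ^ (suc j) (λ i → uniform m r i ℤ.- nonBasesAbove M d F ℤ.* defect r i) k
          ≡⟨ trans (Δ^-- (suc j) (uniform m r) (λ i → nonBasesAbove M d F ℤ.* defect r i) k)
               (cong (λ x → Δ^ (suc j) (uniform m r) k ℤ.- x) (trans (Δ^-* (suc j) (nonBasesAbove M d F) (defect r) k)
                 (ℤ.*-comm (nonBasesAbove M d F) _))) ⟩
        freeTerm (suc j) ℤ.- circuitTerm (suc j) ℤ.* nonBasesAbove M d F ∎
        where
        q = coeff (P (contract M F))
        r = d ∸ suc j
        lt′ : suc j < d
        lt′ = subst (_< d) F≡ lt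
        r≡ : r + ∣ F ∣ ≡ d
        r≡ = trans (cong (λ x → r + x) F≡) (m∸n+n≡m (<⇒≤ lt′))
        0<r : 0 < r
        0<r = m<n⇒0<n∸m lt′
        q≡ : ∀ i → q i ≡ uniform m r i ℤ.- nonBasesAbove M d F ℤ.* defect r i
        q≡ i = trans
          (rec r 0<r (∸-monoʳ-< z<s (<⇒≤ lt′)) (contract M F) (contract-loopless M F flat) (contract-free F⊆E r≡ 0<r) i)
          (cong (λ x → uniform m r i ℤ.- x ℤ.* defect r i) (contract-free-nonBases F⊆E r≡ 0<r))

    summand-nonBasis : ∀ {C} → NonBasis M d C → summand C ≡ uniformχ 1 (pred d) (δ 0) k
    summand-nonBasis {C} nb@(C⊆E , C≡d , rk≡) = begin
      summand C
        ≡⟨ SparsePavingχ.χ-⊗ (restrict-circuit nb) 0<d-1 (restrict-loopless M C loopless) (P (contract M C)) k ⟩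
      uniformχ 1 (pred d) q k ℤ.+ nonBases (restrict M C) (pred d) ℤ.* (sign (pred d) ℤ.* Δ q k)
        ≡⟨ cong₂ (λ x y → x ℤ.+ y ℤ.* (sign (pred d) ℤ.* Δ q k)) (uniformχ-cong 1 (pred d) q≡ k) (restrict-circuit-nonBases nb) ⟩
      uniformχ 1 (pred d) (δ 0) k ℤ.+ 0ℤ
        ≡⟨ ℤ.+-identityʳ _ ⟩
      uniformχ 1 (pred d) (δ 0) k ∎
      where
      q = coeff (P (contract M C))
      -- In rank one a circuit-hyperplane would consist of a loop.
      1<d : 1 < d
      1<d = ≤∧≢⇒< 0<d (λ { refl → nonBases-loopless M loopless C nb })
      0<d-1 : 0 < pred d
      0<d-1 = ≤-pred (≤-trans 1<d (≤-reflexive (sym (suc-pred d {{>-nonZero 0<d}}))))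
      q≡ : ∀ i → q i ≡ δ 0 i
      q≡ i = begin
        q i
          ≡⟨ rec 1 z<s 1<d (contract M C) loopless′ (contract-circuit nb) i ⟩
        uniform (pred m) 1 i ℤ.- nonBases (contract M C) 1 ℤ.* defect 1 i
          ≡⟨ cong₂ (λ x y → x ℤ.- y ℤ.* defect 1 i) (uniform-rank1 (pred m) i)
               (nonBases-0 (contract M C) 1 (nonBases-loopless (contract M C) loopless′)) ⟩
        δ 0 i ℤ.- 0ℤ
          ≡⟨ ℤ.+-identityʳ (δ 0 i) ⟩
        δ 0 i ∎
        where
        loopless′ : Loopless (contract M C)
        loopless′ = contract-loopless M C (nonBasis-flat nb)

    topTerm : ℤ
    topTerm = uniformχ m d (δ 0) k ℤ.+ nonBases M d ℤ.* (sign d ℤ.* Δ (δ 0) k)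

    summand-E : summand (E M) ≡ topTerm
    summand-E = begin
      summand (E M)
        ≡⟨ SparsePavingχ.χ-⊗ restrict-E 0<d (restrict-loopless M (E M) loopless) (P (contract M (E M))) k ⟩
      uniformχ m d q k ℤ.+ nonBases (restrict M (E M)) d ℤ.* (sign d ℤ.* Δ q k)
        ≡⟨ cong₂ ℤ._+_ (uniformχ-cong m d q≡ k)
             (cong₂ (λ x y → x ℤ.* (sign d ℤ.* y)) restrict-E-nonBases (Δ-cong q≡ k)) ⟩
      topTerm ∎
      where
      q = coeff (P (contract M (E M)))
      q≡ : ∀ i → q i ≡ δ 0 i
      q≡ i = trans (P-rank0 (contract M (E M)) (contract-loopless M (E M) E-flat) contract-E-rank i) (coeff-1 i)

    recursion-sum : coeff (∑ (map (λ F → χ (restrict M F) ⊗ P (contract M F)) (flats M))) k ≡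
      ((uniformΔ m d k ℤ.- nonBases M d ℤ.* binomialSum d circuitTerm) ℤ.+
       uniformχ 1 (pred d) (δ 0) k ℤ.* nonBases M d) ℤ.+ topTerm
    recursion-sum = begin
      coeff (∑ (map (λ F → χ (restrict M F) ⊗ P (contract M F)) (flats M))) k
        ≡⟨ coeff-∑ (map (λ F → χ (restrict M F) ⊗ P (contract M F)) (flats M)) k ⟩
      sumℤ (map (λ p → coeff p k) (map (λ F → χ (restrict M F) ⊗ P (contract M F)) (flats M)))
        ≡⟨ cong sumℤ (List.map-∘ (flats M)) ⟨
      sumℤ (map summand (flats M))
        ≡⟨ sumℤ-filter-subsets (isFlat? M) summand ⟩
      subsetSum (λ F → when (isFlat? M F) (summand F))
        ≡⟨ flatSum summand freeTerm circuitTerm (uniformχ 1 (pred d) (δ 0) k) topTerm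
             summand-small free≡circuit free≡0 circuit≡0 summand-nonBasis summand-E ⟩
      ((uniformΔ m d k ℤ.- nonBases M d ℤ.* binomialSum d circuitTerm) ℤ.+
       uniformχ 1 (pred d) (δ 0) k ℤ.* nonBases M d) ℤ.+ topTerm ∎
      where
      -- A contraction by d - 1 independent elements has rank one, where the uniform polynomial and
      -- the defect are both 1.
      free≡circuit : ∀ {j} → suc j ≡ d → freeTerm j ≡ circuitTerm j
      free≡circuit {j} suc≡ = Δ^-cong j (λ i → trans (cong (λ r → uniform m r i) r≡1) (trans (uniform-rank1 m i)
        (sym (trans (cong (λ r → defect r i) r≡1) (trans (cong₂ ℤ._-_ (uniform-rank1 1 i) (uniform-0 1 i)) (ℤ.+-identityʳ (δ 0 i))))))) k
        where
        r≡1 : d ∸ j ≡ 1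
        r≡1 = trans (cong (_∸ j) (sym suc≡)) (m+n∸n≡m 1 j)
      free≡0 : ∀ {j} → d ≤ j → freeTerm j ≡ 0ℤ
      free≡0 {j} d≤j = Δ^-0 j (λ i → trans (cong (λ r → uniform m r i) (m≤n⇒m∸n≡0 d≤j)) (uniform-0 m i)) k
      circuit≡0 : ∀ {j} → d ≤ j → circuitTerm j ≡ 0ℤ
      circuit≡0 {j} d≤j = Δ^-0 j (λ i → trans (cong (λ r → defect r i) (m≤n⇒m∸n≡0 d≤j))
        (cong₂ ℤ._-_ (uniform-0 1 i) (uniform-0 1 i))) k

  -- Coefficients in the upper half vanish on both sides. A lower one is found at the reflected
  -- index `k′`, where the recursion involves smaller ranks only and is `uniform-reverse` minus λ
  -- times `defect-reverse`.
  sparsePaving-step : ∀ d → (∀ r → 0 < r → r < suc d → HasSparsePavingCoefficients r) → HasSparsePavingCoefficients (suc d)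
  sparsePaving-step d rec {n} {m} M loopless sp k with suc d ≤? 2 * k
  ... | yes d≤2k = trans (P-degree M loopless (subst (0 <_) (sym rk-E) z<s) k (≤-trans (≤-reflexive rk-E) d≤2k))
    (sym (cong₂ ℤ._-_ (uniform-degree′ m k d≤2k) (trans (cong (λ x → nonBases M (suc d) ℤ.* x) (defect-degree k d≤2k)) (ℤ.*-zeroʳ (nonBases M (suc d))))))
    where open IsSparsePaving sp
  ... | no  d≰2k = begin
    coeff (P M) k
      ≡⟨ cong (coeff (P M)) (m∸[m∸n]≡n k≤d) ⟨
    coeff (P M) (suc d ∸ k′)
      ≡⟨ coeff-reflect (suc d) (P M) k′ (m∸n≤m (suc d) k) ⟨
    coeff (reflect (suc d) (P M)) k′
      ≡⟨ cong (λ r → coeff (reflect r (P M)) k′) rk-E ⟨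
    coeff (reflect (rank M) (P M)) k′
      ≡⟨ P-rec M loopless k′ ⟩
    coeff (∑ (map (λ F → χ (restrict M F) ⊗ P (contract M F)) (flats M))) k′
      ≡⟨ recursion-sum loopless sp z<s rec k′ d≤2k′ ⟩
    ((uniformΔ m (suc d) k′ ℤ.- λ′ ℤ.* s) ℤ.+ uniformχ 1 d (δ 0) k′ ℤ.* λ′) ℤ.+
    (uniformχ m (suc d) (δ 0) k′ ℤ.+ λ′ ℤ.* ((ℤ.- sign d) ℤ.* Δ (δ 0) k′))
      ≡⟨ lemma (uniformΔ m (suc d) k′) λ′ s (uniformχ 1 d (δ 0) k′) (uniformχ m (suc d) (δ 0) k′) (sign d) (Δ (δ 0) k′) ⟩
    (uniformΔ m (suc d) k′ ℤ.+ uniformχ m (suc d) (δ 0) k′) ℤ.-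
    λ′ ℤ.* ((s ℤ.- uniformχ 1 d (δ 0) k′) ℤ.+ sign d ℤ.* Δ (δ 0) k′)
      ≡⟨ cong₂ (λ x y → x ℤ.- λ′ ℤ.* y) (uniform-reverse m (suc d) k′) (defect-reverse d k′) ⟨
    reverse (suc d) (uniform m (suc d)) k′ ℤ.- λ′ ℤ.* reverse (suc d) (defect (suc d)) k′
      ≡⟨ cong₂ (λ x y → x ℤ.- λ′ ℤ.* y) (at (uniform m (suc d))) (at (defect (suc d))) ⟩
    uniform m (suc d) k ℤ.- λ′ ℤ.* defect (suc d) k ∎
    where
    open IsSparsePaving sp
    open ≡-Reasoning
    λ′ = nonBases M (suc d)
    k′ = suc d ∸ k
    s = binomialSum (suc d) (λ j → Δ^ j (defect (suc d ∸ j)) k′)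
    k≤d : k ≤ suc d
    k≤d = ≤-trans (m≤m+n k _) (<⇒≤ (≰⇒> d≰2k))
    d≤2k′ : suc d ≤ 2 * k′
    d≤2k′ = upper-half k≤d (<⇒≤ (≰⇒> d≰2k))
    lemma : ∀ u l s c x g y → ((u ℤ.- l ℤ.* s) ℤ.+ c ℤ.* l) ℤ.+ (x ℤ.+ l ℤ.* ((ℤ.- g) ℤ.* y)) ≡
            (u ℤ.+ x) ℤ.- l ℤ.* ((s ℤ.- c) ℤ.+ g ℤ.* y)
    lemma = ℤ-solve
    at : ∀ f → reverse (suc d) f k′ ≡ f k
    at f = trans (reverse-≤ f (m∸n≤m (suc d) k)) (cong f (m∸[m∸n]≡n k≤d))

  sparsePaving-coefficients : ∀ d → 0 < d → HasSparsePavingCoefficients d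
  sparsePaving-coefficients d = go d (<-wellFounded d)
    where
    go : ∀ d → Acc _<_ d → 0 < d → HasSparsePavingCoefficients d
    go (suc d) (acc rs) _ = sparsePaving-step d (λ r 0<r r<d → go r (rs r<d) 0<r)

-- Vanishing of the top coefficient

0<C : ∀ n k → k ≤ n → 0 < n choose k
0<C n       zero    _         = ≤-reflexive (sym (nC0≡1 n))
0<C (suc n) (suc k) (s≤s k≤n) = <-≤-trans (0<C n k k≤n)
  (≤-trans (m≤m+n (n choose k) (n choose suc k)) (≤-reflexive (sym (pascal n k))))

cancel-≤ : ∀ {c x y} → 0 < c → c * x ≤ c * y → x ≤ y
cancel-≤ {c} 0<c = *-cancelˡ-≤ c {{>-nonZero 0<c}}

absorption-right : ∀ k r → suc r * (suc (k + r) choose k) ≡ suc (k + r) * ((k + r) choose k)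
absorption-right k r = begin
  suc r * (suc (k + r) choose k)     ≡⟨ cong (λ n → suc r * (n choose k)) (+-suc k r) ⟨
  suc r * ((k + suc r) choose k)     ≡⟨ falling k (suc r) ⟨
  suc k * ((k + suc r) choose suc k) ≡⟨ cong (λ n → suc k * (n choose suc k)) (+-suc k r) ⟩
  suc k * (suc (k + r) choose suc k) ≡⟨ absorption (k + r) k ⟩
  suc (k + r) * ((k + r) choose k)   ∎
  where open ≡-Reasoning

-- Trinomial revision brings out the factor `n choose k`, which the top coefficient also contains
-- and which can then be cancelled.
choose-bound : ∀ n k j ℓ m → ℓ * m ≤ n choose (k + j) → (ℓ * m) * ((k + j) choose k) ≤ (n choose k) * ((n ∸ k) choose j)
choose-bound n k j ℓ m bound = ≤-trans (*-monoˡ-≤ ((k + j) choose k) bound) (≤-reflexive (trinomial-revision n k j))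

-- The binomial coefficients left in the bounds are rational multiples of `D`. With denominators
-- cleared, `D` cancels and polynomial inequalities in k and m remain.
module Products (k m : ℕ) where
  open ≡-Reasoning

  D a b c : ℕ
  D = (k + m) choose k
  a = suc (k + m)
  b = suc a
  c = suc b

  private
    expand : ∀ {p x y q z} → p * x ≡ y → q * y ≡ z → (q * p) * x ≡ z
    expand {p} {x} {q = q} eq eq′ = trans (*-assoc q p x) (trans (cong (q *_) eq) eq′)

  prod-k : (suc (suc m) * suc m) * (b choose k) ≡ b * (a * D)
  prod-k = begin
    (suc (suc m) * suc m) * (b choose k)
      ≡⟨ rotate (suc (suc m)) (suc m) (b choose k) ⟩
    suc m * (suc (suc m) * (b choose k))
      ≡⟨ cong (λ x → suc m * (suc (suc m) * (suc x choose k))) (+-suc k m) ⟨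
    suc m * (suc (suc m) * (suc (k + suc m) choose k))
      ≡⟨ cong (suc m *_) (absorption-right k (suc m)) ⟩
    suc m * (suc (k + suc m) * ((k + suc m) choose k))
      ≡⟨ cong (λ x → suc m * (suc x * (x choose k))) (+-suc k m) ⟩
    suc m * (b * (a choose k))
      ≡⟨ *-swap (suc m) b (a choose k) ⟩
    b * (suc m * (a choose k))
      ≡⟨ cong (b *_) (absorption-right k m) ⟩
    b * (a * D) ∎
    where
    rotate : ∀ x y z → (x * y) * z ≡ y * (x * z)
    rotate = solve-∀

  prod-k+2 : (suc k * (2 + k)) * (b choose (2 + k)) ≡ b * (a * D)
  prod-k+2 = expand {p = 2 + k} {x = b choose (2 + k)} {q = suc k} (absorption a (suc k))
    (trans (*-swap (suc k) b (a choose suc k)) (cong (b *_) (absorption (k + m) k)))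

  prod-k+1 : ((suc (suc m) * suc m) * suc k) * (c choose suc k) ≡ c * (b * (a * D))
  prod-k+1 = expand {p = suc k} {x = c choose suc k} {q = suc (suc m) * suc m} (absorption b k)
    (trans (*-swap (suc (suc m) * suc m) c (b choose k)) (cong (c *_) prod-k))

  prod-k+3 : ((suc k * (2 + k)) * (3 + k)) * (c choose (3 + k)) ≡ c * (b * (a * D))
  prod-k+3 = expand {p = 3 + k} {x = c choose (3 + k)} {q = suc k * (2 + k)} (absorption b (2 + k))
    (trans (*-swap (suc k * (2 + k)) c (b choose (2 + k))) (cong (c *_) prod-k+2))

  0<D : 0 < D
  0<D = 0<C (k + m) k (m≤m+n k m)

private
  -- For m + 2 and k + 2 in place of m and k the first inequality is (m − 1)(m − k(k + 1)) ≥ 0.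
  odd-inequalities-contradict : ∀ k m → (2 + m) * ((3 + k) * (4 + k)) ≤ (2 + m + (3 + k)) * (2 + m + (2 + k)) →
    ¬ ((4 + k) * ((2 + m) * (3 + m)) ≤ 2 * ((2 + m + (3 + k)) * (2 + m + (2 + k))))
  odd-inequalities-contradict k m small large with 2 + m <? (2 + k) * (3 + k)
  ... | yes lt with m≤n⇒∃[o]m+o≡n lt
  ...   | w , eq = <⇒≱ (begin-strict
    (2 + m + (3 + k)) * (2 + m + (2 + k))
      ≡⟨ expand₁ k m ⟩
    (2 + m) * (2 + m) + (2 + m) * (2 * k + 5) + (2 + k) * (3 + k)
      ≡⟨ cong (λ x → (2 + m) * (2 + m) + (2 + m) * (2 * k + 5) + x) eq ⟨
    (2 + m) * (2 + m) + (2 + m) * (2 * k + 5) + (3 + m + w)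
      <⟨ s≤s (m≤m+n _ (m + w + m * w)) ⟩
    suc ((2 + m) * (2 + m) + (2 + m) * (2 * k + 5) + (3 + m + w) + (m + w + m * w))
      ≡⟨ expand₂ k m w ⟩
    (2 + m) * ((3 + m + w) + 2 * (3 + k))
      ≡⟨ cong (λ x → (2 + m) * (x + 2 * (3 + k))) eq ⟩
    (2 + m) * ((2 + k) * (3 + k) + 2 * (3 + k))
      ≡⟨ expand₃ k m ⟩
    (2 + m) * ((3 + k) * (4 + k)) ∎) small
    where
    open ≤-Reasoning
    expand₁ : ∀ k m → (2 + m + (3 + k)) * (2 + m + (2 + k)) ≡
              (2 + m) * (2 + m) + (2 + m) * (2 * k + 5) + (2 + k) * (3 + k)
    expand₁ = solve-∀
    expand₂ : ∀ k m w → suc ((2 + m) * (2 + m) + (2 + m) * (2 * k + 5) + (3 + m + w) + (m + w + m * w)) ≡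
              (2 + m) * ((3 + m + w) + 2 * (3 + k))
    expand₂ = solve-∀
    expand₃ : ∀ k m → (2 + m) * ((2 + k) * (3 + k) + 2 * (3 + k)) ≡ (2 + m) * ((3 + k) * (4 + k))
    expand₃ = solve-∀
  odd-inequalities-contradict k m small large | no ≮ with m≤n⇒∃[o]m+o≡n (≮⇒≥ ≮)
  ... | w , eq = <⇒≱ (subst (λ x → 2 * ((x + (3 + k)) * (x + (2 + k))) < (4 + k) * (x * (1 + x))) eq
    (≤-trans (s≤s (m≤m+n _ _)) (≤-reflexive (sym (expand k w))))) large
    where
    -- Written in terms of the excess `w` over the threshold, the difference of the two sides has
    -- only positive coefficients.
    expand : ∀ z w → (4 + z) * (((2 + z) * (3 + z) + w) * (1 + ((2 + z) * (3 + z) + w))) ≡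
      suc (2 * ((((2 + z) * (3 + z) + w) + (3 + z)) * (((2 + z) * (3 + z) + w) + (2 + z))) +
      (23 + 18 * w + 2 * w * w + 98 * z + 29 * z * w + 1 * z * w * w + 111 * z * z + 14 * z * z * w + 54 * z * z * z +
       2 * z * z * z * w + 12 * z * z * z * z + 1 * z * z * z * z * z))
    expand = solve-∀

  -- If x ≤ 2k + 1, powers of x with a negative coefficient are lowered by means of x ≤ 2k + 1.
  even-inequalities-contradict : ∀ z x → let k = 1 + z; m = 1 + x; G = suc k * (2 + k) + k * x; Q = (m + k + 2) * ((m + k + 1) * (m + k)) in
    m * (2 * k + 3) * suc k * (3 + k) * G ≤ 2 * k * (2 + k) * Q →
    ¬ (suc k * m * suc m * (3 + k) * G ≤ 2 * k * (2 + k) * Q)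
  even-inequalities-contradict z x small large with x ≤? 2 * (1 + z) + 1
  ... | yes x≤ = <⇒≱ (+-cancelʳ-< (K₂ * x * x) R L (begin-strict
    R + K₂ * x * x
      ≡⟨ cong (_+ K₂ * x * x) (expand₁ z x) ⟩
    R′ + K₁ * x * x * x + K₂ * x * x
      ≤⟨ +-mono-≤ (+-monoʳ-≤ R′ (*-monoʳ-≤ (K₁ * x * x) x≤)) (*-monoʳ-≤ (K₂ * x) x≤) ⟩
    R′ + K₁ * x * x * (2 * (1 + z) + 1) + K₂ * x * (2 * (1 + z) + 1)
      <⟨ s≤s (m≤m+n _ _) ⟩
    suc (R′ + K₁ * x * x * (2 * (1 + z) + 1) + K₂ * x * (2 * (1 + z) + 1) + rest)
      ≡⟨ expand₂ z x ⟨
    L + K₂ * x * x ∎)) small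
    where
    open ≤-Reasoning
    k = 1 + z
    L = (1 + x) * (2 * k + 3) * suc k * (3 + k) * (suc k * (2 + k) + k * x)
    R = 2 * k * (2 + k) * ((1 + x + k + 2) * ((1 + x + k + 1) * (1 + x + k)))
    K₁ = 2 * k * (2 + k)
    -- Once x³ has been lowered to (2k + 1) x², the coefficient of x² in the left side minus the
    -- right side is 2k⁴ + k³ - 16k² - 19k; `K₂` is its negative part.
    K₂ = k * (16 * k + 19)
    R′ = K₁ * (3 * (k + 2) * x * x + (3 * k * k + 12 * k + 11) * x + (k + 1) * (k + 2) * (k + 3))
    rest = 95 + 19 * x + 3 * x * x + 128 * z + 23 * z * x + 11 * z * x * x + 62 * z * z + 71 * z * z * x +
      15 * z * z * x * x + 13 * z * z * z + 70 * z * z * z * x + 9 * z * z * z * x * x + 1 * z * z * z * z +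
      23 * z * z * z * z * x + 2 * z * z * z * z * x * x + 2 * z * z * z * z * z * x
    expand₁ : ∀ z x → 2 * (1 + z) * (2 + (1 + z)) * ((1 + x + (1 + z) + 2) * ((1 + x + (1 + z) + 1) * (1 + x + (1 + z)))) ≡
      2 * (1 + z) * (2 + (1 + z)) * (3 * ((1 + z) + 2) * x * x + (3 * (1 + z) * (1 + z) + 12 * (1 + z) + 11) * x +
      ((1 + z) + 1) * ((1 + z) + 2) * ((1 + z) + 3)) + 2 * (1 + z) * (2 + (1 + z)) * x * x * x
    expand₁ = solve-∀
    expand₂ : ∀ z x → (1 + x) * (2 * (1 + z) + 3) * suc (1 + z) * (3 + (1 + z)) * (suc (1 + z) * (2 + (1 + z)) + (1 + z) * x) +
      (1 + z) * (16 * (1 + z) + 19) * x * x ≡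
      suc (2 * (1 + z) * (2 + (1 + z)) * (3 * ((1 + z) + 2) * x * x + (3 * (1 + z) * (1 + z) + 12 * (1 + z) + 11) * x +
      ((1 + z) + 1) * ((1 + z) + 2) * ((1 + z) + 3)) + 2 * (1 + z) * (2 + (1 + z)) * x * x * (2 * (1 + z) + 1) +
      (1 + z) * (16 * (1 + z) + 19) * x * (2 * (1 + z) + 1) +
      (95 + 19 * x + 3 * x * x + 128 * z + 23 * z * x + 11 * z * x * x + 62 * z * z + 71 * z * z * x +
      15 * z * z * x * x + 13 * z * z * z + 70 * z * z * z * x + 9 * z * z * z * x * x + 1 * z * z * z * z +
      23 * z * z * z * z * x + 2 * z * z * z * z * x * x + 2 * z * z * z * z * z * x))
    expand₂ = solve-∀
  ... | no x≰ with m≤n⇒∃[o]m+o≡n (≰⇒> x≰)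
  ...   | w , eq = <⇒≱ (subst (λ x → R x < L x) eq (≤-trans (s≤s (m≤m+n _ _)) (≤-reflexive (sym (expand z w))))) large
    where
    k = 1 + z
    L R : ℕ → ℕ
    L x = suc k * (1 + x) * suc (1 + x) * (3 + k) * (suc k * (2 + k) + k * x)
    R x = 2 * k * (2 + k) * ((1 + x + k + 2) * ((1 + x + k + 1) * (1 + x + k)))
    expand : ∀ z w → suc (1 + z) * (1 + (suc (2 * (1 + z) + 1) + w)) * suc (1 + (suc (2 * (1 + z) + 1) + w)) * (3 + (1 + z)) *
      (suc (1 + z) * (2 + (1 + z)) + (1 + z) * (suc (2 * (1 + z) + 1) + w)) ≡
      suc (2 * (1 + z) * (2 + (1 + z)) * ((1 + (suc (2 * (1 + z) + 1) + w) + (1 + z) + 2) *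
      ((1 + (suc (2 * (1 + z) + 1) + w) + (1 + z) + 1) * (1 + (suc (2 * (1 + z) + 1) + w) + (1 + z)))) +
      (383 + 244 * w + 42 * w * w + 2 * w * w * w + 884 * z + 620 * z * w + 112 * z * w * w + 6 * z * w * w * w +
      1266 * z * z + 780 * z * z * w + 119 * z * z * w * w + 5 * z * z * w * w * w + 1112 * z * z * z +
      491 * z * z * z * w + 50 * z * z * z * w * w + 1 * z * z * z * w * w * w + 534 * z * z * z * z +
      145 * z * z * z * z * w + 7 * z * z * z * z * w * w + 128 * z * z * z * z * z + 16 * z * z * z * z * z * w +
      12 * z * z * z * z * z * z))
    expand = solve-∀

module _ (k m ℓ : ℕ) where
  open Products k m
  open ≤-Reasoning

  private
    N Y : ℕ
    N = (suc m + (k + suc k)) choose k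
    Y = suc (k + suc k) choose k
    rank≡ : k + (2 + k) ≡ suc (k + suc k)
    rank≡ = +-suc k (suc k)
    remaining : (suc m + (k + suc k)) ∸ k ≡ b
    remaining = trans (cong (_∸ k) (index k m)) (m+n∸m≡n k b)
      where
      index : ∀ k m → suc m + (k + suc k) ≡ k + suc (suc (k + m))
      index = solve-∀
    0<ND : 0 < N * D
    0<ND = *-mono-≤ (0<C _ k (≤-trans (m≤m+n k (suc k)) (m≤n+m (k + suc k) (suc m)))) 0<D

  -- The first hypothesis is the vanishing of the top coefficient. It eliminates ℓ from the bound,
  -- after which `N * D` is a common factor.
  odd-large-bound : N * D ≡ ℓ * Y → ℓ * suc m ≤ (suc m + (k + suc k)) choose suc (k + suc k) →
                    suc m * (suc k * (2 + k)) ≤ b * a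
  odd-large-bound top≡ bound = cancel-≤ 0<ND (begin
    (N * D) * (suc m * (suc k * (2 + k)))
      ≡⟨ cong (_* (suc m * (suc k * (2 + k)))) top≡ ⟩
    (ℓ * Y) * (suc m * (suc k * (2 + k)))
      ≡⟨ regroup ℓ Y (suc m) (suc k * (2 + k)) ⟩
    (suc k * (2 + k)) * ((ℓ * suc m) * Y)
      ≡⟨ cong (λ r → (suc k * (2 + k)) * ((ℓ * suc m) * (r choose k))) rank≡ ⟨
    (suc k * (2 + k)) * ((ℓ * suc m) * ((k + (2 + k)) choose k))
      ≤⟨ *-monoʳ-≤ (suc k * (2 + k)) (choose-bound (suc m + (k + suc k)) k (2 + k) ℓ (suc m)
           (subst (λ r → ℓ * suc m ≤ (suc m + (k + suc k)) choose r) (sym rank≡) bound)) ⟩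
    (suc k * (2 + k)) * (N * (((suc m + (k + suc k)) ∸ k) choose (2 + k)))
      ≡⟨ cong (λ r → (suc k * (2 + k)) * (N * (r choose (2 + k)))) remaining ⟩
    (suc k * (2 + k)) * (N * (b choose (2 + k)))
      ≡⟨ *-swap (suc k * (2 + k)) N (b choose (2 + k)) ⟩
    N * ((suc k * (2 + k)) * (b choose (2 + k)))
      ≡⟨ cong (N *_) prod-k+2 ⟩
    N * (b * (a * D))
      ≡⟨ collect N b a D ⟩
    (N * D) * (b * a) ∎)
    where
    regroup : ∀ l y m q → (l * y) * (m * q) ≡ q * ((l * m) * y)
    regroup = solve-∀
    collect : ∀ n b a d → n * (b * (a * d)) ≡ (n * d) * (b * a)
    collect = solve-∀

  odd-small-bound : N * D ≡ ℓ * Y → ℓ * (k + suc k) ≤ (suc m + (k + suc k)) choose (k + k) →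
                    (2 + k) * (suc m * (2 + m)) ≤ 2 * (b * a)
  odd-small-bound top≡ bound = cancel-≤ 0<ND (begin
    (N * D) * ((2 + k) * (suc m * (2 + m)))
      ≡⟨ cong (_* ((2 + k) * (suc m * (2 + m)))) top≡ ⟩
    (ℓ * Y) * ((2 + k) * (suc m * (2 + m)))
      ≡⟨ regroup ℓ Y (2 + k) (suc m * (2 + m)) ⟩
    (ℓ * ((2 + k) * Y)) * (suc m * (2 + m))
      ≡⟨ cong (λ x → (ℓ * x) * (suc m * (2 + m))) halve ⟩
    (ℓ * (2 * ((k + suc k) * ((k + k) choose k)))) * (suc m * (2 + m))
      ≡⟨ regroup₂ ℓ (k + suc k) ((k + k) choose k) m ⟩
    (2 * (suc (suc m) * suc m)) * ((ℓ * (k + suc k)) * ((k + k) choose k))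
      ≤⟨ *-monoʳ-≤ (2 * (suc (suc m) * suc m)) (choose-bound (suc m + (k + suc k)) k k ℓ (k + suc k) bound) ⟩
    (2 * (suc (suc m) * suc m)) * (N * (((suc m + (k + suc k)) ∸ k) choose k))
      ≡⟨ cong (λ r → (2 * (suc (suc m) * suc m)) * (N * (r choose k))) remaining ⟩
    (2 * (suc (suc m) * suc m)) * (N * (b choose k))
      ≡⟨ regroup₃ (suc (suc m) * suc m) N (b choose k) ⟩
    2 * (N * ((suc (suc m) * suc m) * (b choose k)))
      ≡⟨ cong (λ x → 2 * (N * x)) prod-k ⟩
    2 * (N * (b * (a * D)))
      ≡⟨ collect N b a D ⟩
    (N * D) * (2 * (b * a)) ∎)
    where
    regroup : ∀ l y k q → (l * y) * (k * q) ≡ (l * (k * y)) * q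
    regroup = solve-∀
    regroup₂ : ∀ l r z m → (l * (2 * (r * z))) * (suc m * (2 + m)) ≡ (2 * (suc (suc m) * suc m)) * ((l * r) * z)
    regroup₂ = solve-∀
    regroup₃ : ∀ x y z → (2 * x) * (y * z) ≡ 2 * (y * (x * z))
    regroup₃ = solve-∀
    collect : ∀ n b a d → 2 * (n * (b * (a * d))) ≡ (n * d) * (2 * (b * a))
    collect = solve-∀
    halve : (2 + k) * Y ≡ 2 * ((k + suc k) * ((k + k) choose k))
    halve = ≡.begin
      (2 + k) * Y                                   ≡.≡⟨ absorption-right k (suc k) ⟩
      suc (k + suc k) * ((k + suc k) choose k)            ≡.≡⟨ cong (λ r → suc (k + suc k) * (r choose k)) (+-suc k k) ⟩
      suc (k + suc k) * (suc (k + k) choose k)            ≡.≡⟨ double k (suc (k + k) choose k) ⟩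
      2 * (suc k * (suc (k + k) choose k))               ≡.≡⟨ cong (2 *_) (absorption-right k k) ⟩
      2 * (suc (k + k) * ((k + k) choose k))             ≡.≡⟨ cong (λ r → 2 * (r * ((k + k) choose k))) (+-suc k k) ⟨
      2 * ((k + suc k) * ((k + k) choose k))             ≡.∎
      where
      module ≡ = ≡-Reasoning
      double : ∀ k x → suc (k + suc k) * x ≡ 2 * (suc k * x)
      double = solve-∀

-- Here `suc m` is the corank and k + (k + 1) the rank. For m = 0 the vanishing condition alone
-- forces ℓ = 1; for larger m only rank three escapes the inequalities.
odd-solutions : ∀ k m ℓ → 0 < k →
  ((suc m + (k + suc k)) choose k) * ((k + m) choose k) ≡ ℓ * (suc (k + suc k) choose k) →
  ℓ * (k + suc k) ≤ (suc m + (k + suc k)) choose (k + k) →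
  ℓ * suc m ≤ (suc m + (k + suc k)) choose suc (k + suc k) →
  (m ≡ 0 × ℓ ≡ 1) ⊎ (k ≡ 1 × m ≡ 3 × ℓ ≡ 7)
odd-solutions k zero ℓ 0<k top≡ small large = inj₁ (refl , *-cancelʳ-≡ ℓ 1 Y {{>-nonZero 0<Y}} (begin
  ℓ * Y                  ≡⟨ top≡ ⟨
  Y * ((k + 0) choose k) ≡⟨ cong (λ r → Y * (r choose k)) (+-identityʳ k) ⟩
  Y * (k choose k)       ≡⟨ cong (Y *_) (nCn≡1 k) ⟩
  Y * 1                  ≡⟨ *-comm Y 1 ⟩
  1 * Y                  ∎))
  where
  open ≡-Reasoning
  Y = suc (k + suc k) choose k
  0<Y : 0 < Y
  0<Y = 0<C (suc (k + suc k)) k (m≤n⇒m≤1+n (m≤m+n k (suc k)))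
-- In rank three the condition reads 10, 18 or 28 = 4ℓ for m = 1, 2, 3. The single solution 28 = 4 ·
-- 7 has the parameters of the Fano plane.
odd-solutions 1 1 ℓ _ top≡ small large = ⊥-elim (from-no (4 ℕ.∣? 10) (ℕ.divides ℓ top≡))
odd-solutions 1 2 ℓ _ top≡ small large = ⊥-elim (from-no (4 ℕ.∣? 18) (ℕ.divides ℓ top≡))
odd-solutions 1 3 ℓ _ top≡ small large = inj₂ (refl , refl , sym (*-cancelʳ-≡ 7 ℓ 4 top≡))
odd-solutions 1 (suc (suc (suc (suc m)))) ℓ _ top≡ small large =
  ⊥-elim (<⇒≱ (≤-trans (s≤s (m≤m+n _ _)) (≤-reflexive (sym (expand m)))) (odd-small-bound 1 (4 + m) ℓ top≡ small))
  where
  expand : ∀ t → 3 * (suc (4 + t) * (2 + (4 + t))) ≡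
           suc (2 * (suc (suc (1 + (4 + t))) * suc (1 + (4 + t))) + (5 + 7 * t + t * t))
  expand = solve-∀
odd-solutions (suc (suc k)) (suc m) ℓ _ top≡ small large = ⊥-elim (odd-inequalities-contradict k m
  (≤-trans (odd-large-bound (2 + k) (suc m) ℓ top≡ large) (≤-reflexive (index k m)))
  (≤-trans (odd-small-bound (2 + k) (suc m) ℓ top≡ small) (≤-reflexive (cong (2 *_) (index k m)))))
  where
  index : ∀ k m → suc (suc (2 + k + suc m)) * suc (2 + k + suc m) ≡ (2 + m + (3 + k)) * (2 + m + (2 + k))
  index = solve-∀

module _ (k m ℓ : ℕ) where
  open Products k m
  open ≤-Reasoning

  private
    R N Y G K H H′ : ℕ
    R = suc m + (k + (2 + k))
    N = R choose k
    K = 2 * k * (2 + k)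
    H = (suc k * (2 + k)) * (3 + k)
    H′ = (suc (suc m) * suc m) * suc k
    Y = (k + (2 + k)) choose k
    G = suc k * (2 + k) + k * m
    remaining : (suc m + (k + (2 + k))) ∸ k ≡ c
    remaining = trans (cong (_∸ k) (index k m)) (m+n∸m≡n k c)
      where
      index : ∀ k m → suc m + (k + (2 + k)) ≡ k + suc (suc (suc (k + m)))
      index = solve-∀
    0<ND : 0 < N * D
    0<ND = *-mono-≤ (0<C _ k (≤-trans (m≤m+n k (2 + k)) (m≤n+m (k + (2 + k)) (suc m)))) 0<D

  -- The elimination of ℓ as in odd rank. The factor `K` comes from the defect, which in even rank
  -- is a difference of two nonzero top coefficients when k > 0.
  even-large-bound : (3 + k) * (N * (D * G)) ≡ ((2 * k * (2 + k)) * (2 + k)) * (ℓ * Y) →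
    ℓ * suc m ≤ (suc m + (k + (2 + k))) choose suc (k + (2 + k)) →
    suc m * (2 * k + 3) * suc k * (3 + k) * G ≤ 2 * k * (2 + k) * (c * (b * a))
  even-large-bound top≡ bound = cancel-≤ 0<ND (begin
    (N * D) * (suc m * (2 * k + 3) * suc k * (3 + k) * G)
      ≡⟨ regroup N D (suc m * (2 * k + 3) * suc k) (3 + k) G ⟩
    (suc m * (2 * k + 3) * suc k) * ((3 + k) * (N * (D * G)))
      ≡⟨ cong ((suc m * (2 * k + 3) * suc k) *_) top≡ ⟩
    (suc m * (2 * k + 3) * suc k) * ((K * (2 + k)) * (ℓ * Y))
      ≡⟨ regroup₂ (suc m) k K ℓ Y ⟩
    (K * (suc k * (2 + k))) * ((ℓ * suc m) * (suc (k + (2 + k)) * Y))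
      ≡⟨ cong (λ x → (K * (suc k * (2 + k))) * ((ℓ * suc m) * x)) (absorption-right k (2 + k)) ⟨
    (K * (suc k * (2 + k))) * ((ℓ * suc m) * ((3 + k) * (suc (k + (2 + k)) choose k)))
      ≡⟨ regroup₃ K (suc k * (2 + k)) (ℓ * suc m) (3 + k) _ ⟩
    (K * H) * ((ℓ * suc m) * (suc (k + (2 + k)) choose k))
      ≡⟨ cong (λ r → (K * H) * ((ℓ * suc m) * (r choose k))) (+-suc k (2 + k)) ⟨
    (K * H) * ((ℓ * suc m) * ((k + (3 + k)) choose k))
      ≤⟨ *-monoʳ-≤ (K * H)
           (choose-bound R k (3 + k) ℓ (suc m)
             (subst (λ r → ℓ * suc m ≤ R choose r) (sym (+-suc k (2 + k))) bound)) ⟩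
    (K * H) * (N * ((R ∸ k) choose (3 + k)))
      ≡⟨ cong (λ r → (K * H) * (N * (r choose (3 + k)))) remaining ⟩
    (K * H) * (N * (c choose (3 + k)))
      ≡⟨ regroup₄ K H N (c choose (3 + k)) ⟩
    K * (N * (H * (c choose (3 + k))))
      ≡⟨ cong (λ x → K * (N * x)) prod-k+3 ⟩
    K * (N * (c * (b * (a * D))))
      ≡⟨ collect K N c b a D ⟩
    (N * D) * (2 * k * (2 + k) * (c * (b * a))) ∎)
    where
    regroup : ∀ n d x y g → (n * d) * (x * y * g) ≡ x * (y * (n * (d * g)))
    regroup = solve-∀
    regroup₂ : ∀ m k q l y → (m * (2 * k + 3) * suc k) * ((q * (2 + k)) * (l * y)) ≡
               (q * (suc k * (2 + k))) * ((l * m) * (suc (k + (2 + k)) * y))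
    regroup₂ = solve-∀
    regroup₃ : ∀ q p l x y → (q * p) * (l * (x * y)) ≡ (q * (p * x)) * (l * y)
    regroup₃ = solve-∀
    regroup₄ : ∀ q p n x → (q * p) * (n * x) ≡ q * (n * (p * x))
    regroup₄ = solve-∀
    collect : ∀ q n c b a d → q * (n * (c * (b * (a * d)))) ≡ (n * d) * (q * (c * (b * a)))
    collect = solve-∀

  even-small-bound : (3 + k) * (N * (D * G)) ≡ ((2 * k * (2 + k)) * (2 + k)) * (ℓ * Y) →
    ℓ * (k + (2 + k)) ≤ (suc m + (k + (2 + k))) choose (k + suc k) →
    suc k * suc m * suc (suc m) * (3 + k) * G ≤ 2 * k * (2 + k) * (c * (b * a))
  even-small-bound top≡ bound = cancel-≤ 0<ND (begin
    (N * D) * (suc k * suc m * suc (suc m) * (3 + k) * G)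
      ≡⟨ regroup N D (suc k * suc m * suc (suc m)) (3 + k) G ⟩
    (suc k * suc m * suc (suc m)) * ((3 + k) * (N * (D * G)))
      ≡⟨ cong ((suc k * suc m * suc (suc m)) *_) top≡ ⟩
    (suc k * suc m * suc (suc m)) * ((K * (2 + k)) * (ℓ * Y))
      ≡⟨ regroup₂ (suc k) (suc m) (suc (suc m)) K (2 + k) ℓ Y ⟩
    (K * H′) * (ℓ * ((2 + k) * Y))
      ≡⟨ cong (λ x → (K * H′) * (ℓ * x)) descend ⟩
    (K * H′) * (ℓ * ((k + (2 + k)) * ((k + suc k) choose k)))
      ≡⟨ cong ((K * H′) *_) (*-assoc ℓ (k + (2 + k)) _) ⟨
    (K * H′) * ((ℓ * (k + (2 + k))) * ((k + suc k) choose k))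
      ≤⟨ *-monoʳ-≤ (K * H′)
           (choose-bound R k (suc k) ℓ (k + (2 + k)) bound) ⟩
    (K * H′) * (N * ((R ∸ k) choose suc k))
      ≡⟨ cong (λ r → (K * H′) * (N * (r choose suc k))) remaining ⟩
    (K * H′) * (N * (c choose suc k))
      ≡⟨ regroup₄ K H′ N (c choose suc k) ⟩
    K * (N * (H′ * (c choose suc k)))
      ≡⟨ cong (λ x → K * (N * x)) prod-k+1 ⟩
    K * (N * (c * (b * (a * D))))
      ≡⟨ collect K N c b a D ⟩
    (N * D) * (2 * k * (2 + k) * (c * (b * a))) ∎)
    where
    regroup : ∀ n d x y g → (n * d) * (x * y * g) ≡ x * (y * (n * (d * g)))
    regroup = solve-∀
    regroup₂ : ∀ x y z q p l w → (x * y * z) * ((q * p) * (l * w)) ≡ (q * ((z * y) * x)) * (l * (p * w))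
    regroup₂ = solve-∀
    regroup₄ : ∀ q p n x → (q * p) * (n * x) ≡ q * (n * (p * x))
    regroup₄ = solve-∀
    collect : ∀ q n c b a d → q * (n * (c * (b * (a * d)))) ≡ (n * d) * (q * (c * (b * a)))
    collect = solve-∀
    descend : (2 + k) * Y ≡ (k + (2 + k)) * ((k + suc k) choose k)
    descend = subst (λ r → (2 + k) * (r choose k) ≡ r * ((k + suc k) choose k)) (sym (+-suc k (suc k))) (absorption-right k (suc k))

even-no-solutions : ∀ k m ℓ → 0 < k →
  (3 + k) * (((suc m + (k + (2 + k))) choose k) * (((k + m) choose k) * (suc k * (2 + k) + k * m))) ≡
  ((2 * k * (2 + k)) * (2 + k)) * (ℓ * ((k + (2 + k)) choose k)) →
  ℓ * (k + (2 + k)) ≤ (suc m + (k + (2 + k))) choose (k + suc k) →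
  ¬ (ℓ * suc m ≤ (suc m + (k + (2 + k))) choose suc (k + (2 + k)))
even-no-solutions (suc z) m ℓ _ top≡ small large = even-inequalities-contradict z m
  (≤-trans (even-large-bound (suc z) m ℓ top≡ large) (≤-reflexive (cong (2 * suc z * (3 + z) *_) (index z m))))
  (≤-trans (even-small-bound (suc z) m ℓ top≡ small) (≤-reflexive (cong (2 * suc z * (3 + z) *_) (index z m))))
  where
  index : ∀ z m → suc (suc (suc (1 + z + m))) * (suc (suc (1 + z + m)) * suc (1 + z + m)) ≡
          (1 + m + (1 + z) + 2) * ((1 + m + (1 + z) + 1) * (1 + m + (1 + z)))
  index = solve-∀

-- Rank conditions from the circuit definition of sparse paving

-- A dependent set whose proper subsets are all independent is a circuit, and circuits are too large
-- here.
paving⇒independent : (M : Matroid n) → Paving M → ∀ S → Acc _⊂_ S → S ⊆ E M → ∣ S ∣ < rank M → rk M S ≡ ∣ S ∣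
paving⇒independent M paving S (acc rs) S⊆E lt = decidable-stable (rk M S ≟ ∣ S ∣) λ dependent →
  <⇒≱ lt (paving S (S⊆E , dependent , λ D D⊂S →
    paving⇒independent M paving D (rs D⊂S) (S⊆E ∘ p⊂q⇒p⊆q D⊂S) (<-trans (p⊂q⇒∣p∣<∣q∣ D⊂S) lt)))

sparsePaving⇒ : (M : Matroid n) → SparsePaving M → rank M ≡ d → ∣ E M ∣ ≡ m + d → 0 < d → IsSparsePaving M m d
sparsePaving⇒ {n} {d} {m} M (paving , paving*) rk≡ card≡ 0<d = record
  { card     = card≡
  ; rk-E     = rk≡
  ; rk-small = small
  ; rk-equal = middle
  ; rk-large = large
  }
  where
  small : ∀ {S} → S ⊆ E M → ∣ S ∣ < d → rk M S ≡ ∣ S ∣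
  small {S} S⊆E lt = paving⇒independent M paving S (⊂-wellFounded S) S⊆E (<-≤-trans lt (≤-reflexive (sym rk≡)))

  -- Removing one element leaves an independent set of size d - 1, which bounds the rank from below.
  middle : ∀ {S} → S ⊆ E M → ∣ S ∣ ≡ d → rk M S ≢ d → suc (rk M S) ≡ d
  middle {S} S⊆E S≡d rk≢ with nonempty? S
  ... | no  ¬ne = contradiction (trans (sym S≡d) (trans (cong ∣_∣ (Empty-unique ¬ne)) (∣⊥∣≡0 n))) (<⇒≢ 0<d ∘ sym)
  ... | yes (x , x∈S) = ≤-antisym
    (≤∧≢⇒< (≤-trans (rk-card M S S⊆E) (≤-reflexive S≡d)) rk≢)
    (≤-trans (≤-reflexive (sym size)) (s≤s (≤-trans (≤-reflexive (sym rkR)) (rk-mono M R S (p─q⊆p S ⁅ x ⁆) S⊆E))))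
    where
    R : Subset n
    R = S ─ ⁅ x ⁆
    size : suc ∣ R ∣ ≡ d
    size = trans (+-comm 1 (∣ R ∣)) (trans (cong (λ k → ∣ R ∣ + k) (sym (∣⁅x⁆∣≡1 x)))
      (trans (∣─∣ (λ y∈ → subst (_∈ S) (sym (x∈⁅y⁆⇒x≡y x y∈)) x∈S)) S≡d))
    rkR : rk M R ≡ ∣ R ∣
    rkR = small (S⊆E ∘ p─q⊆p S ⁅ x ⁆) (≤-reflexive size)

  rank* : rank (dual M) ≡ m
  rank* = begin
    (∣ E M ∣ + rk M (E M ─ E M)) ∸ rank M
      ≡⟨ cong₂ (λ x y → (∣ E M ∣ + x) ∸ y) (n≤0⇒n≡0 (≤-trans (rk-card M _ (p─q⊆p (E M) (E M))) (≤-reflexive empty))) rk≡ ⟩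
    (∣ E M ∣ + 0) ∸ d
      ≡⟨ cong (_∸ d) (trans (+-identityʳ (∣ E M ∣)) card≡) ⟩
    (m + d) ∸ d
      ≡⟨ m+n∸n≡m m d ⟩
    m ∎
    where
    open ≡-Reasoning
    empty : ∣ E M ─ E M ∣ ≡ 0
    empty = +-cancelʳ-≡ (∣ E M ∣) _ _ (∣─∣ {E = E M} {E M} (λ x∈ → x∈))

  -- The complement of `T` has fewer than m elements, the rank of the dual, so it is independent
  -- there; this says that `T` spans.
  large : ∀ {T} → T ⊆ E M → d < ∣ T ∣ → rk M T ≡ d
  large {T} T⊆E d<T = sym (+-cancelˡ-≡ (∣ S ∣) _ _ (begin
    ∣ S ∣ + d                             ≡⟨ cong (_+ d) independent* ⟨
    (∣ S ∣ + rk M (E M ─ S)) ∸ rank M + d ≡⟨ cong (λ x → (∣ S ∣ + rk M (E M ─ S)) ∸ x + d) rk≡ ⟩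
    (∣ S ∣ + rk M (E M ─ S)) ∸ d + d      ≡⟨ cong (λ U → (∣ S ∣ + rk M U) ∸ d + d) E─S ⟩
    (∣ S ∣ + rk M T) ∸ d + d              ≡⟨ m∸n+n≡m above ⟩
    ∣ S ∣ + rk M T                        ∎))
    where
    open ≡-Reasoning
    S : Subset n
    S = E M ─ T
    S⊆E : S ⊆ E M
    S⊆E = p─q⊆p (E M) T
    sizes : ∣ S ∣ + ∣ T ∣ ≡ m + d
    sizes = trans (∣─∣ T⊆E) card≡
    S<m : ∣ S ∣ < m
    S<m = +-cancelʳ-< d (∣ S ∣) m (≤-trans (+-monoʳ-< (∣ S ∣) d<T) (≤-reflexive sizes))
    E─S : E M ─ S ≡ T
    E─S = ⊆-antisym
      (λ {x} x∈ → decidable-stable (x ∈? T) (λ x∉T → ─-∈⁻ (E M) S x∈ (x∈p∧x∉q⇒x∈p─q (p─q⊆p (E M) S x∈) x∉T)))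
      (λ x∈T → x∈p∧x∉q⇒x∈p─q (T⊆E x∈T) (λ x∈S → ─-∈⁻ (E M) T x∈S x∈T))
    independent* : (∣ S ∣ + rk M (E M ─ S)) ∸ rank M ≡ ∣ S ∣
    independent* = paving⇒independent (dual M) paving* S (⊂-wellFounded S) S⊆E (<-≤-trans S<m (≤-reflexive (sym rank*)))
    above : d ≤ ∣ S ∣ + rk M T
    above = ≤-trans (≤-reflexive (trans (sym rk≡) (cong (rk M) (sym (─-∪-cancel T⊆E)))))
      (≤-trans (rk-∪ M S T S⊆E T⊆E) (+-monoˡ-≤ (rk M T) (rk-card M S S⊆E)))

-- Counting circuit-hyperplanes

binomialSum-indicator : ∀ n k → binomialSum n (λ i → when (i ≟ k) 1ℤ) ≡ + (n choose k)
binomialSum-indicator zero    zero    = refl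
binomialSum-indicator zero    (suc k) = cong +_ (sym (k>n⇒nCk≡0 {0} {suc k} z<s))
binomialSum-indicator (suc n) zero    = trans
  (cong₂ ℤ._+_ (binomialSum-0 n (λ i _ → refl)) (binomialSum-indicator n zero))
  (cong +_ (trans (nC0≡1 n) (sym (nC0≡1 (suc n)))))
binomialSum-indicator (suc n) (suc k) = trans
  (cong₂ ℤ._+_ (binomialSum-indicator n k) (binomialSum-indicator n (suc k)))
  (cong +_ (sym (pascal n k)))

subsetSum-unique : {P : Subset n → Set} (P? : Decidable P) → (∀ {C C′} → P C → P C′ → C ≡ C′) →
                   subsetSum (λ C → when (P? C) 1ℤ) ℤ.≤ 1ℤ
subsetSum-unique P? unique with anySubset? P?
... | yes (C , p) = ℤ.≤-reflexive (trans
  (subsetSum-single C (λ C′ C′≢C → when-no (P? C′) (λ p′ → C′≢C (unique p′ p)) 1ℤ))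
  (when-yes (P? C) p 1ℤ))
... | no  none    = ℤ.≤-trans (ℤ.≤-reflexive (subsetSum-0 (λ C → when-no (P? C) (λ p → none (C , p)) 1ℤ))) (ℤ.+≤+ z≤n)

module CircuitHyperplanes {M : Matroid n} (sp : IsSparsePaving M m d) where
  open IsSparsePaving sp
  open SparsePavingFlats sp

  -- Dependence excludes fewer than d elements, and rank d - 1 excludes more than d.
  circuitHyperplane⇒ : ∀ {S} → IsCircuitHyperplane M S → NonBasis M d S
  circuitHyperplane⇒ {S} ((S⊆E , dependent , _) , (_ , hyper)) = S⊆E , ≤-antisym S≤d d≤S , trans hyper rk-E
    where
    d≤S : d ≤ ∣ S ∣
    d≤S = ≮⇒≥ (λ lt → dependent (rk-small S⊆E lt))
    S≤d : ∣ S ∣ ≤ d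
    S≤d = ≮⇒≥ (λ lt → 1+n≢n (trans hyper (trans rk-E (sym (rk-large S⊆E lt)))))

  ⇒circuitHyperplane : ∀ {S} → NonBasis M d S → IsCircuitHyperplane M S
  ⇒circuitHyperplane {S} nb@(S⊆E , S≡d , rk≡) =
    (S⊆E , (λ ind → 1+n≢n (trans rk≡ (trans (sym S≡d) (sym ind)))) , λ D D⊂S →
      rk-small (S⊆E ∘ p⊂q⇒p⊆q D⊂S) (<-≤-trans (p⊂q⇒∣p∣<∣q∣ D⊂S) (≤-reflexive S≡d))) ,
    (nonBasis-flat nb , trans rk≡ (sym rk-E))

module SparsePavingBounds {M : Matroid n} (sp : IsSparsePaving M m d) (0<d : 0 < d) (ℓ : ℕ) (nonBases≡ : nonBases M d ≡ + ℓ) where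
  open IsSparsePaving sp
  open SparsePavingFlats sp

  -- Counts pairs of a circuit-hyperplane and one of its d subsets of size d - 1, each of which
  -- occurs at most once by `size-d-1`.
  small-bound : ℓ * d ≤ (m + d) choose pred d
  small-bound = ℤ.drop‿+≤+ (begin
    + (ℓ * d)
      ≡⟨ ℤ.pos-* ℓ d ⟩
    + ℓ ℤ.* + d
      ≡⟨ cong₂ ℤ._*_ (sym nonBases≡) (trans (cong +_ (sym (choose-pred d 0<d))) (sym (binomialSum-indicator d (pred d)))) ⟩
    nonBases M d ℤ.* binomialSum d (λ i → when (i ≟ pred d) 1ℤ)
      ≡⟨ nonBases-⊆ M d (λ i → when (i ≟ pred d) 1ℤ) ⟨
    subsetSum (λ F → subsetSum (λ C → when (nonBasis? M d C) (when (F ⊆? C) (when (∣ F ∣ ≟ pred d) 1ℤ))))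
      ≤⟨ subsetSum-mono pointwise ⟩
    subsetSum (λ F → when (F ⊆? E M) (when (∣ F ∣ ≟ pred d) 1ℤ))
      ≡⟨ subsetSum-⊆ (E M) (λ i → when (i ≟ pred d) 1ℤ) ⟩
    binomialSum (∣ E M ∣) (λ i → when (i ≟ pred d) 1ℤ)
      ≡⟨ trans (binomialSum-indicator (∣ E M ∣) (pred d)) (cong (λ x → + (x choose pred d)) card) ⟩
    + ((m + d) choose pred d) ∎)
    where
    open ℤ.≤-Reasoning
    choose-pred : ∀ d → 0 < d → d choose pred d ≡ d
    choose-pred (suc d) _ = trans (nCk≡nC[n∸k] {d} {suc d} (n≤1+n d)) (trans (cong (suc d choose_) (m+n∸n≡m 1 d)) (nC1≡n (suc d)))
    pointwise : ∀ F → subsetSum (λ C → when (nonBasis? M d C) (when (F ⊆? C) (when (∣ F ∣ ≟ pred d) 1ℤ))) ℤ.≤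
                when (F ⊆? E M) (when (∣ F ∣ ≟ pred d) 1ℤ)
    pointwise F = helper (F ⊆? E M) (∣ F ∣ ≟ pred d)
      where
      lhs = subsetSum (λ C → when (nonBasis? M d C) (when (F ⊆? C) (when (∣ F ∣ ≟ pred d) 1ℤ)))
      helper : Dec (F ⊆ E M) → Dec (∣ F ∣ ≡ pred d) → lhs ℤ.≤ when (F ⊆? E M) (when (∣ F ∣ ≟ pred d) 1ℤ)
      helper (no F⊈E) _ = ℤ.≤-reflexive (trans
        (subsetSum-0 (λ C → when-≡0 (nonBasis? M d C) (λ (C⊆E , _) → when-no (F ⊆? C) (λ F⊆C → F⊈E (C⊆E ∘ F⊆C)) _)))
        (sym (when-no (F ⊆? E M) F⊈E _)))
      helper (yes F⊆E) (no F≢) = ℤ.≤-reflexive (trans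
        (subsetSum-0 (λ C → when-≡0 (nonBasis? M d C) (λ _ → when-≡0 (F ⊆? C) (λ _ → when-no (∣ F ∣ ≟ pred d) F≢ 1ℤ))))
        (sym (when-≡0 (F ⊆? E M) (λ _ → when-no (∣ F ∣ ≟ pred d) F≢ 1ℤ))))
      helper (yes F⊆E) (yes F≡) = ℤ.≤-trans (ℤ.≤-reflexive (subsetSum-cong (λ C →
          cong (λ x → when (nonBasis? M d C) (when (F ⊆? C) x)) (when-yes (∣ F ∣ ≟ pred d) F≡ 1ℤ))))
        (ℤ.≤-trans (at-most-one (size-d-1 F⊆E (trans (cong suc F≡) (suc-pred d {{>-nonZero 0<d}}))))
          (ℤ.≤-reflexive (sym (trans (when-yes (F ⊆? E M) F⊆E _) (when-yes (∣ F ∣ ≟ pred d) F≡ 1ℤ)))))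
        where
        at-most-one : (IsFlat M F × nonBasesAbove M d F ≡ 0ℤ) ⊎ (¬ IsFlat M F × nonBasesAbove M d F ≡ 1ℤ) →
                      nonBasesAbove M d F ℤ.≤ 1ℤ
        at-most-one (inj₁ (_ , above≡0)) = ℤ.≤-trans (ℤ.≤-reflexive above≡0) (ℤ.+≤+ z≤n)
        at-most-one (inj₂ (_ , above≡1)) = ℤ.≤-reflexive above≡1

  -- Two d-subsets of a set of size d + 1 share at least d - 1 elements. Thus uniqueness from below
  -- reduces to `nonBasis-unique`, without passing to the dual.
  nonBasis-unique-below : ∀ {T C C′} → ∣ T ∣ ≡ suc d → NonBasis M d C → NonBasis M d C′ → C ⊆ T → C′ ⊆ T → C ≡ C′
  nonBasis-unique-below {T} {C} {C′} T≡ nb@(_ , C≡d , _) nb′@(_ , C′≡d , _) C⊆T C′⊆T with ∣ C ∩ C′ ∣ <? d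
  ... | no  ≮ = trans (sym (eq (p∩q⊆p C C′) C≡d)) (eq (p∩q⊆q C C′) C′≡d)
    where
    eq : ∀ {X} → C ∩ C′ ⊆ X → ∣ X ∣ ≡ d → C ∩ C′ ≡ X
    eq ⊆X X≡ = ⊆∧∣≥∣⇒≡ ⊆X (≤-trans (≤-reflexive X≡) (≮⇒≥ ≮))
  ... | yes lt = nonBasis-unique (≤-antisym lt d≤) nb nb′ (p∩q⊆p C C′) (p∩q⊆q C C′)
    where
    open ≤-Reasoning
    d≤ : d ≤ suc ∣ C ∩ C′ ∣
    d≤ = +-cancelˡ-≤ d _ _ (begin
      d + d                       ≡⟨ cong₂ _+_ C≡d C′≡d ⟨
      (∣ C ∣) + (∣ C′ ∣)          ≡⟨ ∣∪∣+∣∩∣ C C′ ⟨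
      (∣ C ∪ C′ ∣) + (∣ C ∩ C′ ∣) ≤⟨ +-monoˡ-≤ (∣ C ∩ C′ ∣) (p⊆q⇒∣p∣≤∣q∣ (∪-least C⊆T C′⊆T)) ⟩
      (∣ T ∣) + (∣ C ∩ C′ ∣)      ≡⟨ cong (λ x → x + (∣ C ∩ C′ ∣)) T≡ ⟩
      suc d + (∣ C ∩ C′ ∣)        ≡⟨ +-suc d (∣ C ∩ C′ ∣) ⟨
      d + suc (∣ C ∩ C′ ∣)        ∎)

  -- Counts pairs of a circuit-hyperplane and one of its m supersets of size d + 1.
  large-bound : ℓ * m ≤ (m + d) choose suc d
  large-bound = ℤ.drop‿+≤+ (begin
    + (ℓ * m)
      ≡⟨ trans (ℤ.pos-* ℓ m) (trans (cong (ℤ._* + m) (sym nonBases≡)) (ℤ.*-comm (nonBases M d) (+ m))) ⟩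
    + m ℤ.* nonBases M d
      ≡⟨ subsetSum-* {n} (+ m) _ ⟨
    subsetSum (λ C → + m ℤ.* when (nonBasis? M d C) 1ℤ)
      ≡⟨ subsetSum-cong (λ C → trans (sym (when-* (nonBasis? M d C) (+ m) 1ℤ))
           (when-cong (nonBasis? M d C) (nonBasis? M d C) (λ x → x) (λ x → x) (λ nb → trans (ℤ.*-identityʳ (+ m)) (sym (supersets nb))))) ⟩
    subsetSum (λ C → when (nonBasis? M d C) (subsetSum (λ T → when (C ⊆? T) (when (T ⊆? E M) (w (∣ T ∣))))))
      ≡⟨ subsetSum-cong (λ C → sym (subsetSum-when {n = n} (nonBasis? M d C) _)) ⟩
    subsetSum (λ C → subsetSum (λ T → when (nonBasis? M d C) (when (C ⊆? T) (when (T ⊆? E M) (w (∣ T ∣))))))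
      ≡⟨ subsetSum-swap {n} {n} _ ⟩
    subsetSum (λ T → subsetSum (λ C → when (nonBasis? M d C) (when (C ⊆? T) (when (T ⊆? E M) (w (∣ T ∣))))))
      ≤⟨ subsetSum-mono pointwise ⟩
    subsetSum (λ T → when (T ⊆? E M) (w (∣ T ∣)))
      ≡⟨ subsetSum-⊆ (E M) w ⟩
    binomialSum (∣ E M ∣) w
      ≡⟨ trans (binomialSum-indicator (∣ E M ∣) (suc d)) (cong (λ x → + (x choose suc d)) card) ⟩
    + ((m + d) choose suc d) ∎)
    where
    open ℤ.≤-Reasoning
    w : ℕ → ℤ
    w i = when (i ≟ suc d) 1ℤ
    supersets : ∀ {C} → NonBasis M d C → subsetSum (λ T → when (C ⊆? T) (when (T ⊆? E M) (w (∣ T ∣)))) ≡ + m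
    supersets {C} (C⊆E , C≡d , _) = ≡.begin
      subsetSum (λ T → when (C ⊆? T) (when (T ⊆? E M) (w (∣ T ∣))))
        ≡.≡⟨ subsetSum-∪ (E M) C C⊆E (λ T → w (∣ T ∣)) ⟨
      subsetSum (λ S → when (S ⊆? (E M ─ C)) (w (∣ S ∪ C ∣)))
        ≡.≡⟨ subsetSum-cong (λ S → when-cong (S ⊆? (E M ─ C)) (S ⊆? (E M ─ C)) (λ x → x) (λ x → x) (λ S⊆ →
             when-cong (∣ S ∪ C ∣ ≟ suc d) (∣ S ∣ ≟ 1)
               (λ eq → +-cancelʳ-≡ d _ _ (trans (sym (size S⊆)) eq))
               (λ eq → trans (size S⊆) (cong (_+ d) eq)) (λ _ → refl))) ⟩
      subsetSum (λ S → when (S ⊆? (E M ─ C)) (when (∣ S ∣ ≟ 1) 1ℤ))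
        ≡.≡⟨ subsetSum-⊆ (E M ─ C) (λ i → when (i ≟ 1) 1ℤ) ⟩
      binomialSum (∣ E M ─ C ∣) (λ i → when (i ≟ 1) 1ℤ)
        ≡.≡⟨ trans (binomialSum-indicator (∣ E M ─ C ∣) 1) (cong +_ (trans (nC1≡n (∣ E M ─ C ∣)) remaining)) ⟩
      + m ≡.∎
      where
      module ≡ = ≡-Reasoning
      size : ∀ {S} → S ⊆ E M ─ C → ∣ S ∪ C ∣ ≡ ∣ S ∣ + d
      size {S} S⊆ = trans (∣∪∣-─ {E = E M} S⊆) (cong (λ x → ∣ S ∣ + x) C≡d)
      remaining : ∣ E M ─ C ∣ ≡ m
      remaining = +-cancelʳ-≡ d _ _ (trans (cong (λ x → ∣ E M ─ C ∣ + x) (sym C≡d)) (trans (∣─∣ C⊆E) card))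
    pointwise : ∀ T → subsetSum (λ C → when (nonBasis? M d C) (when (C ⊆? T) (when (T ⊆? E M) (w (∣ T ∣))))) ℤ.≤
                when (T ⊆? E M) (w (∣ T ∣))
    pointwise T = helper (∣ T ∣ ≟ suc d) (T ⊆? E M)
      where
      lhs = subsetSum (λ C → when (nonBasis? M d C) (when (C ⊆? T) (when (T ⊆? E M) (w (∣ T ∣)))))
      vanishing : when (T ⊆? E M) (w (∣ T ∣)) ≡ 0ℤ → lhs ℤ.≤ when (T ⊆? E M) (w (∣ T ∣))
      vanishing eq = ℤ.≤-reflexive (trans
        (subsetSum-0 (λ C → when-≡0 (nonBasis? M d C) (λ _ → when-≡0 (C ⊆? T) (λ _ → eq)))) (sym eq))
      helper : Dec (∣ T ∣ ≡ suc d) → Dec (T ⊆ E M) → lhs ℤ.≤ when (T ⊆? E M) (w (∣ T ∣))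
      helper (no T≢) _        = vanishing (when-≡0 (T ⊆? E M) (λ _ → when-no (∣ T ∣ ≟ suc d) T≢ 1ℤ))
      helper _ (no T⊈E)      = vanishing (when-no (T ⊆? E M) T⊈E _)
      helper (yes T≡) (yes T⊆E) = ℤ.≤-trans
        (ℤ.≤-reflexive (subsetSum-cong (λ C → trans
          (cong (λ x → when (nonBasis? M d C) (when (C ⊆? T) x)) one)
          (sym (when-× (nonBasis? M d C) (C ⊆? T) 1ℤ)))))
        (ℤ.≤-trans (subsetSum-unique (λ C → nonBasis? M d C ×-dec C ⊆? T)
          (λ (nb , C⊆T) (nb′ , C′⊆T) → nonBasis-unique-below T≡ nb nb′ C⊆T C′⊆T)) (ℤ.≤-reflexive (sym one)))
        where
        one : when (T ⊆? E M) (w (∣ T ∣)) ≡ 1ℤ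
        one = trans (when-yes (T ⊆? E M) T⊆E _) (when-yes (∣ T ∣ ≟ suc d) T≡ 1ℤ)

nonBases-length : (M : Matroid n) → IsSparsePaving M m d → + length (circuitHyperplanes M) ≡ nonBases M d
nonBases-length {n} {d = d} M sp = begin
  + length (circuitHyperplanes M)
    ≡⟨ sumℤ-length (circuitHyperplanes M) ⟨
  sumℤ (map (λ _ → 1ℤ) (circuitHyperplanes M))
    ≡⟨ sumℤ-filter-subsets (isCircuitHyperplane? M) (λ _ → 1ℤ) ⟩
  subsetSum (λ S → when (isCircuitHyperplane? M S) 1ℤ)
    ≡⟨ subsetSum-cong (λ S → when-cong (isCircuitHyperplane? M S) (nonBasis? M d S)
         circuitHyperplane⇒ ⇒circuitHyperplane (λ _ → refl)) ⟩
  nonBases M d ∎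
  where
  open ≡-Reasoning
  open CircuitHyperplanes sp

-- The top coefficient by parity of the rank, and the classification

-- `k` is the largest degree allowed, ⌊(d - 1)/2⌋. The rank is split as `i + e`, the shape in which
-- the closed form is stated.
odd-or-even : ∀ d → 0 < d → ∃ λ k → d ≡ k + suc k ⊎ d ≡ k + (2 + k)
odd-or-even 1             _ = 0 , inj₁ refl
odd-or-even 2             _ = 0 , inj₂ refl
odd-or-even (suc (suc (suc d))) _ with odd-or-even (suc d) z<s
... | k , inj₁ eq = suc k , inj₁ (cong suc (trans (cong suc eq) (sym (+-suc k (suc k)))))
... | k , inj₂ eq = suc k , inj₂ (cong suc (trans (cong suc eq) (sym (+-suc k (2 + k)))))

scaled-zero : ∀ s c x y → + suc s ℤ.* c ≡ + x ℤ.- + y → (c ≡ 0ℤ → x ≡ y) × (x ≡ y → c ≡ 0ℤ)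
scaled-zero s c x y eq =
  (λ { refl → ℤ.+-injective (ℤ.i-j≡0⇒i≡j (+ x) (+ y) (trans (sym eq) (ℤ.*-zeroʳ (+ suc s)))) }) ,
  (λ { refl → ℤ.*-cancelˡ-≡ (+ suc s) c 0ℤ (trans eq (trans (ℤ.+-inverseʳ (+ x)) (sym (ℤ.*-zeroʳ (+ suc s))))) })

topCoefficient : (m d ℓ k : ℕ) → ℤ
topCoefficient m d ℓ k = uniform m d k ℤ.- + ℓ ℤ.* defect d k

top-odd : ∀ m k ℓ →
  let X = ((suc m + (k + suc k)) choose k) * ((k + m) choose k); Y = suc (k + suc k) choose k in
  (topCoefficient (suc m) (k + suc k) ℓ k ≡ 0ℤ → X ≡ ℓ * Y) × (X ≡ ℓ * Y → topCoefficient (suc m) (k + suc k) ℓ k ≡ 0ℤ)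
top-odd m k ℓ = scaled-zero k _ _ _ (begin
  + suc k ℤ.* (u ℤ.- + ℓ ℤ.* defect (k + suc k) k)
    ≡⟨ distribute (+ suc k) u (+ ℓ) (defect (k + suc k) k) ⟩
  + suc k ℤ.* u ℤ.- + ℓ ℤ.* (+ suc k ℤ.* defect (k + suc k) k)
    ≡⟨ cong₂ (λ x y → x ℤ.- + ℓ ℤ.* y) (uniform-top-odd m k) scaled-defect ⟩
  + X ℤ.- + ℓ ℤ.* + Y
    ≡⟨ cong (λ y → + X ℤ.- y) (ℤ.pos-* ℓ Y) ⟨
  + X ℤ.- + (ℓ * Y) ∎)
  where
  open ≡-Reasoning
  X = ((suc m + (k + suc k)) choose k) * ((k + m) choose k)
  Y = suc (k + suc k) choose k
  u = uniform (suc m) (k + suc k) k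
  distribute : ∀ s u l v → s ℤ.* (u ℤ.- l ℤ.* v) ≡ s ℤ.* u ℤ.- l ℤ.* (s ℤ.* v)
  distribute = ℤ-solve
  scaled-defect : + suc k ℤ.* defect (k + suc k) k ≡ + Y
  scaled-defect = begin
    + suc k ℤ.* (uniform 1 (k + suc k) k ℤ.- uniform 1 (pred (k + suc k)) k)
      -- The second part of the defect has rank 2k and therefore degree below k.
      ≡⟨ cong (λ x → + suc k ℤ.* (uniform 1 (k + suc k) k ℤ.- x)) (uniform-degree′ 1 k
           (≤-reflexive (trans (cong pred (+-suc k k)) (cong (λ x → k + x) (sym (+-identityʳ k)))))) ⟩
    + suc k ℤ.* (uniform 1 (k + suc k) k ℤ.- 0ℤ)
      ≡⟨ cong (λ x → + suc k ℤ.* x) (ℤ.+-identityʳ (uniform 1 (k + suc k) k)) ⟩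
    + suc k ℤ.* uniform 1 (k + suc k) k
      ≡⟨ uniform-top-odd 0 k ⟩
    + (Y * ((k + 0) choose k))
      ≡⟨ cong (λ x → + (Y * x)) (trans (cong (_choose k) (+-identityʳ k)) (nCn≡1 k)) ⟩
    + (Y * 1)
      ≡⟨ cong +_ (*-identityʳ Y) ⟩
    + Y ∎

-- With Y = C(2k + 2, k), the two parts v and w of the defect satisfy (k + 3) v = (2k + 3) Y and (k
-- + 1) w = Y. The factor 2k(k + 2) is (k + 1)(2k + 3) - (k + 3); the further k + 2 clears the
-- denominator of the uniform coefficient.
top-even : ∀ m k ℓ → topCoefficient (suc m) (k + (2 + k)) ℓ k ≡ 0ℤ →
  (3 + k) * (((suc m + (k + (2 + k))) choose k) * (((k + m) choose k) * (suc k * (2 + k) + k * m))) ≡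
  ((2 * k * (2 + k)) * (2 + k)) * (ℓ * ((k + (2 + k)) choose k))
top-even m k ℓ top≡0 = ℤ.+-injective (begin
  + ((3 + k) * X)
    ≡⟨ ℤ.pos-* (3 + k) X ⟩
  + (3 + k) ℤ.* + X
    ≡⟨ cong (λ x → + (3 + k) ℤ.* x) (trans (cong (ℤ._* u) (sym (ℤ.pos-* (suc k) (2 + k)))) (uniform-top-even m k)) ⟨
  + (3 + k) ℤ.* ((+ suc k ℤ.* + (2 + k)) ℤ.* u)
    ≡⟨ cong (λ x → + (3 + k) ℤ.* ((+ suc k ℤ.* + (2 + k)) ℤ.* x)) (ℤ.i-j≡0⇒i≡j u (+ ℓ ℤ.* (v ℤ.- w)) top≡) ⟩
  + (3 + k) ℤ.* ((+ suc k ℤ.* + (2 + k)) ℤ.* (+ ℓ ℤ.* (v ℤ.- w)))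
    ≡⟨ regroup (+ suc k) (+ (2 + k)) (+ (3 + k)) (+ ℓ) v w ⟩
  + ℓ ℤ.* ((+ suc k ℤ.* + (2 + k)) ℤ.* (+ (3 + k) ℤ.* v) ℤ.- (+ (3 + k) ℤ.* + (2 + k)) ℤ.* (+ suc k ℤ.* w))
    ≡⟨ cong₂ (λ x y → + ℓ ℤ.* ((+ suc k ℤ.* + (2 + k)) ℤ.* x ℤ.- (+ (3 + k) ℤ.* + (2 + k)) ℤ.* y)) scaled-v scaled-w ⟩
  + ℓ ℤ.* ((+ suc k ℤ.* + (2 + k)) ℤ.* ((+ 3 ℤ.+ + 2 ℤ.* + k) ℤ.* + Y) ℤ.- (+ (3 + k) ℤ.* + (2 + k)) ℤ.* + Y)
    ≡⟨ simplify (+ k) (+ ℓ) (+ Y) ⟩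
  ((+ 2 ℤ.* + k ℤ.* + (2 + k)) ℤ.* + (2 + k)) ℤ.* (+ ℓ ℤ.* + Y)
    ≡⟨ cong₂ ℤ._*_ (trans (cong (λ x → (x ℤ.* + (2 + k)) ℤ.* + (2 + k)) (sym (ℤ.pos-* 2 k)))
         (trans (cong (ℤ._* + (2 + k)) (sym (ℤ.pos-* (2 * k) (2 + k)))) (sym (ℤ.pos-* (2 * k * (2 + k)) (2 + k)))))
         (sym (ℤ.pos-* ℓ Y)) ⟩
  + ((2 * k * (2 + k)) * (2 + k)) ℤ.* + (ℓ * Y)
    ≡⟨ ℤ.pos-* ((2 * k * (2 + k)) * (2 + k)) (ℓ * Y) ⟨
  + (((2 * k * (2 + k)) * (2 + k)) * (ℓ * Y)) ∎)
  where
  open ≡-Reasoning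
  X = ((suc m + (k + (2 + k))) choose k) * (((k + m) choose k) * (suc k * (2 + k) + k * m))
  Y = (k + (2 + k)) choose k
  u v w : ℤ
  u = uniform (suc m) (k + (2 + k)) k
  v = uniform 1 (k + (2 + k)) k
  w = uniform 1 (k + suc k) k

  top≡ : u ℤ.- + ℓ ℤ.* (v ℤ.- w) ≡ 0ℤ
  top≡ = trans (cong (λ r → u ℤ.- + ℓ ℤ.* (v ℤ.- uniform 1 r k)) (sym (cong pred (+-suc k (suc k))))) top≡0

  regroup : ∀ a b c l v w → c ℤ.* ((a ℤ.* b) ℤ.* (l ℤ.* (v ℤ.- w))) ≡
            l ℤ.* ((a ℤ.* b) ℤ.* (c ℤ.* v) ℤ.- (c ℤ.* b) ℤ.* (a ℤ.* w))
  regroup = ℤ-solve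
  simplify : ∀ K L Y → L ℤ.* (((+ 1 ℤ.+ K) ℤ.* (+ 2 ℤ.+ K)) ℤ.* ((+ 3 ℤ.+ + 2 ℤ.* K) ℤ.* Y) ℤ.-
             ((+ 3 ℤ.+ K) ℤ.* (+ 2 ℤ.+ K)) ℤ.* Y) ≡
             ((+ 2 ℤ.* K ℤ.* (+ 2 ℤ.+ K)) ℤ.* (+ 2 ℤ.+ K)) ℤ.* (L ℤ.* Y)
  simplify = ℤ-solve

  self-choose : (k + 0) choose k ≡ 1
  self-choose = trans (cong (_choose k) (+-identityʳ k)) (nCn≡1 k)

  v≡ : v ≡ + (suc (k + (2 + k)) choose k)
  v≡ = ℤ.*-cancelˡ-≡ (+ (suc k * (2 + k))) v _ (begin
    + (suc k * (2 + k)) ℤ.* v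
      ≡⟨ uniform-top-even 0 k ⟩
    + (V * (((k + 0) choose k) * (suc k * (2 + k) + k * 0)))
      ≡⟨ cong₂ (λ x y → + (V * (x * (suc k * (2 + k) + y)))) self-choose (*-zeroʳ k) ⟩
    + (V * (1 * (suc k * (2 + k) + 0)))
      ≡⟨ cong (λ x → + (V * x)) (trans (*-identityˡ _) (+-identityʳ (suc k * (2 + k)))) ⟩
    + (V * (suc k * (2 + k)))
      ≡⟨ cong +_ (*-comm V (suc k * (2 + k))) ⟩
    + ((suc k * (2 + k)) * V)
      ≡⟨ ℤ.pos-* (suc k * (2 + k)) V ⟩
    + (suc k * (2 + k)) ℤ.* + V ∎)
    where
    V = suc (k + (2 + k)) choose k

  scaled-v : + (3 + k) ℤ.* v ≡ (+ 3 ℤ.+ + 2 ℤ.* + k) ℤ.* + Y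
  scaled-v = begin
    + (3 + k) ℤ.* v
      ≡⟨ cong (λ x → + (3 + k) ℤ.* x) v≡ ⟩
    + (3 + k) ℤ.* + (suc (k + (2 + k)) choose k)
      ≡⟨ ℤ.pos-* (3 + k) (suc (k + (2 + k)) choose k) ⟨
    + ((3 + k) * (suc (k + (2 + k)) choose k))
      ≡⟨ cong +_ (absorption-right k (2 + k)) ⟩
    + (suc (k + (2 + k)) * Y)
      ≡⟨ cong (λ x → + (x * Y)) (index k) ⟩
    + ((3 + 2 * k) * Y)
      ≡⟨ ℤ.pos-* (3 + 2 * k) Y ⟩
    + (3 + 2 * k) ℤ.* + Y
      ≡⟨ cong (λ x → (+ 3 ℤ.+ x) ℤ.* + Y) (ℤ.pos-* 2 k) ⟩
    (+ 3 ℤ.+ + 2 ℤ.* + k) ℤ.* + Y ∎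
    where
    index : ∀ k → suc (k + (2 + k)) ≡ 3 + 2 * k
    index = solve-∀

  scaled-w : + suc k ℤ.* w ≡ + Y
  scaled-w = begin
    + suc k ℤ.* w
      ≡⟨ uniform-top-odd 0 k ⟩
    + ((suc (k + suc k) choose k) * ((k + 0) choose k))
      ≡⟨ cong₂ (λ r x → + ((r choose k) * x)) (sym (+-suc k (suc k))) self-choose ⟩
    + (Y * 1)
      ≡⟨ cong +_ (*-identityʳ Y) ⟩
    + Y ∎

open import Data.Nat.Divisibility using (_∣_; _∣?_; divides; m∣m*n; ∣m+n∣m⇒∣n)

Exceptional : (m d ℓ : ℕ) → Set
Exceptional m d ℓ = (m ≡ 1 × 3 ≤ d × ¬ (2 ∣ d) × ℓ ≡ 1) ⊎ (m ≡ 4 × d ≡ 3 × ℓ ≡ 7)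

odd-∤ : ∀ k → ¬ (2 ∣ (k + suc k))
odd-∤ k 2∣ = from-no (2 ∣? 1) (∣m+n∣m⇒∣n {2} {2 * k} {1} (subst (2 ∣_) (index k) 2∣) (m∣m*n k))
  where
  index : ∀ k → k + suc k ≡ 2 * k + 1
  index = solve-∀

even-∣ : ∀ k → 2 ∣ (k + (2 + k))
even-∣ k = divides (suc k) (index k)
  where
  index : ∀ k → k + (2 + k) ≡ suc k * 2
  index = solve-∀

theorem5p2 : (KL : KazhdanLusztig) →
    ∀ {n} (M : Matroid n) (m d ℓ : ℕ) →
    Loopless M → SparsePaving M →
    rank M ≡ d → ∣ E M ∣ ≡ m + d → 1 ≤ m → 1 ≤ d →
    length (circuitHyperplanes M) ≡ ℓ →
    KazhdanLusztig.Degenerate KL M ⇔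
    ((m ≡ 1 × 3 ≤ d × ¬ (2 ∣ d) × ℓ ≡ 1) ⊎ (m ≡ 4 × d ≡ 3 × ℓ ≡ 7))
theorem5p2 KL M (suc m) d ℓ loopless sparse rk≡ card≡ 1≤m 1≤d length≡ =
  conclude (odd-or-even d 1≤d)
  where
  open KazhdanLusztig KL

  sp : IsSparsePaving M (suc m) d
  sp = sparsePaving⇒ M sparse rk≡ card≡ 1≤d

  nonBases≡ : nonBases M d ≡ + ℓ
  nonBases≡ = trans (sym (nonBases-length M sp)) (cong +_ length≡)

  open SparsePavingBounds sp 1≤d ℓ nonBases≡

  coefficient : ∀ k → coeff (P M) k ≡ topCoefficient (suc m) d ℓ k
  coefficient k = trans (sparsePaving-coefficients KL d 1≤d M loopless sp k)
    (cong (λ x → uniform (suc m) d k ℤ.- x ℤ.* defect d k) nonBases≡)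

  degenerate⇔ : ∀ k → ⌊ d ∸ 1 /2⌋ ≡ k → d ≤ 2 * suc k →
                (Degenerate M → topCoefficient (suc m) d ℓ k ≡ 0ℤ) × (topCoefficient (suc m) d ℓ k ≡ 0ℤ → Degenerate M)
  degenerate⇔ k half≡ d≤ =
    -- Degrees above `k` are excluded anyway, so having degree `k` amounts to a nonzero coefficient
    -- there; decidable equality removes the double negation.
    (λ degenerate → trans (sym (coefficient k)) (decidable-stable (coeff (P M) k ℤ.≟ 0ℤ) (λ ≢0 →
      degenerate (subst (HasDegree (P M)) (sym half-rank) (≢0 , λ j k<j →
        P-degree KL M loopless (subst (0 <_) (sym rk≡) 1≤d) j (≤-trans (≤-reflexive rk≡) (≤-trans d≤ (*-monoʳ-≤ 2 k<j)))))))) ,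
    (λ top≡0 (≢0 , _) → ≢0 (trans (cong (coeff (P M)) half-rank) (trans (coefficient k) top≡0)))
    where
    half-rank : ⌊ rank M ∸ 1 /2⌋ ≡ k
    half-rank = trans (cong (λ r → ⌊ r ∸ 1 /2⌋) rk≡) half≡

  odd-case : ∀ k → d ≡ k + suc k → Degenerate M ⇔ Exceptional (suc m) d ℓ
  odd-case k refl = mk⇔ (λ degenerate → to k refl (proj₁ (top-odd m k ℓ) (proj₁ at-top degenerate)))
                        (λ exceptional → proj₂ at-top (proj₂ (top-odd m k ℓ) (from exceptional)))
    where
    at-top = degenerate⇔ k (trans (cong (λ r → ⌊ r ∸ 1 /2⌋) (+-suc k k)) (sym (n≡⌊n+n/2⌋ k)))
               (≤-trans (+-monoˡ-≤ (suc k) (n≤1+n k)) (≤-reflexive (cong (λ r → suc k + r) (sym (+-identityʳ (suc k))))))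

    to : ∀ j → j ≡ k → ((suc m + (k + suc k)) choose k) * ((k + m) choose k) ≡ ℓ * (suc (k + suc k) choose k) →
         Exceptional (suc m) (k + suc k) ℓ
    -- In rank one a loopless matroid has no circuit-hyperplanes, so the condition would read 1 = 0.
    -- This is what forces d ≥ 3.
    to zero    refl top≡ = contradiction (trans top≡ (cong (_* 1) ℓ≡0)) λ ()
      where
      ℓ≡0 : ℓ ≡ 0
      ℓ≡0 = ℤ.+-injective (trans (sym nonBases≡) (nonBases-0 M 1 (nonBases-loopless M loopless)))
    to (suc j) refl top≡ with odd-solutions k m ℓ z<s top≡
      (subst (λ r → ℓ * (k + suc k) ≤ (suc m + (k + suc k)) choose r) (cong pred (+-suc k k)) small-bound) large-bound
    ... | inj₁ (m≡0 , ℓ≡1)           = inj₁ (cong suc m≡0 , s≤s (≤-trans (s≤s (s≤s z≤n)) (m≤n+m (suc (suc j)) j)) , odd-∤ k , ℓ≡1)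
    ... | inj₂ (refl , refl , ℓ≡7) = inj₂ (refl , refl , ℓ≡7)

    from : Exceptional (suc m) (k + suc k) ℓ →
           ((suc m + (k + suc k)) choose k) * ((k + m) choose k) ≡ ℓ * (suc (k + suc k) choose k)
    from (inj₁ (refl , _ , _ , refl)) = trans
      (cong (λ x → (suc (k + suc k) choose k) * x) (trans (cong (_choose k) (+-identityʳ k)) (nCn≡1 k)))
      (*-comm (suc (k + suc k) choose k) 1)
    from (inj₂ (refl , d≡3 , refl)) = subst
      (λ k → ((4 + (k + suc k)) choose k) * ((k + 3) choose k) ≡ 7 * (suc (k + suc k) choose k)) (k≡1 k d≡3) refl
      where
      k≡1 : ∀ k → k + suc k ≡ 3 → 1 ≡ k
      k≡1 1 _ = refl
      k≡1 (suc (suc k)) eq = contradiction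
        (trans (sym (+-suc k (suc k))) (suc-injective (trans (sym (+-suc k (2 + k))) (suc-injective (suc-injective eq))))) 1+n≢0

  even-case : ∀ k → d ≡ k + (2 + k) → Degenerate M ⇔ Exceptional (suc m) d ℓ
  even-case k refl = mk⇔ (λ degenerate → ⊥-elim (to k refl (proj₁ at-top degenerate))) (λ exceptional → ⊥-elim (from exceptional))
    where
    at-top = degenerate⇔ k
      (trans (cong (λ r → ⌊ r ∸ 1 /2⌋) (+-suc k (suc k))) (trans (cong ⌊_/2⌋ (+-suc k k)) (sym (n≡⌈n+n/2⌉ k))))
      (≤-reflexive (trans (+-suc k (suc k)) (cong (λ r → suc k + r) (sym (+-identityʳ (suc k))))))

    to : ∀ j → j ≡ k → ¬ topCoefficient (suc m) (k + (2 + k)) ℓ k ≡ 0ℤ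
    -- In rank two the top coefficient is the constant one: the defect there is 1 - 1 = 0, so it
    -- remains 1 for every ℓ.
    to zero    refl top≡0 = contradiction (trans (sym (cong (λ x → 1ℤ ℤ.- x) (ℤ.*-zeroʳ (+ ℓ)))) top≡0) λ ()
    to (suc j) refl top≡0 = even-no-solutions k m ℓ z<s (top-even m k ℓ top≡0)
      (subst (λ r → ℓ * (k + (2 + k)) ≤ (suc m + (k + (2 + k))) choose r) (cong pred (+-suc k (suc k))) small-bound) large-bound

    from : ¬ Exceptional (suc m) (k + (2 + k)) ℓ
    from (inj₁ (_ , _ , 2∤d , _)) = 2∤d (even-∣ k)
    from (inj₂ (_ , d≡3 , _))     = from-no (2 ∣? 3) (subst (2 ∣_) d≡3 (even-∣ k))

  conclude : (∃ λ k → d ≡ k + suc k ⊎ d ≡ k + (2 + k)) → Degenerate M ⇔ Exceptional (suc m) d ℓ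
  conclude (k , inj₁ odd)  = odd-case k odd
  conclude (k , inj₂ even) = even-case k even
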